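{- There is a constant $c>0$ such that for every integer $k\ge 2$ there exist at least $2^{c\cdot 3^k}$ graphs, pairwise not locally equivalent, each of which is vertex-minor minimal with the property of having linear rank-width larger than $k$. In other words, $2^{\Omega(3^k)}$ such graphs exist. Consequently, any finite set $\mathcal O_k$ of graphs such that a graph has linear rank-width at most $k$ if and only if it has no vertex-minor isomorphic to a member of $\mathcal O_k$ satisfies $|\mathcal O_k|\ge 2^{\Omega(3^k)}$.
   Context: All graphs are finite and simple. For a graph $G$ and $X\subseteq V(G)$, $\mathrm{cutrk}_G(X)$ is the rank over the binary field of the submatrix of the adjacency matrix of $G$ with rows indexed by $X$ and columns indexed by $V(G)\setminus X$. A linear layout of $G$ is a linear ordering $(v_1,\dots,v_n)$ of $V(G)$. Its width is $\max_{1\le i\le n}\mathrm{cutrk}_G(\{v_1,\dots,v_i\})$, and the width is taken to be $0$ if $n\le 1$. The linear rank-width of $G$ is the minimum width over all linear layouts of $G$. The local complementation at a vertex $v$ produces the graph $G*v$ obtained from $G$ by replacing the induced subgraph on the neighborhood $N_G(v)$ by its complement. A graph $H$ is a vertex-minor of $G$ if $H$ can be obtained from $G$ by a sequence of vertex deletions and local complementations. Two graphs are locally equivalent if one can be obtained from the other by a sequence of local complementations. A graph $G$ is vertex-minor minimal with a property if $G$ has the property and no vertex-minor of $G$ with fewer vertices has it. -}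

module Defs where

open import Data.Nat using (ℕ; zero; suc; _<_; _≤_; _<?_; _%_)
open import Data.Bool using (Bool; true; false; _∧_; _xor_; if_then_else_)
open import Data.Fin using (Fin; toℕ; punchIn; _≟_)
open import Data.Fin.Subset using (Subset; _⊆_; _∉_; _∩_; ∣_∣; Nonempty)
open import Data.Fin.Permutation using (Permutation′; _⟨$⟩ˡ_)
open import Data.Vec using (tabulate)
open import Data.Product using (Σ; ∃; _×_; _,_; proj₂)
open import Data.List using (List)
open import Data.List.Membership.Propositional using (_∈_)
open import Function.Bundles using (_↔_; Inverse)
open import Relation.Nullary using (¬_; does)
open import Relation.Binary.PropositionalEquality using (_≡_)

Graph : ℕ → Set
Graph n = Fin n → Fin n → Bool

Simple : ∀ {n} → Graph n → Set
Simple G = (∀ x y → G x y ≡ G y x) × (∀ x → G x x ≡ false)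

N : ∀ {n} → Graph n → Fin n → Subset n
N G y = tabulate (λ x → G x y)

-- A set S of rows (S ⊆ X) of the X × (V∖X) submatrix is linearly
-- independent over GF(2) iff no nonempty subset T ⊆ S has zero sum,
-- i.e. for every nonempty T ⊆ S some column y ∉ X has an odd number
-- of ones in the rows of T.
RowsIndependent : ∀ {n} → Graph n → Subset n → Subset n → Set
RowsIndependent G X S =
  ∀ (T : Subset n) → T ⊆ S → Nonempty T →
    ∃ λ y → y ∉ X × ∣ T ∩ N G y ∣ % 2 ≡ 1
  where n = _

-- cutrk_G(X) ≤ k : the GF(2)-rank (= maximum number of linearly
-- independent rows) of the X × (V∖X) adjacency submatrix is at most k.
CutrkLe : ∀ {n} → Graph n → Subset n → ℕ → Set
CutrkLe {n} G X k =
  ∀ (S : Subset n) → S ⊆ X → RowsIndependent G X S → ∣ S ∣ ≤ k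

-- A linear layout is a permutation σ; σ ⟨$⟩ʳ i is the vertex at
-- position i, so σ ⟨$⟩ˡ x is the position of vertex x.
-- prefix σ i = {v_1,…,v_i}
prefix : ∀ {n} → Permutation′ n → ℕ → Subset n
prefix σ i = tabulate (λ x → does (toℕ (σ ⟨$⟩ˡ x) <? i))

LayoutWidthLe : ∀ {n} → Graph n → Permutation′ n → ℕ → Set
LayoutWidthLe G σ k = ∀ i → CutrkLe G (prefix σ i) k

LrwLe : ℕ → ∀ {n} → Graph n → Set
LrwLe k {n} G = Σ (Permutation′ n) λ σ → LayoutWidthLe G σ k

LrwGt : ℕ → ∀ {n} → Graph n → Set
LrwGt k G = ¬ LrwLe k G

-- G * v : complement the induced subgraph on N(v)
-- (diagonal left unchanged; v ∉ N(v) for loopless G)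
lc : ∀ {n} → Graph n → Fin n → Graph n
lc G v x y = if does (x ≟ y) then G x y else (G x y xor (G v x ∧ G v y))

del : ∀ {n} → Graph (suc n) → Fin (suc n) → Graph n
del G v x y = G (punchIn v x) (punchIn v y)

data VertexMinor : ∀ {m n} → Graph m → Graph n → Set where
  vm-refl : ∀ {n} {G : Graph n} → VertexMinor G G
  vm-lc   : ∀ {m n} {G : Graph m} {H : Graph n} (v : Fin m) →
            VertexMinor (lc G v) H → VertexMinor G H
  vm-del  : ∀ {m n} {G : Graph (suc m)} {H : Graph n} (v : Fin (suc m)) →
            VertexMinor (del G v) H → VertexMinor G H

data LocallyEquivalent {n} : Graph n → Graph n → Set where
  le-refl : ∀ {G} → LocallyEquivalent G G
  le-lc   : ∀ {G H} (v : Fin n) →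
            LocallyEquivalent (lc G v) H → LocallyEquivalent G H

Iso : ∀ {m n} → Graph m → Graph n → Set
Iso {m} {n} G H =
  Σ (Fin m ↔ Fin n) λ f → ∀ x y → G x y ≡ H (Inverse.to f x) (Inverse.to f y)

LocEqUpToIso : ∀ {m n} → Graph m → Graph n → Set
LocEqUpToIso {m} G H = ∃ λ (G' : Graph m) → LocallyEquivalent G G' × Iso G' H

VMMinimal : (P : ∀ {n} → Graph n → Set) → ∀ {n} → Graph n → Set
VMMinimal P {n} G =
  P G × (∀ {m} (H : Graph m) → VertexMinor G H → m < n → ¬ P H)

AGraph : Set
AGraph = Σ ℕ Graph

HasVMIn : ∀ {n} → Graph n → List AGraph → Set
HasVMIn G O = ∃ λ (mH : AGraph) → mH ∈ O ×
  ∃ λ (m : ℕ) → ∃ λ (H : Graph m) → VertexMinor G H × Iso H (proj₂ mH)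

{-# OPTIONS --safe #-}
-- The graphs are built by recursion: start with K₂ and repeatedly join three graphs of the
-- previous level by a triangle on one root vertex of each.
--
-- Ranks of cuts over GF(2) are bounded above by factorizations (Fac) and below by triangular
-- submatrices (Tri), both of which behave well under joining.  Of three parts laid out one
-- after the other, the middle one together with an edge of the connected union of the other
-- two has rank one more than the part alone, so the linear rank-width grows with the level.
-- Once a vertex v is deleted, its part fits between the other two within the smaller width,
-- and this holds for each of the three ways of removing v up to local equivalence (Bord).
--
-- Local equivalence preserves the rank of every cut.  If every vertex of a graph H gets a
-- pendant neighbour, the cut ranks determine H, so that it suffices to count nonisomorphic
-- triangle cacti; when all roots are chosen of maximum degree, the central triangle can be
-- read off the degrees, and the children are recovered from the cactus recursively.

module Submission where

open import Defs
open import Data.Bool using (Bool; true; false; not; _∧_; _∨_; _xor_; if_then_else_)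
open import Data.Bool.Properties using (xor-identityʳ; xor-same; xor-assoc; xor-comm; ∧-distribˡ-xor; ∧-distribʳ-xor; ∧-zeroʳ; ∧-comm; ∧-assoc; not-involutive) renaming (_≟_ to _≟ᵇ_)
open import Data.Empty using (⊥; ⊥-elim)
open import Data.Fin as Fin using (Fin; zero; suc; toℕ; fromℕ<; inject₁; punchIn; punchOut; splitAt; remQuot; combine; _≟_)
open import Data.Fin.Patterns using (0F; 1F; 2F)
open import Data.Fin.Permutation using (Permutation′; permutation; transpose; _⟨$⟩ˡ_; _⟨$⟩ʳ_; inverseˡ; inverseʳ)
open import Data.Fin.Properties using (any?; pigeonhole; injective⇒≤; punchIn-injective; punchInᵢ≢i; punchOut-injective; toℕ-injective; toℕ-fromℕ<; toℕ<n; toℕ≤pred[n]; combine-remQuot; join-splitAt; *↔×; 2↔Bool)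
open import Data.Fin.Subset as Subset using (Subset; _⊆_; _∈_; _∉_; _∩_; _∪_; _-_; ∣_∣; Nonempty; ⁅_⁆)
import Data.Fin.Subset.Properties as Sub
open import Data.List as List using (List; []; _∷_; _++_; length; map; filter; allFin; cartesianProduct)
open import Data.List.Membership.Propositional using () renaming (_∈_ to _∈ₗ_)
open import Data.List.Membership.Propositional.Properties using (∈-filter⁺; ∈-cartesianProduct⁺; ∈-allFin)
open import Data.List.Properties using (length-map; length-++)
open import Data.List.Relation.Unary.All as All using (All; []; _∷_)
import Data.List.Relation.Unary.All.Properties as Allₚ
open import Data.List.Relation.Unary.AllPairs using ([]; _∷_)
open import Data.List.Relation.Unary.Any as Any using (here; there)
open import Data.List.Relation.Unary.Any.Properties using (lookup-index)
open import Data.List.Relation.Unary.Unique.Propositional using (Unique)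
import Data.List.Relation.Unary.Unique.Propositional.Properties as Uniqueₚ
open import Data.Nat using (ℕ; zero; suc; _+_; _*_; _∸_; _^_; _<_; _≤_; z≤n; s≤s; _<?_; _≤?_; _%_)
open import Data.Nat.DivMod using ([m+n]%n≡m%n)
open import Data.Nat.Properties as ℕₚ using (≤-refl; ≤-trans)
open import Data.Product using (Σ; ∃; _×_; _,_; proj₁; proj₂)
open import Data.Product.Function.NonDependent.Propositional using (_×-↔_)
open import Data.Product.Properties using (≡-dec)
open import Data.Sum as Sum using (_⊎_; inj₁; inj₂)
open import Data.Unit using (⊤; tt)
import Data.Unit.Properties as Unit
open import Data.Vec as Vec using (Vec; []; _∷_; zipWith; replicate; lookup; tabulate; head; tail; here; there)
open import Data.Vec.Properties using (lookup∘tabulate; lookup⇒[]=; []=⇒lookup)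
open import Function using (_∘_; id; case_of_)
open import Function.Bundles using (_↔_; _⇔_; Inverse; Equivalence; mk↔ₛ′)
open import Function.Construct.Composition using (_↔-∘_)
open import Function.Construct.Identity using (↔-id)
open import Relation.Binary.Definitions using (DecidableEquality; tri<; tri≈; tri>)
open import Relation.Binary.PropositionalEquality using (_≡_; _≢_; refl; sym; trans; cong; cong₂; subst)
open import Relation.Nullary using (¬_; Dec; yes; no; does; contradiction)
open import Relation.Nullary.Decidable using (dec-true; dec-false; ¬?; _×-dec_)


-- Vectors over GF(2)

-- The obstacle to minimality is that local complementations may precede the first deletion, and
-- they leave the class of joins. The three ways of removing `v` are therefore coded by two bits
-- `(s , d)` other than `(0 , 0)`. Complementing only permutes these codes, and so does passing from
-- a join to one of its parts, so a bound for all vertices and all codes is stable under both.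
--
-- Joining raises the width by only one because a part meets the others through its root alone. Laid
-- out first or last, a part sees the other roots as a single extra column, and the induction
-- carries layouts that have room for this column. Only the middle part pays one dimension for the
-- edges between parts.
--
-- Isomorphisms may permute the three children of a fork. Boolean tags prevent this, so the number
-- of distinguished cacti is cubed at each level. Five levels are spent before this growth starts,
-- hence c = 1/3^5, written without real numbers as `2 ^ (3 ^ k)` ≤ `L ^ 243`. Below level 5 two
-- graphs are enough.

true≢false : true ≢ false
true≢false ()

F₂^ : ℕ → Set
F₂^ = Vec Bool

infixl 6 _⊕_
infixr 7 _·_

_⊕_ : ∀ {r} → F₂^ r → F₂^ r → F₂^ r
_⊕_ = zipWith _xor_

_·_ : ∀ {r} → Bool → F₂^ r → F₂^ r
b · p = Vec.map (b ∧_) p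

𝟎 : ∀ {r} → F₂^ r
𝟎 = replicate _ false

dot : ∀ {r} → F₂^ r → F₂^ r → Bool
dot []      []      = false
dot (a ∷ p) (b ∷ q) = (a ∧ b) xor dot p q

xor-swap : ∀ a b c d → (a xor b) xor (c xor d) ≡ (a xor c) xor (b xor d)
xor-swap false false c d     = refl
xor-swap false true  false d = refl
xor-swap false true  true  d = refl
xor-swap true  false c d     = sym (notˡ c d)
  where
  notˡ : ∀ c d → not c xor d ≡ not (c xor d)
  notˡ false d = refl
  notˡ true  d = sym (not-involutive d)
xor-swap true  true  false d = sym (not-involutive d)
xor-swap true  true  true  d = refl

dot-comm : ∀ {r} (p q : F₂^ r) → dot p q ≡ dot q p
dot-comm []      []      = refl
dot-comm (a ∷ p) (b ∷ q) = cong₂ _xor_ (∧-comm a b) (dot-comm p q)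

dot-⊕ˡ : ∀ {r} (p p′ q : F₂^ r) → dot (p ⊕ p′) q ≡ dot p q xor dot p′ q
dot-⊕ˡ []      []        []      = refl
dot-⊕ˡ (a ∷ p) (a′ ∷ p′) (b ∷ q) = trans
  (cong₂ _xor_ (∧-distribʳ-xor b a a′) (dot-⊕ˡ p p′ q))
  (xor-swap (a ∧ b) (a′ ∧ b) (dot p q) (dot p′ q))

dot-·ˡ : ∀ {r} b (p q : F₂^ r) → dot (b · p) q ≡ b ∧ dot p q
dot-·ˡ b []      []      = sym (∧-zeroʳ b)
dot-·ˡ b (a ∷ p) (c ∷ q) = trans
  (cong₂ _xor_ (∧-assoc b a c) (dot-·ˡ b p q))
  (sym (∧-distribˡ-xor b (a ∧ c) (dot p q)))

dot-𝟎ˡ : ∀ {r} (q : F₂^ r) → dot 𝟎 q ≡ false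
dot-𝟎ˡ []      = refl
dot-𝟎ˡ (_ ∷ q) = dot-𝟎ˡ q

dot-𝟎ʳ : ∀ {r} (p : F₂^ r) → dot p 𝟎 ≡ false
dot-𝟎ʳ p = trans (dot-comm p 𝟎) (dot-𝟎ˡ p)

dot-⊕·ˡ : ∀ {r} (p : F₂^ r) b p′ q → dot (p ⊕ b · p′) q ≡ dot p q xor (b ∧ dot p′ q)
dot-⊕·ˡ p b p′ q = trans (dot-⊕ˡ p (b · p′) q) (cong (dot p q xor_) (dot-·ˡ b p′ q))

dot-⊕·ʳ : ∀ {r} (p q : F₂^ r) b q′ → dot p (q ⊕ b · q′) ≡ dot p q xor (b ∧ dot p q′)
dot-⊕·ʳ p q b q′ = trans (dot-comm p (q ⊕ b · q′)) (trans (dot-⊕·ˡ q b q′ p)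
  (cong₂ (λ u v → u xor (b ∧ v)) (dot-comm q p) (dot-comm q′ p)))

dot-·ʳ : ∀ {r} b (p q : F₂^ r) → dot p (b · q) ≡ b ∧ dot p q
dot-·ʳ b p q = trans (dot-comm p (b · q)) (trans (dot-·ˡ b q p) (cong (b ∧_) (dot-comm q p)))

-- The hyperplane orthogonal to w ≠ 0 has dimension one less: dot products with
-- its elements can be computed after dropping a coordinate where w is nonzero.
record Reduction {r} (w : F₂^ (suc r)) : Set where
  field
    redˡ redʳ : F₂^ (suc r) → F₂^ r
    red-dot   : ∀ p q → dot p w ≡ false → dot (redˡ p) (redʳ q) ≡ dot p q

reduction : ∀ {r} (u w : F₂^ (suc r)) → dot u w ≡ true → Reduction w
reduction (a ∷ u) (true ∷ w) _ = record
  { redˡ    = λ { (_ ∷ p) → p }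
  ; redʳ    = λ { (b ∷ q) → q ⊕ b · w }
  ; red-dot = λ { (a ∷ p) (b ∷ q) e → trans (dot-⊕·ʳ p q b w) (lemma a b (dot p q) (dot p w) e) }
  }
  where
  lemma : ∀ a b c d → (a ∧ true) xor d ≡ false → c xor (b ∧ d) ≡ (a ∧ b) xor c
  lemma false b     c     false _ = trans (cong (c xor_) (∧-zeroʳ b)) (xor-identityʳ c)
  lemma true  false c     true  _ = xor-identityʳ c
  lemma true  true  false true  _ = refl
  lemma true  true  true  true  _ = refl
reduction {zero}  (a ∷ []) (false ∷ []) e = contradiction (trans (sym e) (trans (xor-identityʳ _) (∧-zeroʳ a))) true≢false
reduction {suc r} (a ∷ u) (false ∷ w) e = record
  { redˡ    = λ { (b ∷ p) → b ∷ redˡ p }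
  ; redʳ    = λ { (b ∷ q) → b ∷ redʳ q }
  ; red-dot = λ { (a ∷ p) (b ∷ q) e′ → cong ((a ∧ b) xor_) (red-dot p q (trans (cong (_xor dot p w) (sym (∧-zeroʳ a))) e′)) }
  }
  where open Reduction (reduction u w (trans (cong (_xor dot u w) (sym (∧-zeroʳ a))) e))

-- Certificates for upper and lower bounds on the rank of a cut

Gr : Set → Set
Gr V = V → V → Bool

Sym Irr : ∀ {V} → Gr V → Set
Sym G = ∀ x y → G x y ≡ G y x
Irr G = ∀ x → G x x ≡ false

record Fac {V : Set} (r : ℕ) (G : Gr V) (X : V → Bool) : Set where
  constructor fac
  field
    row col : V → F₂^ r
    factor  : ∀ {x y} → X x ≡ true → X y ≡ false → G x y ≡ dot (row x) (col y)

Fac-cong : ∀ {V r} {G H : Gr V} {X Y : V → Bool} → (∀ x y → G x y ≡ H x y) → (∀ x → X x ≡ Y x) → Fac r G X → Fac r H Y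
Fac-cong G≡H X≡Y (fac p q e) = fac p q λ {x} {y} Yx Yy →
  trans (sym (G≡H x y)) (e (trans (X≡Y x) Yx) (trans (X≡Y y) Yy))

Fac-pull : ∀ {V W r} {G : Gr V} {X : V → Bool} (f : W → V) → Fac r G X → Fac r (λ x y → G (f x) (f y)) (X ∘ f)
Fac-pull f (fac p q e) = fac (p ∘ f) (q ∘ f) e

not-true : ∀ {b} → not b ≡ true → b ≡ false
not-true {false} _ = refl

not-false : ∀ {b} → not b ≡ false → b ≡ true
not-false {true} _ = refl

Fac-transpose : ∀ {V r} {G : Gr V} {X : V → Bool} → Sym G → Fac r G X → Fac r G (not ∘ X)
Fac-transpose G-sym (fac p q e) = fac q p λ {x} {y} ¬Xx ¬Xy →
  trans (G-sym x y) (trans (e (not-false ¬Xy) (not-true ¬Xx)) (dot-comm (p y) (q x)))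

data Tri {V : Set} (G : Gr V) (X : V → Bool) : List (V × V) → Set where
  []   : Tri G X []
  step : ∀ {u w l} → X u ≡ true → X w ≡ false → G u w ≡ true → All (λ z → G u (proj₂ z) ≡ false) l →
         Tri G X l → Tri G X ((u , w) ∷ l)

Tri-map : ∀ {V W} {G : Gr V} {H : Gr W} {X : V → Bool} {Y : W → Bool} (f : V → W) →
  (∀ x y → H (f x) (f y) ≡ G x y) → (∀ x → Y (f x) ≡ X x) →
  ∀ {l} → Tri G X l → Tri H Y (map (λ z → f (proj₁ z) , f (proj₂ z)) l)
Tri-map f HG YX []                 = []
Tri-map {G = G} {H} f HG YX (step {u} a b c ds t) = step (trans (YX _) a) (trans (YX _) b) (trans (HG _ _) c) (go ds) (Tri-map f HG YX t)
  where
  go : ∀ {l} → All (λ z → G u (proj₂ z) ≡ false) l → All (λ z → H (f u) (proj₂ z) ≡ false) (map (λ z → f (proj₁ z) , f (proj₂ z)) l)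
  go []       = []
  go (d ∷ ds) = trans (HG _ _) d ∷ go ds

Tri≤Fac : ∀ {V r} {G : Gr V} {X : V → Bool} {l} → Tri G X l → Fac r G X → length l ≤ r
Tri≤Fac {V} {r} {G} {X} t (fac p q e) = go p q (λ y → X y ≡ false) e t (cols t)
  where
  cols : ∀ {l} → Tri G X l → All (λ z → X (proj₂ z) ≡ false) l
  cols []                = []
  cols (step _ Xw _ _ t) = Xw ∷ cols t
  go : ∀ {r} (p q : V → F₂^ r) (Q : V → Set) → (∀ {x y} → X x ≡ true → Q y → G x y ≡ dot (p x) (q y)) →
       ∀ {l} → Tri G X l → All (Q ∘ proj₂) l → length l ≤ r
  go p q Q e [] _ = z≤n
  go {zero} p q Q e (step {u} {w} Xu _ Guw _ _) (Qw ∷ _) =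
    contradiction (trans (sym Guw) (trans (e Xu Qw) (dot-[] (p u) (q w)))) true≢false
    where
    dot-[] : (a b : F₂^ 0) → dot a b ≡ false
    dot-[] [] [] = refl
  go {suc r} p q Q e (step {u} {w} Xu _ Guw zs t) (Qw ∷ Qs) =
    s≤s (go (redʳ ∘ p) (redˡ ∘ q) (λ y → Q y × G u y ≡ false) e′ t (All.zip (Qs , zs)))
    where
    open Reduction (reduction (q w) (p u) (trans (dot-comm (q w) (p u)) (trans (sym (e Xu Qw)) Guw)))
    e′ : ∀ {x y} → X x ≡ true → Q y × G u y ≡ false → G x y ≡ dot (redʳ (p x)) (redˡ (q y))
    e′ {x} {y} Xx (Qy , Guy) = trans (e Xx Qy) (trans (dot-comm (p x) (q y)) (trans
      (sym (red-dot (q y) (p x) (trans (dot-comm (q y) (p u)) (trans (sym (e Xu Qy)) Guy))))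
      (dot-comm (redˡ (q y)) (redʳ (p x)))))

-- Comparison with CutrkLe

parity : ∀ {n} → Subset n → (Fin n → Bool) → Bool
parity []      f = false
parity (b ∷ T) f = (b ∧ f zero) xor parity T (f ∘ suc)

parity-cong : ∀ {n} (T : Subset n) {f g : Fin n → Bool} → (∀ {x} → x ∈ T → f x ≡ g x) → parity T f ≡ parity T g
parity-cong []          e = refl
parity-cong (true  ∷ T) e = cong₂ _xor_ (e here) (parity-cong T (e ∘ there))
parity-cong (false ∷ T) e = parity-cong T (e ∘ there)

parity-xor : ∀ {n} (T : Subset n) (f g : Fin n → Bool) → parity T (λ x → f x xor g x) ≡ parity T f xor parity T g
parity-xor []      f g = refl
parity-xor (b ∷ T) f g = trans
  (cong₂ _xor_ (∧-distribˡ-xor b (f zero) (g zero)) (parity-xor T (f ∘ suc) (g ∘ suc)))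
  (xor-swap (b ∧ f zero) (b ∧ g zero) _ _)

parity-∧ : ∀ {n} (T : Subset n) (f : Fin n → Bool) c → parity T (λ x → f x ∧ c) ≡ parity T f ∧ c
parity-∧ []      f c = refl
parity-∧ (b ∷ T) f c = trans
  (cong₂ _xor_ (sym (∧-assoc b (f zero) c)) (parity-∧ T (f ∘ suc) c))
  (sym (∧-distribʳ-xor c (b ∧ f zero) _))

parity-false : ∀ {n} (T : Subset n) → parity T (λ _ → false) ≡ false
parity-false []      = refl
parity-false (b ∷ T) = trans (cong (_xor parity T (λ _ → false)) (∧-zeroʳ b)) (parity-false T)

odd : ℕ → Bool
odd zero    = false
odd (suc n) = not (odd n)

odd-%2 : ∀ n → n % 2 ≡ 1 → odd n ≡ true
odd-%2 (suc zero)    _ = refl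
odd-%2 (suc (suc n)) e = trans (not-involutive (odd n)) (odd-%2 n (trans (sym ([m+n]%n≡m%n′ n)) e))
  where
  [m+n]%n≡m%n′ : ∀ n → suc (suc n) % 2 ≡ n % 2
  [m+n]%n≡m%n′ n = trans (cong (_% 2) (ℕₚ.+-comm 2 n)) ([m+n]%n≡m%n n 2)

parity-∣∣ : ∀ {n} (T : Subset n) (f : Fin n → Bool) → parity T f ≡ odd ∣ T ∩ tabulate f ∣
parity-∣∣ []      f = refl
parity-∣∣ (false ∷ T) f = parity-∣∣ T (f ∘ suc)
parity-∣∣ (true ∷ T) f with f zero
... | true  = cong not (parity-∣∣ T (f ∘ suc))
... | false = parity-∣∣ T (f ∘ suc)

toggle : ∀ {n} → Fin n → Subset n → Subset n
toggle zero    (b ∷ T) = not b ∷ T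
toggle (suc x) (b ∷ T) = b ∷ toggle x T

parity-toggle : ∀ {n} (x : Fin n) (T : Subset n) f → parity (toggle x T) f ≡ f x xor parity T f
parity-toggle zero (true  ∷ T) f with f zero
... | true  = sym (not-involutive _)
... | false = refl
parity-toggle zero (false ∷ T) f = refl
parity-toggle (suc x) (b ∷ T) f = trans (cong ((b ∧ f zero) xor_) (parity-toggle x T (f ∘ suc)))
  (trans (sym (xor-assoc (b ∧ f zero) (f (suc x)) _)) (trans (cong (_xor parity T (f ∘ suc)) (xor-comm (b ∧ f zero) (f (suc x)))) (xor-assoc (f (suc x)) (b ∧ f zero) _)))

toggle-⊆ : ∀ {n} (x : Fin n) (T : Subset n) {y} → y ∈ toggle x T → y ≡ x ⊎ y ∈ T
toggle-⊆ zero    (b ∷ T) {zero}  _         = inj₁ refl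
toggle-⊆ zero    (b ∷ T) {suc y} (there m) = inj₂ (there m)
toggle-⊆ (suc x) (b ∷ T) {zero}  here      = inj₂ here
toggle-⊆ (suc x) (b ∷ T) {suc y} (there m) with toggle-⊆ x T m
... | inj₁ refl = inj₁ refl
... | inj₂ m′   = inj₂ (there m′)

toggle-≢ : ∀ {n} (x : Fin n) (T : Subset n) {y} → y ≢ x → y ∈ T → y ∈ toggle x T
toggle-≢ zero    (b ∷ T) {zero}  y≢x m         = contradiction refl y≢x
toggle-≢ zero    (b ∷ T) {suc y} y≢x (there m) = there m
toggle-≢ (suc x) (b ∷ T) {zero}  y≢x here      = here
toggle-≢ (suc x) (b ∷ T) {suc y} y≢x (there m) = there (toggle-≢ x T (y≢x ∘ cong suc) m)

∣p∣≤1+∣p-x∣ : ∀ {n} (p : Subset n) (x : Fin n) → ∣ p ∣ ≤ suc ∣ p - x ∣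
∣p∣≤1+∣p-x∣ (true  ∷ p) zero    = s≤s (ℕₚ.≤-reflexive (sym (cong ∣_∣ (Sub.p─⊥≡p p))))
∣p∣≤1+∣p-x∣ (false ∷ p) zero    = ℕₚ.m≤n⇒m≤1+n (ℕₚ.≤-reflexive (sym (cong ∣_∣ (Sub.p─⊥≡p p))))
∣p∣≤1+∣p-x∣ (true  ∷ p) (suc x) = s≤s (∣p∣≤1+∣p-x∣ p x)
∣p∣≤1+∣p-x∣ (false ∷ p) (suc x) = ∣p∣≤1+∣p-x∣ p x

nonempty : ∀ {n} (S : Subset n) → 0 < ∣ S ∣ → Nonempty S
nonempty (true  ∷ S) _ = zero , here
nonempty (false ∷ S) h with nonempty S h
... | x , m = suc x , there m

dot-∷ : ∀ {r} (p : F₂^ (suc r)) c₀ c → dot p (c₀ ∷ c) ≡ (head p ∧ c₀) xor dot (tail p) c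
dot-∷ (_ ∷ _) _ _ = refl

∈-⇒≢ : ∀ {n} (S : Subset n) x {y} → y ∈ S - x → y ≢ x
∈-⇒≢ (_ ∷ S) (suc x) (there m) refl = ∈-⇒≢ S x m refl
∈-⇒≢ (true  ∷ S) zero () refl
∈-⇒≢ (false ∷ S) zero () refl

∉⇒lookup : ∀ {n} {X : Subset n} {y} → y ∉ X → lookup X y ≡ false
∉⇒lookup {X = X} {y} y∉X with lookup X y in eq
... | true  = contradiction (lookup⇒[]= y X eq) y∉X
... | false = refl

lookup⇒∉ : ∀ {n} {X : Subset n} {y} → lookup X y ≡ false → y ∉ X
lookup⇒∉ e y∈X = true≢false (trans (sym ([]=⇒lookup y∈X)) e)

-- Gaussian elimination on the first coordinate. A pivot `x₀` clears the heads of the other vectors;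
-- a dependency `T` of the cleared tails is one of the original vectors up to a multiple of `p x₀`,
-- and toggling `x₀` in `T` removes that multiple.
dependent : ∀ {n} k (p : Fin n → F₂^ k) (S : Subset n) → k < ∣ S ∣ →
  Σ (Subset n) λ T → T ⊆ S × Nonempty T × (∀ c → parity T (λ x → dot (p x) c) ≡ false)
dependent zero p S h = S , id , nonempty S h , λ { [] → trans (parity-cong S λ {x} _ → dot-𝟎ʳ (p x)) (parity-false S) }
dependent {n} (suc k) p S h with any? (λ x → (x Sub.∈? S) ×-dec (head (p x) ≟ᵇ true))
... | no none = T , T⊆S , T≢∅ , λ { (c₀ ∷ c) → trans
        (parity-cong T λ {x} m → trans (dot-∷ (p x) c₀ c) (cong (λ b → (b ∧ c₀) xor dot (tail (p x)) c) (heads (T⊆S m)))) (zero-sum c) }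
  where
  rest = dependent k (tail ∘ p) S (ℕₚ.<⇒≤ h)
  T = proj₁ rest
  T⊆S = proj₁ (proj₂ rest)
  T≢∅ = proj₁ (proj₂ (proj₂ rest))
  zero-sum = proj₂ (proj₂ (proj₂ rest))
  heads : ∀ {x} → x ∈ S → head (p x) ≡ false
  heads {x} m with head (p x) in eq
  ... | true  = contradiction (x , m , eq) none
  ... | false = refl
... | yes (x₀ , x₀∈S , head≡true) = finish (parity T (head ∘ p)) refl
  where
  t₀ = tail (p x₀)
  rest = dependent k (λ x → tail (p x) ⊕ head (p x) · t₀) (S - x₀) (ℕₚ.≤-pred (≤-trans h (∣p∣≤1+∣p-x∣ S x₀)))
  T = proj₁ rest
  T⊆S-x₀ = proj₁ (proj₂ rest)
  y = proj₁ (proj₁ (proj₂ (proj₂ rest)))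
  y∈T = proj₂ (proj₁ (proj₂ (proj₂ rest)))
  zero-sum = proj₂ (proj₂ (proj₂ rest))
  T⊆S : T ⊆ S
  T⊆S m = Sub.p─q⊆p S ⁅ x₀ ⁆ (T⊆S-x₀ m)
  xor-false⇒≡ : ∀ a b → a xor b ≡ false → a ≡ b
  xor-false⇒≡ false b e = sym e
  xor-false⇒≡ true true e = refl
  sum-tails : ∀ c → parity T (λ x → dot (tail (p x)) c) ≡ parity T (head ∘ p) ∧ dot t₀ c
  sum-tails c = xor-false⇒≡ _ _ (trans
    (cong (parity T (λ x → dot (tail (p x)) c) xor_) (sym (parity-∧ T (head ∘ p) (dot t₀ c))))
    (trans (sym (parity-xor T _ _))
    (trans (parity-cong T λ {x} _ → sym (dot-⊕·ˡ (tail (p x)) (head (p x)) t₀ c)) (zero-sum c))))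
  sum : ∀ c → parity T (λ x → dot (p x) c) ≡ parity T (head ∘ p) ∧ dot (p x₀) c
  sum (c₀ ∷ c) = trans (parity-cong T λ {x} _ → dot-∷ (p x) c₀ c) (trans (parity-xor T _ _)
    (trans (cong₂ _xor_ (parity-∧ T (head ∘ p) c₀) (sum-tails c))
    (trans (sym (∧-distribˡ-xor (parity T (head ∘ p)) c₀ (dot t₀ c)))
    (cong (parity T (head ∘ p) ∧_) (sym (trans (dot-∷ (p x₀) c₀ c) (cong (λ b → (b ∧ c₀) xor dot t₀ c) head≡true)))))))
  finish : ∀ b → parity T (head ∘ p) ≡ b →
    Σ (Subset n) λ T → T ⊆ S × Nonempty T × (∀ c → parity T (λ x → dot (p x) c) ≡ false)
  finish false e = T , T⊆S , (y , y∈T) , λ c → trans (sum c) (cong (_∧ dot (p x₀) c) e)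
  finish true  e = toggle x₀ T , sub , (y , toggle-≢ x₀ T (∈-⇒≢ S x₀ (T⊆S-x₀ y∈T)) y∈T) ,
    λ c → trans (parity-toggle x₀ T _) (trans (cong (dot (p x₀) c xor_) (trans (sum c) (cong (_∧ dot (p x₀) c) e))) (xor-same (dot (p x₀) c)))
    where
    sub : toggle x₀ T ⊆ S
    sub m with toggle-⊆ x₀ T m
    ... | inj₁ refl = x₀∈S
    ... | inj₂ m′   = T⊆S m′

Fac⇒CutrkLe : ∀ {n k} (G : Graph n) (X : Subset n) → Fac k G (lookup X) → CutrkLe G X k
Fac⇒CutrkLe {n} {k} G X (fac p q e) S S⊆X indep with k <? ∣ S ∣
... | no  k≮  = ℕₚ.≮⇒≥ k≮
... | yes k<S with dependent k p S k<S
... | T , T⊆S , T≢∅ , zero-sum with indep T T⊆S T≢∅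
... | y , y∉X , isOdd = contradiction (trans (sym (odd-%2 ∣ T ∩ N G y ∣ isOdd)) (trans (sym (parity-∣∣ T (λ x → G x y)))
        (trans (parity-cong T λ m → e ([]=⇒lookup (S⊆X (T⊆S m))) (∉⇒lookup y∉X)) (zero-sum (q y))))) true≢false

-- The column belonging to the last row of T in the triangular order meets T in that row only.
module _ {n} (G : Graph n) (X : Subset n) where

  record TriRows (l : List (Fin n × Fin n)) : Set where
    field
      rows     : Subset n
      rows⊆X   : rows ⊆ X
      size     : length l ≤ ∣ rows ∣
      nonzero  : ∀ {v} → v ∈ rows → ¬ All (λ z → G v (proj₂ z) ≡ false) l
      isolated : ∀ (T : Subset n) → T ⊆ rows → Nonempty T → ∃ λ y → y ∉ X ×
                 (∀ v → All (λ z → G v (proj₂ z) ≡ false) l → G v y ≡ false) ×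
                 ∃ λ x → x ∈ T × G x y ≡ true × (∀ {z} → z ∈ T → z ≢ x → G z y ≡ false)

  triRows : ∀ {l} → Tri G (lookup X) l → TriRows l
  triRows [] = record
    { rows = Subset.⊥ ; rows⊆X = λ m → ⊥-elim (Sub.∉⊥ m) ; size = z≤n
    ; nonzero = λ m _ → Sub.∉⊥ m ; isolated = λ T T⊆ (x , m) → ⊥-elim (Sub.∉⊥ (T⊆ m)) }
  triRows {(u , w) ∷ l} (step Xu Xw Guw zs t) = record
    { rows = ⁅ u ⁆ ∪ rows ; rows⊆X = sub ; size = ≤-trans (s≤s size) grow ; nonzero = nz ; isolated = iso }
    where
    open TriRows (triRows t)
    u∉rows : u ∉ rows
    u∉rows m = nonzero m zs
    grow : suc ∣ rows ∣ ≤ ∣ ⁅ u ⁆ ∪ rows ∣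
    grow = Sub.p⊂q⇒∣p∣<∣q∣ (Sub.q⊆p∪q ⁅ u ⁆ rows , u , Sub.p⊆p∪q rows (Sub.x∈⁅x⁆ u) , u∉rows)
    split : ∀ {v} → v ∈ ⁅ u ⁆ ∪ rows → v ≡ u ⊎ v ∈ rows
    split m with Sub.x∈p∪q⁻ ⁅ u ⁆ rows m
    ... | inj₁ e  = inj₁ (Sub.x∈⁅y⁆⇒x≡y u e)
    ... | inj₂ m′ = inj₂ m′
    sub : ⁅ u ⁆ ∪ rows ⊆ X
    sub m with split m
    ... | inj₁ refl = lookup⇒[]= u X Xu
    ... | inj₂ m′   = rows⊆X m′
    nz : ∀ {v} → v ∈ ⁅ u ⁆ ∪ rows → ¬ All (λ z → G v (proj₂ z) ≡ false) ((u , w) ∷ l)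
    nz m (z ∷ zs′) with split m
    ... | inj₁ refl = true≢false (trans (sym Guw) z)
    ... | inj₂ m′   = nonzero m′ zs′
    iso : ∀ T → T ⊆ ⁅ u ⁆ ∪ rows → Nonempty T → ∃ λ y → y ∉ X ×
          (∀ v → All (λ z → G v (proj₂ z) ≡ false) ((u , w) ∷ l) → G v y ≡ false) ×
          ∃ λ x → x ∈ T × G x y ≡ true × (∀ {z} → z ∈ T → z ≢ x → G z y ≡ false)
    iso T T⊆ (x , x∈T) with Sub.nonempty? (T - u)
    ... | no empty = w , lookup⇒∉ Xw , (λ { v (z ∷ _) → z }) , u , subst (_∈ T) (only x∈T) x∈T , Guw ,
                     λ z∈T z≢u → contradiction (only z∈T) z≢u
      where
      only : ∀ {z} → z ∈ T → z ≡ u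
      only {z} z∈T with z ≟ u
      ... | yes e   = e
      ... | no  z≢u = contradiction (z , Sub.x∈p∧x≢y⇒x∈p-y z∈T z≢u) empty
    ... | yes ne with isolated (T - u) rest ne
      where
      rest : T - u ⊆ rows
      rest m with split (T⊆ (Sub.p─q⊆p T ⁅ u ⁆ m))
      ... | inj₁ e  = contradiction e (∈-⇒≢ T u m)
      ... | inj₂ m′ = m′
    ... | y , y∉X , zero-on-y , x , x∈ , Gxy , others = y , y∉X , (λ { v (_ ∷ zs′) → zero-on-y v zs′ }) , x , Sub.p─q⊆p T ⁅ u ⁆ x∈ , Gxy , others′
      where
      others′ : ∀ {z} → z ∈ T → z ≢ x → G z y ≡ false
      others′ {z} z∈T z≢x with z ≟ u
      ... | yes refl = zero-on-y u zs
      ... | no  z≢u  = others (Sub.x∈p∧x≢y⇒x∈p-y z∈T z≢u) z≢x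

  CutrkLe⇒Tri≤ : ∀ {k l} → CutrkLe G X k → Tri G (lookup X) l → length l ≤ k
  CutrkLe⇒Tri≤ cutrk t = ≤-trans size (cutrk rows rows⊆X indep)
    where
    open TriRows (triRows t)
    indep : RowsIndependent G X rows
    indep T T⊆ ne with isolated T T⊆ ne
    ... | y , y∉X , _ , x , x∈T , Gxy , others = y , y∉X , cong (_% 2) (trans (cong ∣_∣ single) (Sub.∣⁅x⁆∣≡1 x))
      where
      lookupN : ∀ z → lookup (N G y) z ≡ G z y
      lookupN z = lookup∘tabulate (λ z → G z y) z
      single : T ∩ N G y ≡ ⁅ x ⁆
      single = Sub.⊆-antisym one (λ m → subst (_∈ T ∩ N G y) (sym (Sub.x∈⁅y⁆⇒x≡y x m))
        (Sub.x∈p∩q⁺ (x∈T , lookup⇒[]= x (N G y) (trans (lookupN x) Gxy))))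
        where
        one : T ∩ N G y ⊆ ⁅ x ⁆
        one {z} m with z ≟ x
        ... | yes refl = Sub.x∈⁅x⁆ x
        ... | no  z≢x  = contradiction (trans (sym ([]=⇒lookup (proj₂ (Sub.x∈p∩q⁻ T (N G y) m))))
              (trans (lookupN z) (others (proj₁ (Sub.x∈p∩q⁻ T (N G y) m)) z≢x))) true≢false

-- Layouts as injective position functions

record Layout (V : Set) : Set where
  field
    pos     : V → ℕ
    pos-inj : ∀ {x y} → pos x ≡ pos y → x ≡ y
    bound   : ℕ
    pos<    : ∀ x → pos x < bound

open Layout

Layout-pull : ∀ {V W} (f : W → V) → (∀ {x y} → f x ≡ f y → x ≡ y) → Layout V → Layout W
Layout-pull f f-inj ℓ = record
  { pos = pos ℓ ∘ f ; pos-inj = f-inj ∘ pos-inj ℓ ; bound = bound ℓ ; pos< = pos< ℓ ∘ f }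

before : ∀ {V : Set} → (V → ℕ) → ℕ → V → Bool
before f t x = does (f x <? t)

cut : ∀ {V} → Layout V → ℕ → V → Bool
cut ℓ = before (pos ℓ)

does-true : ∀ {P : Set} (p? : Dec P) → does p? ≡ true → P
does-true (yes p) _ = p

does-false : ∀ {P : Set} (p? : Dec P) → does p? ≡ false → ¬ P
does-false (no ¬p) _ = ¬p

does-⇔ : ∀ {P Q : Set} (p? : Dec P) (q? : Dec Q) → (P → Q) → (Q → P) → does p? ≡ does q?
does-⇔ p? q? to from with p?
... | yes p = sym (dec-true q? (to p))
... | no ¬p = sym (dec-false q? (¬p ∘ from))

LinearWidth≤ : ∀ {V} → ℕ → Gr V → Set
LinearWidth≤ {V} k G = Σ (Layout V) λ ℓ → ∀ t → Fac k G (cut ℓ t)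

module _ {n} (ℓ : Layout (Fin n)) where

  below : Fin n → Subset n
  below x = tabulate (before (pos ℓ) (pos ℓ x))

  below⁺ : ∀ {x y} → pos ℓ y < pos ℓ x → y ∈ below x
  below⁺ {x} {y} h = lookup⇒[]= y (below x) (trans (lookup∘tabulate (before (pos ℓ) (pos ℓ x)) y) (dec-true (_ <? _) h))

  below⁻ : ∀ {x y} → y ∈ below x → pos ℓ y < pos ℓ x
  below⁻ {x} {y} m = does-true (_ <? _) (trans (sym (lookup∘tabulate (before (pos ℓ) (pos ℓ x)) y)) ([]=⇒lookup m))

  -- Not a matrix rank: the positions compressed to 0, ..., n-1.
  rank : Fin n → ℕ
  rank x = ∣ below x ∣

  rank-mono : ∀ {x y} → pos ℓ x < pos ℓ y → rank x < rank y
  rank-mono {x} x<y = Sub.p⊂q⇒∣p∣<∣q∣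
    ((λ m → below⁺ (ℕₚ.<-trans (below⁻ m) x<y)) , x , below⁺ x<y , λ m → ℕₚ.<-irrefl refl (below⁻ m))

  rank-reflects : ∀ {x y} → rank x < rank y → pos ℓ x < pos ℓ y
  rank-reflects {x} {y} h with ℕₚ.<-cmp (pos ℓ x) (pos ℓ y)
  ... | tri< x<y _ _ = x<y
  ... | tri≈ _ x≈y _ = contradiction h (ℕₚ.<-irrefl (cong rank (pos-inj ℓ x≈y)))
  ... | tri> _ _ y<x = contradiction h (ℕₚ.<-asym (rank-mono y<x))

  rank<n : ∀ x → rank x < n
  rank<n x = subst (rank x <_) (Sub.∣⊤∣≡n n)
    (Sub.p⊂q⇒∣p∣<∣q∣ ((λ _ → Sub.∈⊤) , x , Sub.∈⊤ , λ m → ℕₚ.<-irrefl refl (below⁻ m)))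

  rank-inj : ∀ {x y} → rank x ≡ rank y → x ≡ y
  rank-inj {x} {y} e with ℕₚ.<-cmp (pos ℓ x) (pos ℓ y)
  ... | tri< x<y _ _ = contradiction (rank-mono x<y) (ℕₚ.<-irrefl e)
  ... | tri≈ _ x≈y _ = pos-inj ℓ x≈y
  ... | tri> _ _ y<x = contradiction (rank-mono y<x) (ℕₚ.<-irrefl (sym e))

injective⇒surjective : ∀ {n} (f : Fin n → Fin n) → (∀ {x y} → f x ≡ f y → x ≡ y) → ∀ i → ∃ λ x → f x ≡ i
injective⇒surjective {suc n} f f-inj i with any? (λ x → f x ≟ i)
... | yes found = found
... | no  none  = contradiction (injective⇒≤ (λ {x} {y} e → f-inj (punchOut-injective (miss x) (miss y) e))) ℕₚ.1+n≰n
  where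
  miss : ∀ x → i ≢ f x
  miss x e = none (x , sym e)

order : ∀ {n} → Layout (Fin n) → Permutation′ n
order {n} ℓ = permutation (proj₁ ∘ sur) f (λ x → inj (proj₂ (sur (f x)))) (λ i → proj₂ (sur i))
  where
  f : Fin n → Fin n
  f x = fromℕ< (rank<n ℓ x)
  inj : ∀ {x y} → f x ≡ f y → x ≡ y
  inj e = rank-inj ℓ (trans (sym (toℕ-fromℕ< (rank<n ℓ _))) (trans (cong toℕ e) (toℕ-fromℕ< (rank<n ℓ _))))
  sur = injective⇒surjective f inj

prefix-order : ∀ {n} (ℓ : Layout (Fin n)) i → ∃ λ t → ∀ x → cut ℓ t x ≡ lookup (prefix (order ℓ) i) x
prefix-order {n} ℓ i = threshold , λ x → trans
  (does-⇔ (pos ℓ x <? threshold) (toℕ (order ℓ ⟨$⟩ˡ x) <? i)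
    (λ h → subst (_< i) (sym (toℕ-fromℕ< (rank<n ℓ x))) (to h))
    (λ h → from (subst (_< i) (toℕ-fromℕ< (rank<n ℓ x)) h)))
  (sym (lookup∘tabulate (λ x → does (toℕ (order ℓ ⟨$⟩ˡ x) <? i)) x))
  where
  found : Dec (i < n) → Σ ℕ λ t → ∀ {x} → (pos ℓ x < t → rank ℓ x < i) × (rank ℓ x < i → pos ℓ x < t)
  -- From n on the prefix is the whole vertex set, and so is the cut at `bound ℓ`.
  found (no i≮n)  = bound ℓ , λ {x} → (λ _ → ℕₚ.<-≤-trans (rank<n ℓ x) (ℕₚ.≮⇒≥ i≮n)) , (λ _ → pos< ℓ x)
  found (yes i<n) = pos ℓ y , λ {x} → (λ h → subst (rank ℓ x <_) rank-y (rank-mono ℓ h)) , (λ h → rank-reflects ℓ (subst (rank ℓ x <_) (sym rank-y) h))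
    where
    y = order ℓ ⟨$⟩ʳ fromℕ< i<n
    rank-y : rank ℓ y ≡ i
    rank-y = trans (sym (toℕ-fromℕ< (rank<n ℓ y))) (trans (cong toℕ (Inverse.strictlyInverseʳ (order ℓ) (fromℕ< i<n))) (toℕ-fromℕ< i<n))
  threshold = proj₁ (found (i <? n))
  to : ∀ {x} → pos ℓ x < threshold → rank ℓ x < i
  to = proj₁ (proj₂ (found (i <? n)))
  from : ∀ {x} → rank ℓ x < i → pos ℓ x < threshold
  from = proj₂ (proj₂ (found (i <? n)))

LinearWidth≤⇒LrwLe : ∀ {n k} (G : Graph n) → LinearWidth≤ k G → LrwLe k G
LinearWidth≤⇒LrwLe G (ℓ , width) = order ℓ , λ i →
  let t , e = prefix-order ℓ i in Fac⇒CutrkLe G (prefix (order ℓ) i) (Fac-cong (λ _ _ → refl) e (width t))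

-- The lower bound in a form that restricts to parts: positions are merely injective, so composing
-- `f` with the inclusion of a part gives positions for that part.
Wide : ∀ {V} → ℕ → Gr V → Set
Wide {V} m G = (f : V → ℕ) → (∀ {x y} → f x ≡ f y → x ≡ y) →
  Σ ℕ λ t → Σ (List (V × V)) λ l → Tri G (before f t) l × length l ≡ m

Tri-cong : ∀ {V} {G : Gr V} {X Y : V → Bool} → (∀ x → Y x ≡ X x) → ∀ {l} → Tri G X l → Tri G Y l
Tri-cong e []                  = []
Tri-cong e (step a b c ds t) = step (trans (e _) a) (trans (e _) b) c ds (Tri-cong e t)

Wide⇒LrwGt : ∀ {n k} (G : Graph n) → Wide (suc k) G → LrwGt k G
Wide⇒LrwGt G wide (σ , width) =
  let t , l , tri , len = wide (λ x → toℕ (σ ⟨$⟩ˡ x)) (λ e → σˡ-inj (toℕ-injective e)) in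
  ℕₚ.1+n≰n (subst (_≤ _) len (CutrkLe⇒Tri≤ G (prefix σ t) (width t)
    (Tri-cong (λ x → lookup∘tabulate (λ x → does (toℕ (σ ⟨$⟩ˡ x) <? t)) x) tri)))
  where
  σˡ-inj : ∀ {x y} → σ ⟨$⟩ˡ x ≡ σ ⟨$⟩ˡ y → x ≡ y
  σˡ-inj {x} {y} e = trans (sym (inverseʳ σ)) (trans (cong (σ ⟨$⟩ʳ_) e) (inverseʳ σ))

-- Local complementation

separated : ∀ {V : Set} {X : V → Bool} {x y} → X x ≡ true → X y ≡ false → x ≢ y
separated Xx Xy refl = true≢false (trans (sym Xx) Xy)

lc-≢ : ∀ {n} (G : Graph n) u {x y} → x ≢ y → lc G u x y ≡ G x y xor (G u x ∧ G u y)
lc-≢ G u {x} {y} x≢y = cong (λ b → if b then G x y else G x y xor (G u x ∧ G u y)) (dec-false (x ≟ y) x≢y)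

lc-refl : ∀ {n} (G : Graph n) u x → lc G u x x ≡ G x x
lc-refl G u x = cong (λ b → if b then G x x else G x x xor (G u x ∧ G u x)) (dec-true (x ≟ x) refl)

lc-simple : ∀ {n} {G : Graph n} u → Simple G → Simple (lc G u)
lc-simple {n} {G} u (G-sym , G-irr) = lc-sym , λ x → trans (lc-refl G u x) (G-irr x)
  where
  lc-sym : ∀ x y → lc G u x y ≡ lc G u y x
  lc-sym x y with x ≟ y
  ... | yes refl = sym (lc-refl G u x)
  ... | no  x≢y  = trans (cong₂ _xor_ (G-sym x y) (∧-comm (G u x) (G u y))) (sym (lc-≢ G u (x≢y ∘ sym)))

lc-self : ∀ {n} {G : Graph n} u → Simple G → ∀ x → lc G u u x ≡ G u x
lc-self {G = G} u (_ , G-irr) x with u ≟ x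
... | yes refl = refl
... | no  _    = trans (cong (λ b → G u x xor (b ∧ G u x)) (G-irr u)) (xor-identityʳ (G u x))

lc-involutive : ∀ {n} {G : Graph n} u → Simple G → ∀ x y → lc (lc G u) u x y ≡ G x y
lc-involutive {G = G} u G-simple x y with x ≟ y
... | yes refl = refl
... | no  x≢y  = trans (cong ((G x y xor (G u x ∧ G u y)) xor_) (cong₂ _∧_ (lc-self u G-simple x) (lc-self u G-simple y)))
  (trans (xor-assoc (G x y) _ _) (trans (cong (G x y xor_) (xor-same (G u x ∧ G u y))) (xor-identityʳ _)))

-- On a cut, complementing at `u` is an elementary operation: if `u` is in `X`, row `u` is added to
-- the rows of its neighbours, and otherwise column `u` to the columns of its neighbours.
Fac-lc : ∀ {n r} {G : Graph n} {X : Fin n → Bool} u → Simple G → Fac r G X → Fac r (lc G u) X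
Fac-lc {n} {r} {G} {X} u (G-sym , _) (fac p q e) with X u in Xu
... | true  = fac (λ x → p x ⊕ G u x · p u) q λ {x} {y} Xx Xy →
  trans (lc-≢ G u (separated {X = X} Xx Xy))
    (sym (trans (dot-⊕·ˡ (p x) (G u x) (p u) (q y)) (cong₂ (λ a b → a xor (G u x ∧ b)) (sym (e Xx Xy)) (sym (e Xu Xy)))))
... | false = fac p (λ y → q y ⊕ G u y · q u) λ {x} {y} Xx Xy →
  trans (lc-≢ G u (separated {X = X} Xx Xy))
    (sym (trans (dot-⊕·ʳ (p x) (q y) (G u y) (q u))
      (cong₂ _xor_ (sym (e Xx Xy)) (trans (∧-comm (G u y) _) (cong (_∧ G u y) (trans (sym (e Xx Xu)) (G-sym x u)))))))

Fac-lc⁻ : ∀ {n r} {G : Graph n} {X : Fin n → Bool} u → Simple G → Fac r (lc G u) X → Fac r G X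
Fac-lc⁻ u G-simple f = Fac-cong (lc-involutive u G-simple) (λ _ → refl) (Fac-lc u (lc-simple u G-simple) f)

-- Deleting v from the graphs locally equivalent to G yields at most three graphs up to
-- local equivalence: G - v, G * v - v and G ∧ vw - v.  The rank of a cut X of them is
-- one less than the rank of the cut matrix of G bordered by s times row and column v with
-- corner d, for (s , d) = (0 , 1), (1 , 1) and (1 , 0) respectively.
record Bord {V : Set} (r : ℕ) (s d : Bool) (G : Gr V) (v : V) (X : V → Bool) : Set where
  constructor bord
  field
    row col    : V → F₂^ r
    rowᵛ colᵛ  : F₂^ r
    bulk       : ∀ {x y} → x ≢ v → y ≢ v → X x ≡ true → X y ≡ false → G x y ≡ dot (row x) (col y)
    border-col : ∀ {x} → x ≢ v → X x ≡ true  → s ∧ G x v ≡ dot (row x) colᵛ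
    border-row : ∀ {y} → y ≢ v → X y ≡ false → s ∧ G v y ≡ dot rowᵛ (col y)
    corner     : d ≡ dot rowᵛ colᵛ

Bord-cong : ∀ {V r s d} {G : Gr V} {v} {X Y : V → Bool} → (∀ x → X x ≡ Y x) → Bord r s d G v X → Bord r s d G v Y
Bord-cong e (bord p q pᵛ qᵛ b c c′ k) = bord p q pᵛ qᵛ
  (λ {x} {y} x≢ y≢ Yx Yy → b x≢ y≢ (trans (e x) Yx) (trans (e y) Yy)) (λ {x} x≢ Yx → c x≢ (trans (e x) Yx)) (λ {y} y≢ Yy → c′ y≢ (trans (e y) Yy)) k

Bord-pull : ∀ {V W r s d} {G : Gr V} {X : V → Bool} (f : W → V) → (∀ {x y} → f x ≡ f y → x ≡ y) → ∀ {v} →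
  Bord r s d G (f v) X → Bord r s d (λ x y → G (f x) (f y)) v (X ∘ f)
Bord-pull f f-inj (bord p q pᵛ qᵛ b c c′ k) = bord (p ∘ f) (q ∘ f) pᵛ qᵛ
  (λ x≢ y≢ → b (x≢ ∘ f-inj) (y≢ ∘ f-inj)) (λ x≢ → c (x≢ ∘ f-inj)) (λ y≢ → c′ (y≢ ∘ f-inj)) k

Bord-transpose : ∀ {V r s d} {G : Gr V} {v} {X : V → Bool} → Sym G → Bord r s d G v X → Bord r s d G v (not ∘ X)
Bord-transpose {s = s} {v = v} G-sym (bord p q pᵛ qᵛ b c c′ k) = bord q p qᵛ pᵛ
  (λ {x} {y} x≢ y≢ Xx Xy → trans (G-sym x y) (trans (b y≢ x≢ (not-false Xy) (not-true Xx)) (dot-comm (p y) (q x))))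
  (λ {x} x≢ Xx → trans (cong (s ∧_) (G-sym x v)) (trans (c′ x≢ (not-true Xx)) (dot-comm pᵛ (q x))))
  (λ {y} y≢ Xy → trans (cong (s ∧_) (G-sym v y)) (trans (c y≢ (not-false Xy)) (dot-comm (p y) qᵛ)))
  (trans k (dot-comm pᵛ qᵛ))

Bord-untranspose : ∀ {V r s d} {G : Gr V} {v} {X : V → Bool} → Sym G → Bord r s d G v (not ∘ X) → Bord r s d G v X
Bord-untranspose {X = X} G-sym b = Bord-cong (λ x → not-involutive (X x)) (Bord-transpose G-sym b)

-- Row `u` is added to the rows of its neighbours, and to the border row with coefficient
-- `s ∧ G u v`. The entry of row `u` in the border column is again `s ∧ G u v`, and this is what the
-- corner changes by.
Bord-lc-row : ∀ {n r s d} {G : Graph n} {v} {X : Fin n → Bool} u → Simple G → u ≢ v → X u ≡ true →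
  Bord r s (d xor (s ∧ G u v)) G v X → Bord r s d (lc G u) v X
Bord-lc-row {n} {r} {s} {d} {G} {v} {X} u (G-sym , _) u≢v Xu (bord p q pᵛ qᵛ b c c′ k) =
  bord (λ x → p x ⊕ G u x · p u) q (pᵛ ⊕ (s ∧ G u v) · p u) qᵛ
  (λ {x} {y} x≢ y≢ Xx Xy → trans (lc-≢ G u (separated {X = X} Xx Xy))
    (sym (trans (dot-⊕·ˡ (p x) (G u x) (p u) (q y)) (cong₂ (λ a b → a xor (G u x ∧ b)) (sym (b x≢ y≢ Xx Xy)) (sym (b u≢v y≢ Xu Xy))))))
  (λ {x} x≢ Xx → trans (cong (s ∧_) (lc-≢ G u x≢)) (trans (col-table s (G x v) (G u x) (G u v))
    (sym (trans (dot-⊕·ˡ (p x) (G u x) (p u) qᵛ) (cong₂ (λ a b → a xor (G u x ∧ b)) (sym (c x≢ Xx)) (sym (c u≢v Xu)))))))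
  (λ {y} y≢ Xy → trans (cong (s ∧_) (lc-≢ G u (y≢ ∘ sym))) (trans (row-table s (G v y) (G u v) (G u y))
    (sym (trans (dot-⊕·ˡ pᵛ (s ∧ G u v) (p u) (q y)) (cong₂ (λ a b → a xor ((s ∧ G u v) ∧ b)) (sym (c′ y≢ Xy)) (sym (b u≢v y≢ Xu Xy)))))))
  (trans (corner-table d (s ∧ G u v)) (sym (trans (dot-⊕·ˡ pᵛ (s ∧ G u v) (p u) qᵛ) (cong₂ (λ a b → a xor ((s ∧ G u v) ∧ b)) (sym k) (sym (c u≢v Xu))))))
  where
  col-table : ∀ s a b c → s ∧ (a xor (b ∧ c)) ≡ (s ∧ a) xor (b ∧ (s ∧ c))
  col-table true  a b c = refl
  col-table false a b c = sym (∧-zeroʳ b)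
  row-table : ∀ s a b c → s ∧ (a xor (b ∧ c)) ≡ (s ∧ a) xor ((s ∧ b) ∧ c)
  row-table true  a b c = refl
  row-table false a b c = refl
  corner-table : ∀ d e → d ≡ (d xor e) xor (e ∧ e)
  corner-table false false = refl
  corner-table false true  = refl
  corner-table true  false = refl
  corner-table true  true  = refl

Bord-lc-≢ : ∀ {n r s d} {G : Graph n} {v} {X : Fin n → Bool} u → Simple G → u ≢ v →
  Bord r s (d xor (s ∧ G u v)) G v X → Bord r s d (lc G u) v X
Bord-lc-≢ {X = X} u G-simple u≢v b with X u in Xu
... | true  = Bord-lc-row u G-simple u≢v Xu b
... | false = Bord-untranspose (proj₁ (lc-simple u G-simple))
  (Bord-lc-row u G-simple u≢v (cong not Xu) (Bord-transpose (proj₁ G-simple) b))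

-- Complementing at `v` itself exchanges the codes `(0 , 1)` and `(1 , 1)` and fixes `(1 , 0)`. The
-- product of border column and border row that it adds to the bulk comes from row and column
-- operations with the border.
Bord-lc-≡ : ∀ {n r s d} {G : Graph n} {X : Fin n → Bool} v → Simple G → s ∨ d ≡ true →
  Bord r (s xor d) d G v X → Bord r s d (lc G v) v X
Bord-lc-≡ {n} {r} {s} {d} {G} {X} v G-simple@(G-sym , _) s∨d (bord p q pᵛ qᵛ b c c′ k) =
  bord (λ x → p x ⊕ G v x · pᵛ) (λ y → q y ⊕ (d ∧ G v y) · qᵛ) pᵛ qᵛ
  (λ {x} {y} x≢ y≢ Xx Xy → trans (lc-≢ G v (separated {X = X} Xx Xy)) (trans
    (bulk-table (G x y) (G v x) (G v y) s d s∨d)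
    (sym (trans (dot-⊕·ʳ (p x ⊕ G v x · pᵛ) (q y) (d ∧ G v y) qᵛ) (cong₂ (λ a b → a xor ((d ∧ G v y) ∧ b))
      (trans (dot-⊕·ˡ (p x) (G v x) pᵛ (q y)) (cong₂ (λ a b → a xor (G v x ∧ b)) (sym (b x≢ y≢ Xx Xy)) (sym (c′ y≢ Xy))))
      (row-v x≢ Xx))))))
  (λ {x} x≢ Xx → trans (cong (s ∧_) (trans (proj₁ (lc-simple v G-simple) x v) (lc-self v G-simple x)))
    (trans (col-table (G v x) s d) (sym (row-v x≢ Xx))))
  (λ {y} y≢ Xy → trans (cong (s ∧_) (lc-self v G-simple y)) (trans (row-table (G v y) s d)
    (sym (trans (dot-⊕·ʳ pᵛ (q y) (d ∧ G v y) qᵛ) (cong₂ (λ a b → a xor ((d ∧ G v y) ∧ b)) (sym (c′ y≢ Xy)) (sym k))))))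
  k
  where
  row-v : ∀ {x} → x ≢ v → X x ≡ true → dot (p x ⊕ G v x · pᵛ) qᵛ ≡ ((s xor d) ∧ G v x) xor (G v x ∧ d)
  row-v {x} x≢ Xx = trans (dot-⊕·ˡ (p x) (G v x) pᵛ qᵛ)
    (cong₂ (λ a b → a xor (G v x ∧ b)) (trans (sym (c x≢ Xx)) (cong ((s xor d) ∧_) (G-sym x v))) (sym k))
  col-table : ∀ a s d → s ∧ a ≡ ((s xor d) ∧ a) xor (a ∧ d)
  col-table false false false = refl
  col-table false false true  = refl
  col-table false true  false = refl
  col-table false true  true  = refl
  col-table true  false false = refl
  col-table true  false true  = refl
  col-table true  true  false = refl
  col-table true  true  true  = refl
  row-table : ∀ a s d → s ∧ a ≡ ((s xor d) ∧ a) xor ((d ∧ a) ∧ d)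
  row-table false false false = refl
  row-table false false true  = refl
  row-table false true  false = refl
  row-table false true  true  = refl
  row-table true  false false = refl
  row-table true  false true  = refl
  row-table true  true  false = refl
  row-table true  true  true  = refl
  bulk-table : ∀ g a b s d → s ∨ d ≡ true →
    g xor (a ∧ b) ≡ (g xor (a ∧ ((s xor d) ∧ b))) xor ((d ∧ b) ∧ (((s xor d) ∧ a) xor (a ∧ d)))
  bulk-table g a b true false _ = sym (xor-identityʳ (g xor (a ∧ b)))
  bulk-table false false false false true _ = refl
  bulk-table true false false false true _ = refl
  bulk-table false false true false true _ = refl
  bulk-table true false true false true _ = refl
  bulk-table false true false false true _ = refl
  bulk-table true true false false true _ = refl
  bulk-table false true true false true _ = refl
  bulk-table true true true false true _ = refl
  bulk-table false false false true true _ = refl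
  bulk-table true false false true true _ = refl
  bulk-table false false true true true _ = refl
  bulk-table true false true true true _ = refl
  bulk-table false true false true true _ = refl
  bulk-table true true false true true _ = refl
  bulk-table false true true true true _ = refl
  bulk-table true true true true true _ = refl

-- Every removal of every vertex, up to local equivalence, leaves width at most k; the layout may
-- depend on the vertex and on the code. The bound is `suc k` because the border adds one to the
-- rank.
Deletable : ∀ {V} → ℕ → Gr V → Set
Deletable {V} k G = ∀ v s d → s ∨ d ≡ true → Σ (Layout V) λ ℓ → ∀ t → Bord (suc k) s d G v (cut ℓ t)

Deletable-lc : ∀ {n k} {G : Graph n} u → Simple G → Deletable k G → Deletable k (lc G u)
Deletable-lc {G = G} u G-simple del v s d s∨d with u ≟ v
... | no u≢v =
  let ℓ , b = del v s (d xor (s ∧ G u v)) (table s d (G u v) s∨d) in ℓ , λ t → Bord-lc-≢ u G-simple u≢v (b t)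
  where
  table : ∀ s d e → s ∨ d ≡ true → s ∨ (d xor (s ∧ e)) ≡ true
  table true  d    e h = refl
  table false true e h = refl
... | yes refl =
  let ℓ , b = del v (s xor d) d (table s d s∨d) in ℓ , λ t → Bord-lc-≡ v G-simple s∨d (b t)
  where
  table : ∀ s d → s ∨ d ≡ true → (s xor d) ∨ d ≡ true
  table true  true  h = refl
  table true  false h = refl
  table false true  h = refl

LinearWidth≤-del : ∀ {n k} {G : Graph (suc n)} v → LinearWidth≤ k G → LinearWidth≤ k (del G v)
LinearWidth≤-del v (ℓ , f) = Layout-pull (punchIn v) (punchIn-injective v _ _) ℓ , λ t → Fac-pull (punchIn v) (f t)

Deletable-del : ∀ {n k} {G : Graph (suc n)} v → Deletable k G → LinearWidth≤ k (del G v)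
Deletable-del {n} {k} {G} v del = Layout-pull (punchIn v) (punchIn-injective v _ _) (proj₁ chosen) , λ t → reduce (proj₂ chosen t)
  where
  -- Plain deletion: the border is zero and the corner is 1. Hence `qᵛ` is nonzero and orthogonal to
  -- all other rows, which saves one dimension.
  chosen = del v false true refl
  reduce : ∀ {X} → Bord (suc k) false true G v X → Fac k (Defs.del G v) (X ∘ punchIn v)
  reduce (bord p q pᵛ qᵛ b c _ k) = fac (redˡ ∘ p ∘ punchIn v) (redʳ ∘ q ∘ punchIn v)
    λ {x} {y} Xx Xy → trans (b (punchInᵢ≢i v x) (punchInᵢ≢i v y) Xx Xy) (sym (red-dot _ _ (sym (c (punchInᵢ≢i v x) Xx))))
    where open Reduction (reduction pᵛ qᵛ (sym k))

LinearWidth≤-vm : ∀ {m n k} {G : Graph n} {H : Graph m} → Simple G → VertexMinor G H → LinearWidth≤ k G → LinearWidth≤ k H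
LinearWidth≤-vm G-simple vm-refl        w       = w
LinearWidth≤-vm G-simple (vm-lc v vm)   (ℓ , f) = LinearWidth≤-vm (lc-simple v G-simple) vm (ℓ , λ t → Fac-lc v G-simple (f t))
LinearWidth≤-vm (s , i)  (vm-del v vm)  w       = LinearWidth≤-vm ((λ _ _ → s _ _) , λ _ → i _) vm (LinearWidth≤-del v w)

-- A vertex-minor with fewer vertices involves a deletion. Up to the first one only local
-- complementations occur, which preserve `Deletable`; after it, the width bound k is inherited.
Deletable-vm : ∀ {m n k} {G : Graph n} {H : Graph m} → Simple G → Deletable k G → VertexMinor G H → m < n → LinearWidth≤ k H
Deletable-vm G-simple D vm-refl       m<n = contradiction m<n (ℕₚ.<-irrefl refl)
Deletable-vm G-simple D (vm-lc v vm)  m<n = Deletable-vm (lc-simple v G-simple) (Deletable-lc v G-simple D) vm m<n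
Deletable-vm (s , i)  D (vm-del v vm) m<n = LinearWidth≤-vm ((λ _ _ → s _ _) , λ _ → i _) vm (Deletable-del v D)

-- Bijections preserving the cut-rank function

record CutEquiv {V W : Set} (G : Gr V) (H : Gr W) : Set where
  field
    to      : V → W
    from    : W → V
    to-from : ∀ y → to (from y) ≡ y
    from-to : ∀ x → from (to x) ≡ x
    push    : ∀ {r X} → Fac r G X → Fac r H (X ∘ from)
    pull    : ∀ {r Y} → Fac r H Y → Fac r G (Y ∘ to)

CutEquiv-sym : ∀ {V W} {G : Gr V} {H : Gr W} → CutEquiv G H → CutEquiv H G
CutEquiv-sym e = record { to = from ; from = to ; to-from = from-to ; from-to = to-from ; push = pull ; pull = push }
  where open CutEquiv e

CutEquiv-trans : ∀ {U V W} {F : Gr U} {G : Gr V} {H : Gr W} → CutEquiv F G → CutEquiv G H → CutEquiv F H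
CutEquiv-trans e f = record
  { to      = F.to ∘ E.to
  ; from    = E.from ∘ F.from
  ; to-from = λ y → trans (cong F.to (E.to-from (F.from y))) (F.to-from y)
  ; from-to = λ x → trans (cong E.from (F.from-to (E.to x))) (E.from-to x)
  ; push    = λ a → F.push (E.push a)
  ; pull    = λ a → E.pull (F.pull a)
  }
  where
  module E = CutEquiv e
  module F = CutEquiv f

CutEquiv-bijection : ∀ {V W} {G : Gr V} {H : Gr W} (f : V ↔ W) → (∀ x y → G x y ≡ H (Inverse.to f x) (Inverse.to f y)) → CutEquiv G H
CutEquiv-bijection {G = G} {H} f e = record
  { to      = to
  ; from    = from
  ; to-from = strictlyInverseˡ
  ; from-to = strictlyInverseʳ
  ; push    = λ a → Fac-cong (λ x y → trans (e (from x) (from y)) (cong₂ H (strictlyInverseˡ x) (strictlyInverseˡ y))) (λ _ → refl) (Fac-pull from a)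
  ; pull    = λ a → Fac-cong (λ x y → sym (e x y)) (λ _ → refl) (Fac-pull to a)
  }
  where open Inverse f

CutEquiv-lc : ∀ {n} {G : Graph n} u → Simple G → CutEquiv G (lc G u)
CutEquiv-lc u G-simple = record
  { to = id ; from = id ; to-from = λ _ → refl ; from-to = λ _ → refl ; push = Fac-lc u G-simple ; pull = Fac-lc⁻ u G-simple }

CutEquiv-refl : ∀ {V} {G : Gr V} → CutEquiv G G
CutEquiv-refl = record { to = id ; from = id ; to-from = λ _ → refl ; from-to = λ _ → refl ; push = id ; pull = id }

LocEq⇒CutEquiv : ∀ {n} {G H : Graph n} → Simple G → LocallyEquivalent G H → CutEquiv G H
LocEq⇒CutEquiv G-simple le-refl     = CutEquiv-refl
LocEq⇒CutEquiv G-simple (le-lc v e) = CutEquiv-trans (CutEquiv-lc v G-simple) (LocEq⇒CutEquiv (lc-simple v G-simple) e)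

LocEqUpToIso⇒CutEquiv : ∀ {m n} {G : Graph m} {H : Graph n} → Simple G → LocEqUpToIso G H → CutEquiv G H
LocEqUpToIso⇒CutEquiv G-simple (_ , e , f , adj) = CutEquiv-trans (LocEq⇒CutEquiv G-simple e) (CutEquiv-bijection f adj)

vm-≤ : ∀ {m n} {G : Graph m} {H : Graph n} → VertexMinor G H → n ≤ m
vm-≤ vm-refl       = ≤-refl
vm-≤ (vm-lc v vm)  = vm-≤ vm
vm-≤ (vm-del v vm) = ℕₚ.m≤n⇒m≤1+n (vm-≤ vm)

vm-proper-or-CutEquiv : ∀ {m n} {G : Graph m} {H : Graph n} → Simple G → VertexMinor G H → n < m ⊎ CutEquiv G H
vm-proper-or-CutEquiv G-simple vm-refl       = inj₂ CutEquiv-refl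
vm-proper-or-CutEquiv G-simple (vm-del v vm) = inj₁ (s≤s (vm-≤ vm))
vm-proper-or-CutEquiv G-simple (vm-lc v vm) with vm-proper-or-CutEquiv (lc-simple v G-simple) vm
... | inj₁ n<m = inj₁ n<m
... | inj₂ e   = inj₂ (CutEquiv-trans (CutEquiv-lc v G-simple) e)

-- Layouts of three parts one after the other

rev : ∀ {V} → Layout V → Layout V
rev ℓ = record
  { pos     = λ x → bound ℓ ∸ pos ℓ x
  ; pos-inj = λ {x} {y} e → pos-inj ℓ (ℕₚ.∸-cancelˡ-≡ (ℕₚ.<⇒≤ (pos< ℓ x)) (ℕₚ.<⇒≤ (pos< ℓ y)) e)
  ; bound   = suc (bound ℓ)
  ; pos<    = λ x → s≤s (ℕₚ.m∸n≤m (bound ℓ) (pos ℓ x))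
  }

cut-rev : ∀ {V} (ℓ : Layout V) t → ∃ λ t′ → ∀ x → cut ℓ t′ x ≡ not (cut (rev ℓ) t x)
cut-rev ℓ t = suc (bound ℓ) ∸ t , λ x → flip (pos ℓ x <? suc (bound ℓ) ∸ t) (bound ℓ ∸ pos ℓ x <? t) (to x) (from x)
  where
  flip : ∀ {P Q : Set} (p? : Dec P) (q? : Dec Q) → (P → ¬ Q) → (¬ P → Q) → does p? ≡ not (does q?)
  flip (yes p) q? to from = sym (cong not (dec-false q? (to p)))
  flip (no ¬p) q? to from = sym (cong not (dec-true q? (from ¬p)))
  to : ∀ x → pos ℓ x < suc (bound ℓ) ∸ t → ¬ (bound ℓ ∸ pos ℓ x < t)
  to x h h′ = ℕₚ.<-irrefl refl (ℕₚ.<-≤-trans h (ℕₚ.m≤n+o⇒m∸n≤o (suc (bound ℓ)) t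
    (≤-trans (s≤s (ℕₚ.m≤n+m∸n (bound ℓ) (pos ℓ x))) (subst (_≤ t + pos ℓ x) (cong suc (ℕₚ.+-comm _ (pos ℓ x))) (ℕₚ.+-monoˡ-≤ (pos ℓ x) h′)))))
  from : ∀ x → ¬ (pos ℓ x < suc (bound ℓ) ∸ t) → bound ℓ ∸ pos ℓ x < t
  from x h with bound ℓ ∸ pos ℓ x <? t
  ... | yes h′ = h′
  ... | no  h′ = contradiction (ℕₚ.m+n≤o⇒m≤o∸n (suc (pos ℓ x)) (s≤s
    (subst (_≤ bound ℓ) (ℕₚ.+-comm t (pos ℓ x)) (subst (t + pos ℓ x ≤_) (ℕₚ.m∸n+n≡m (ℕₚ.<⇒≤ (pos< ℓ x))) (ℕₚ.+-monoˡ-≤ (pos ℓ x) (ℕₚ.≮⇒≥ h′)))))) h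

module _ {V : Set} (σ : Permutation′ 3) (ℓ : Fin 3 → Layout V) where

  slot : Fin 3 → ℕ
  slot i = toℕ (σ ⟨$⟩ʳ i)

  slot-inj : ∀ {i j} → slot i ≡ slot j → i ≡ j
  slot-inj {i} {j} e = trans (sym (inverseˡ σ)) (trans (cong (σ ⟨$⟩ˡ_) (toℕ-injective e)) (inverseˡ σ))

  width : ℕ
  width = bound (ℓ 0F) + bound (ℓ 1F) + bound (ℓ 2F)

  pos<width : ∀ i x → pos (ℓ i) x < width
  pos<width 0F x = ≤-trans (pos< (ℓ 0F) x) (≤-trans (ℕₚ.m≤m+n _ (bound (ℓ 1F))) (ℕₚ.m≤m+n _ (bound (ℓ 2F))))
  pos<width 1F x = ≤-trans (pos< (ℓ 1F) x) (≤-trans (ℕₚ.m≤n+m _ (bound (ℓ 0F))) (ℕₚ.m≤m+n _ (bound (ℓ 2F))))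
  pos<width 2F x = ≤-trans (pos< (ℓ 2F) x) (ℕₚ.m≤n+m _ (bound (ℓ 0F) + bound (ℓ 1F)))

  posₛ : Fin 3 × V → ℕ
  posₛ (i , x) = slot i * width + pos (ℓ i) x

  posₛ<next : ∀ i x → posₛ (i , x) < suc (slot i) * width
  posₛ<next i x = subst (posₛ (i , x) <_) (ℕₚ.+-comm (slot i * width) width) (ℕₚ.+-monoʳ-< (slot i * width) (pos<width i x))

  posₛ-slot : ∀ {i j x y} → slot i < slot j → posₛ (i , x) < posₛ (j , y)
  posₛ-slot {i} {j} {x} {y} h = ℕₚ.<-≤-trans (posₛ<next i x) (≤-trans (ℕₚ.*-monoˡ-≤ width h) (ℕₚ.m≤m+n _ _))

  stack : Layout (Fin 3 × V)
  stack = record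
    { pos     = posₛ
    ; pos-inj = inj
    ; bound   = 3 * width
    ; pos<    = λ { (i , x) → ℕₚ.<-≤-trans (posₛ<next i x) (ℕₚ.*-monoˡ-≤ width (toℕ<n (σ ⟨$⟩ʳ i))) }
    }
    where
    inj : ∀ {x y} → posₛ x ≡ posₛ y → x ≡ y
    inj {i , x} {j , y} e with ℕₚ.<-cmp (slot i) (slot j)
    ... | tri< h _ _ = contradiction (posₛ-slot h) (ℕₚ.<-irrefl e)
    ... | tri> _ _ h = contradiction (posₛ-slot h) (ℕₚ.<-irrefl (sym e))
    ... | tri≈ _ h _ with slot-inj h
    ... | refl = cong (i ,_) (pos-inj (ℓ i) (ℕₚ.+-cancelˡ-≡ (slot i * width) _ _ e))

  record Active (X : Fin 3 × V → Bool) : Set where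
    field
      part    : Fin 3
      time    : ℕ
      current : ∀ x → X (part , x) ≡ cut (ℓ part) time x
      earlier : ∀ {i x} → slot i < slot part → X (i , x) ≡ true
      later   : ∀ {i x} → slot part < slot i → X (i , x) ≡ false

    before-or-in : ∀ {i x} → X (i , x) ≡ true → i ≡ part ⊎ slot i < slot part
    before-or-in {i} Xi with ℕₚ.<-cmp (slot i) (slot part)
    ... | tri< h _ _ = inj₂ h
    ... | tri≈ _ h _ = inj₁ (slot-inj h)
    ... | tri> _ _ h = contradiction (trans (sym Xi) (later h)) true≢false

    in-or-after : ∀ {i x} → X (i , x) ≡ false → i ≡ part ⊎ slot part < slot i
    in-or-after {i} Xi with ℕₚ.<-cmp (slot i) (slot part)
    ... | tri< h _ _ = contradiction (trans (sym (earlier h)) Xi) true≢false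
    ... | tri≈ _ h _ = inj₁ (slot-inj h)
    ... | tri> _ _ h = inj₂ h

    mixed : ∀ {i x y} → X (i , x) ≡ true → X (i , y) ≡ false → i ≡ part
    mixed Xx Xy with before-or-in Xx | in-or-after Xy
    ... | inj₁ e | _      = e
    ... | inj₂ _ | inj₁ e = e
    ... | inj₂ h | inj₂ k = contradiction h (ℕₚ.<-asym k)

  activeAt : ∀ t s → toℕ s * width ≤ t → t ≤ suc (toℕ s) * width ⊎ 2 ≤ toℕ s → Active (cut stack t)
  activeAt t s lo hi = record
    { part    = σ ⟨$⟩ˡ s
    ; time    = t ∸ toℕ s * width
    ; current = λ x → does-⇔ (_ <? _) (_ <? _)
        (λ h → subst (_< t ∸ toℕ s * width) (ℕₚ.m+n∸m≡n (toℕ s * width) _)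
          (ℕₚ.∸-monoˡ-< (subst (λ z → z * width + pos (ℓ (σ ⟨$⟩ˡ s)) x < t) slot-s h) (ℕₚ.m≤m+n (toℕ s * width) _)))
        (λ h → subst (λ z → z * width + pos (ℓ (σ ⟨$⟩ˡ s)) x < t) (sym slot-s)
          (subst (toℕ s * width + pos (ℓ (σ ⟨$⟩ˡ s)) x <_) (ℕₚ.m+[n∸m]≡n lo) (ℕₚ.+-monoʳ-< (toℕ s * width) h)))
    ; earlier = λ {i} {x} h → dec-true (_ <? _) (ℕₚ.<-≤-trans (posₛ<next i x)
        (≤-trans (ℕₚ.*-monoˡ-≤ width (subst (slot i <_) slot-s h)) lo))
    ; later   = λ {i} {x} h → dec-false (_ <? _) (ℕₚ.≤⇒≯ (after i x (subst (_< slot i) slot-s h) hi))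
    }
    where
    slot-s : slot (σ ⟨$⟩ˡ s) ≡ toℕ s
    slot-s = cong toℕ (inverseʳ σ)
    after : ∀ i x → toℕ s < slot i → t ≤ suc (toℕ s) * width ⊎ 2 ≤ toℕ s → t ≤ posₛ (i , x)
    after i x h (inj₁ t≤) = ≤-trans t≤ (≤-trans (ℕₚ.*-monoˡ-≤ width h) (ℕₚ.m≤m+n _ _))
    after i x h (inj₂ 2≤) = contradiction (≤-trans h (toℕ≤pred[n] (σ ⟨$⟩ʳ i))) (ℕₚ.<⇒≱ (s≤s 2≤))

  active : ∀ t → Active (cut stack t)
  active t with t ≤? 1 * width | t ≤? 2 * width
  ... | yes t≤ | _      = activeAt t 0F z≤n (inj₁ t≤)
  ... | no t≰  | yes t≤ = activeAt t 1F (ℕₚ.<⇒≤ (ℕₚ.≰⇒> t≰)) (inj₁ t≤)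
  -- The last slot has no upper limit, so it also takes the thresholds past the end.
  ... | no _   | no t≰  = activeAt t 2F (ℕₚ.<⇒≤ (ℕₚ.≰⇒> t≰)) (inj₂ ≤-refl)

-- Joining three rooted graphs by a triangle on the roots

-- A factorization for the graph in which `v` has received a pendant neighbour outside `X`; `tip` is
-- the column of that neighbour.
record Pend {V : Set} (_≟ᵥ_ : DecidableEquality V) (r : ℕ) (G : Gr V) (v : V) (X : V → Bool) : Set where
  constructor pend
  field
    row col : V → F₂^ r
    tip     : F₂^ r
    factor  : ∀ {x y} → X x ≡ true → X y ≡ false → G x y ≡ dot (row x) (col y)
    pendant : ∀ {x} → X x ≡ true → dot (row x) tip ≡ does (x ≟ᵥ v)

Pend⇒Fac : ∀ {V r} {_≟ᵥ_ : DecidableEquality V} {G : Gr V} {v} {X : V → Bool} → Pend _≟ᵥ_ r G v X → Fac r G X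
Pend⇒Fac (pend p q _ f _) = fac p q f

Fac⇒Pend : ∀ {V r} (_≟ᵥ_ : DecidableEquality V) {G : Gr V} {X : V → Bool} v → Fac r G X → Pend _≟ᵥ_ (suc r) G v X
Fac⇒Pend _≟ᵥ_ v (fac p q f) = pend (λ x → does (x ≟ᵥ v) ∷ p x) (λ y → false ∷ q y) (true ∷ 𝟎)
  (λ {x} {y} Xx Xy → trans (f Xx Xy) (cong (_xor dot (p x) (q y)) (sym (∧-zeroʳ (does (x ≟ᵥ v))))))
  (λ {x} _ → trans (cong₂ _xor_ (∧-comm (does (x ≟ᵥ v)) true) (dot-𝟎ʳ (p x))) (xor-identityʳ _))

-- Within `X` the vertex `v` has at most the neighbour `u`, so the border column is a multiple of
-- `tip` and costs nothing. One new coordinate carries the border row and the corner.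
Pend⇒Bord : ∀ {V r s d} {_≟ᵥ_ : DecidableEquality V} {G : Gr V} {u v} {X : V → Bool} w →
  (∀ x → X x ≡ true → G x v ≡ does (x ≟ᵥ u) ∧ w) → Pend _≟ᵥ_ r G u X → Bord (suc r) s d G v X
Pend⇒Bord {s = s} {d} {_≟ᵥ_} {G} {u} {v} w nbrs (pend p q z f g) = bord
  (λ x → false ∷ p x) (λ y → (s ∧ G v y) ∷ q y) (true ∷ 𝟎) (d ∷ (s ∧ w) · z)
  (λ _ _ Xx Xy → f Xx Xy)
  (λ {x} _ Xx → sym (trans (dot-·ʳ (s ∧ w) (p x) z) (trans (cong ((s ∧ w) ∧_) (g Xx))
    (trans (∧-assoc s w _) (cong (s ∧_) (trans (∧-comm w _) (sym (nbrs x Xx))))))))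
  (λ {y} _ _ → sym (trans (cong ((s ∧ G v y) xor_) (dot-𝟎ˡ (q y))) (xor-identityʳ _)))
  (sym (trans (cong (d xor_) (dot-𝟎ˡ ((s ∧ w) · z))) (xor-identityʳ d)))

module Join {V : Set} (_≟ᵥ_ : DecidableEquality V) (G : Fin 3 → Gr V) (root : Fin 3 → V) where

  _≟ₚ_ : DecidableEquality (Fin 3 × V)
  _≟ₚ_ = ≡-dec _≟_ _≟ᵥ_

  isRoot : Fin 3 × V → Bool
  isRoot (i , x) = does (x ≟ᵥ root i)

  join : Gr (Fin 3 × V)
  join (i , x) (j , y) = if does (i ≟ j) then G i x y else isRoot (i , x) ∧ isRoot (j , y)

  join-≡ : ∀ i x y → join (i , x) (i , y) ≡ G i x y
  join-≡ i x y = cong (if_then G i x y else (isRoot (i , x) ∧ isRoot (i , y))) (dec-true (i ≟ i) refl)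

  join-≢ : ∀ {i j} x y → i ≢ j → join (i , x) (j , y) ≡ isRoot (i , x) ∧ isRoot (j , y)
  join-≢ {i} {j} x y i≢j = cong (if_then G i x y else (isRoot (i , x) ∧ isRoot (j , y))) (dec-false (i ≟ j) i≢j)

  join-sym : (∀ i → Sym (G i)) → Sym join
  join-sym G-sym (i , x) (j , y) with i ≟ j
  ... | yes refl = trans (G-sym i x y) (sym (join-≡ i y x))
  ... | no  i≢j  = trans (∧-comm (isRoot (i , x)) _) (sym (join-≢ y x (i≢j ∘ sym)))

  join-irr : (∀ i → Irr (G i)) → Irr join
  join-irr G-irr (i , x) = trans (join-≡ i x x) (G-irr i x)

  module _ {X : Fin 3 × V → Bool} {Y : V → Bool} (a : Fin 3) (agree : ∀ x → X (a , x) ≡ Y x) where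

    -- Outside part `a` only the other two roots have neighbours in `X`, and each of their columns
    -- is the pendant column at the root of `a`. Hence the rest of the graph adds no dimension.
    Pend-first : ∀ {r} → (∀ {i x} → X (i , x) ≡ true → i ≡ a) →
      Pend _≟ᵥ_ r (G a) (root a) Y → Pend _≟ₚ_ r join (a , root a) X
    Pend-first {r} only (pend p q z f g) = pend (p ∘ proj₂) col z factor pendant
      where
      col : Fin 3 × V → F₂^ r
      col (j , y) = if does (j ≟ a) then q y else isRoot (j , y) · z
      factor : ∀ {x y} → X x ≡ true → X y ≡ false → join x y ≡ dot (p (proj₂ x)) (col y)
      factor {i , x} {j , y} Xx Xy with only Xx
      ... | refl with j ≟ a
      ... | yes refl = trans (join-≡ a x y) (f (trans (sym (agree x)) Xx) (trans (sym (agree y)) Xy))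
      ... | no  j≢a  = trans (join-≢ x y (j≢a ∘ sym)) (trans (∧-comm (isRoot (a , x)) _) (sym
        (trans (dot-·ʳ (isRoot (j , y)) (p x) z) (cong (isRoot (j , y) ∧_) (g (trans (sym (agree x)) Xx))))))
      pendant : ∀ {x} → X x ≡ true → dot (p (proj₂ x)) z ≡ does (x ≟ₚ (a , root a))
      pendant {i , x} Xx with only Xx
      ... | refl = trans (g (trans (sym (agree x)) Xx))
        (does-⇔ (x ≟ᵥ root a) ((a , x) ≟ₚ (a , root a)) (cong (a ,_)) (cong proj₂))

    -- With the middle part cut, all edges between different parts form the rank-one matrix
    -- isRoot ⊗ isRoot, which contributes one extra coordinate.
    mid : ∀ {r} → (V → F₂^ r) → Fin 3 × V → F₂^ (suc r)
    mid p (i , x) = isRoot (i , x) ∷ does (i ≟ a) · p x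

    dot-mid : ∀ {r} (p q : V → F₂^ r) i x j y →
      dot (mid p (i , x)) (mid q (j , y)) ≡ (isRoot (i , x) ∧ isRoot (j , y)) xor (does (i ≟ a) ∧ (does (j ≟ a) ∧ dot (p x) (q y)))
    dot-mid p q i x j y = cong ((isRoot (i , x) ∧ isRoot (j , y)) xor_) (trans (dot-·ˡ (does (i ≟ a)) (p x) _)
      (cong (does (i ≟ a) ∧_) (dot-·ʳ (does (j ≟ a)) (p x) (q y))))

    not-both : ∀ {x y v} → x ≢ y → does (x ≟ᵥ v) ∧ does (y ≟ᵥ v) ≡ false
    not-both {x} {y} {v} x≢y with x ≟ᵥ v
    ... | no  _    = refl
    ... | yes refl = dec-false (y ≟ᵥ x) (x≢y ∘ sym)

    -- Two different vertices of one part are not both its root, so the extra coordinate contributes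
    -- nothing.
    dot-mid-≡ : ∀ {r} (p q : V → F₂^ r) {x y} → x ≢ y → dot (mid p (a , x)) (mid q (a , y)) ≡ dot (p x) (q y)
    dot-mid-≡ p q {x} {y} x≢y = trans (dot-mid p q a x a y) (trans
      (cong₂ _xor_ (not-both x≢y) (cong (λ b → b ∧ (b ∧ dot (p x) (q y))) (dec-true (a ≟ a) refl))) refl)

    dot-mid-≢ : ∀ {r} (p q : V → F₂^ r) {i j} x y → i ≢ j → dot (mid p (i , x)) (mid q (j , y)) ≡ isRoot (i , x) ∧ isRoot (j , y)
    dot-mid-≢ p q {i} {j} x y i≢j = trans (dot-mid p q i x j y) (trans (cong ((isRoot (i , x) ∧ isRoot (j , y)) xor_) lemma) (xor-identityʳ _))
      where
      lemma : does (i ≟ a) ∧ (does (j ≟ a) ∧ dot (p x) (q y)) ≡ false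
      lemma with i ≟ a
      ... | no  _    = refl
      ... | yes refl = cong (_∧ dot (p x) (q y)) (dec-false (j ≟ i) (i≢j ∘ sym))

    Fac-mid : ∀ {r} → (∀ {i x y} → X (i , x) ≡ true → X (i , y) ≡ false → i ≡ a) → Fac r (G a) Y → Fac (suc r) join X
    Fac-mid mixed (fac p q f) = fac (mid p) (mid q) factor
      where
      factor : ∀ {x y} → X x ≡ true → X y ≡ false → join x y ≡ dot (mid p x) (mid q y)
      factor {i , x} {j , y} Xx Xy = case i ≟ j of λ where
        (no i≢j)   → trans (join-≢ x y i≢j) (sym (dot-mid-≢ p q x y i≢j))
        (yes refl) → case mixed Xx Xy of λ where
          refl → trans (join-≡ a x y) (trans (f (trans (sym (agree x)) Xx) (trans (sym (agree y)) Xy))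
            (sym (dot-mid-≡ p q (λ e → separated {X = X} Xx Xy (cong (a ,_) e)))))

    -- Border row and border column both get the entry `s ∧ isRoot (a , v)` in the extra coordinate,
    -- to account for the edges from `v` to the other roots. Its square appears in the corner, so
    -- the border inside the part must start from the corner corrected by it.
    Bord-mid : ∀ {r s d v} → (∀ {i x y} → X (i , x) ≡ true → X (i , y) ≡ false → i ≡ a) →
      Bord r s (d xor (s ∧ isRoot (a , v))) (G a) v Y → Bord (suc r) s d join (a , v) X
    Bord-mid {r} {s} {d} {v} mixed (bord p q pᵛ qᵛ b c c′ k) =
      bord (mid p) (mid q) (e ∷ pᵛ) (e ∷ qᵛ) bulk border-col border-row (trans (corner-table d e) (cong ((e ∧ e) xor_) k))
      where
      e = s ∧ isRoot (a , v)
      corner-table : ∀ d e → d ≡ (e ∧ e) xor (d xor e)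
      corner-table false false = refl
      corner-table false true  = refl
      corner-table true  false = refl
      corner-table true  true  = refl
      swap : ∀ x y z → x ∧ (y ∧ z) ≡ y ∧ (x ∧ z)
      swap true  y z = refl
      swap false y z = sym (∧-zeroʳ y)
      at-≢ : ∀ {x} → (a , x) ≢ (a , v) → x ≢ v
      at-≢ h refl = h refl
      bulk : ∀ {x y} → x ≢ (a , v) → y ≢ (a , v) → X x ≡ true → X y ≡ false → join x y ≡ dot (mid p x) (mid q y)
      bulk {i , x} {j , y} x≢ y≢ Xx Xy = case i ≟ j of λ where
        (no i≢j)   → trans (join-≢ x y i≢j) (sym (dot-mid-≢ p q x y i≢j))
        (yes refl) → case mixed Xx Xy of λ where
          refl → trans (join-≡ a x y) (trans (b (at-≢ x≢) (at-≢ y≢) (trans (sym (agree x)) Xx) (trans (sym (agree y)) Xy))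
            (sym (dot-mid-≡ p q (λ e → separated {X = X} Xx Xy (cong (a ,_) e)))))
      border-col : ∀ {x} → x ≢ (a , v) → X x ≡ true → s ∧ join x (a , v) ≡ dot (mid p x) (e ∷ qᵛ)
      border-col {i , x} x≢ Xx with i ≟ a
      ... | yes refl = trans (c (at-≢ x≢) (trans (sym (agree x)) Xx)) (sym (cong₂ _xor_
              (trans (swap (isRoot (a , x)) s _) (trans (cong (s ∧_) (not-both (at-≢ x≢))) (∧-zeroʳ s)))
              (dot-·ˡ true (p x) qᵛ)))
      ... | no  _    = sym (trans (cong₂ _xor_ (swap (isRoot (i , x)) s _) (dot-·ˡ false (p x) qᵛ)) (xor-identityʳ _))
      border-row : ∀ {y} → y ≢ (a , v) → X y ≡ false → s ∧ join (a , v) y ≡ dot (e ∷ pᵛ) (mid q y)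
      border-row {j , y} y≢ Xy with j ≟ a
      ... | yes refl = trans (cong (s ∧_) (join-≡ a v y)) (trans (c′ (at-≢ y≢) (trans (sym (agree y)) Xy)) (sym (cong₂ _xor_
              (trans (∧-assoc s _ _) (trans (cong (s ∧_) (not-both (at-≢ y≢ ∘ sym))) (∧-zeroʳ s)))
              (dot-·ʳ true pᵛ (q y)))))
      ... | no  j≢a  = trans (cong (s ∧_) (join-≢ v y (j≢a ∘ sym))) (sym (trans (cong₂ _xor_ (∧-assoc s (isRoot (a , v)) _) (dot-·ʳ false pᵛ (q y))) (xor-identityʳ _)))

-- Width at most k+1 even after a pendant neighbour of `v` is put at the very end of the layout.
-- This is the room that a part needs for the columns of the other roots.
Rootable : ∀ {V} → DecidableEquality V → ℕ → Gr V → Set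
Rootable {V} _≟ᵥ_ k G = ∀ v → Σ (Layout V) λ ℓ → ∀ t → Pend _≟ᵥ_ (suc k) G v (cut ℓ t)

-- Connectedness.
Cross : ∀ {V} → Gr V → Set
Cross {V} G = ∀ (X : V → Bool) x y → X x ≡ true → X y ≡ false → ∃ λ u → ∃ λ w → X u ≡ true × X w ≡ false × G u w ≡ true

toSlot : ∀ (s i : Fin 3) → transpose i s ⟨$⟩ʳ i ≡ s
toSlot s i rewrite dec-true (i ≟ i) refl = refl

sort₃ : (t : Fin 3 → ℕ) → ∃ λ a → ∃ λ b → ∃ λ c → a ≢ b × c ≢ b × t a ≤ t b × t b ≤ t c
sort₃ t with ℕₚ.≤-total (t 0F) (t 1F) | ℕₚ.≤-total (t 1F) (t 2F) | ℕₚ.≤-total (t 0F) (t 2F)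
... | inj₁ p | inj₁ q | _      = 0F , 1F , 2F , (λ ()) , (λ ()) , p , q
... | inj₁ p | inj₂ q | inj₁ r = 0F , 2F , 1F , (λ ()) , (λ ()) , r , q
... | inj₁ p | inj₂ q | inj₂ r = 2F , 0F , 1F , (λ ()) , (λ ()) , r , p
... | inj₂ p | inj₁ q | inj₁ r = 1F , 0F , 2F , (λ ()) , (λ ()) , p , r
... | inj₂ p | inj₁ q | inj₂ r = 1F , 2F , 0F , (λ ()) , (λ ()) , q , r
... | inj₂ p | inj₂ q | _      = 2F , 1F , 0F , (λ ()) , (λ ()) , q , p

Tri-snoc : ∀ {V} {G : Gr V} {X : V → Bool} {u w l} → X u ≡ true → X w ≡ false → G u w ≡ true →
  All (λ p → G (proj₁ p) w ≡ false) l → Tri G X l → Tri G X (l ++ (u , w) ∷ [])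
Tri-snoc Xu Xw Guw []       []                = step Xu Xw Guw [] []
Tri-snoc Xu Xw Guw (e ∷ es) (step a b c ds t) = step a b c (Allₚ.++⁺ ds (e ∷ [])) (Tri-snoc Xu Xw Guw es t)

module JoinWidth {V : Set} (_≟ᵥ_ : DecidableEquality V) (G : Fin 3 → Gr V) (root : Fin 3 → V) where

  open Join _≟ᵥ_ G root

  module _ {k} (G-sym : ∀ i → Sym (G i)) (G-root : ∀ i → Rootable _≟ᵥ_ k (G i)) where

    toRoot : Fin 3 → Layout V
    toRoot i = proj₁ (G-root i (root i))

    -- The last part runs backwards, so that seen from the end its root faces the other parts just
    -- as the root of the first part does.
    arrange : (Fin 3 → Layout V) → Fin 3 → Fin 3 → Layout V
    arrange m i 0F = toRoot i
    arrange m i 1F = m i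
    arrange m i 2F = rev (toRoot i)

    module _ (σ : Permutation′ 3) (m : Fin 3 → Layout V) where

      arranged : Fin 3 → Layout V
      arranged i = arrange m i (σ ⟨$⟩ʳ i)

      module _ t (A : Active σ arranged (cut (stack σ arranged) t)) where
        open Active A

        Xₛ : Fin 3 × V → Bool
        Xₛ = cut (stack σ arranged) t

        agree : ∀ {s} → σ ⟨$⟩ʳ part ≡ s → ∀ x → Xₛ (part , x) ≡ cut (arrange m part s) time x
        agree e x = trans (current x) (cong (λ s → cut (arrange m part s) time x) e)

        first : σ ⟨$⟩ʳ part ≡ 0F → Pend _≟ₚ_ (suc k) join (part , root part) Xₛ
        first e = Pend-first part (agree e) only (proj₂ (G-root part (root part)) time)
          where
          only : ∀ {i x} → Xₛ (i , x) ≡ true → i ≡ part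
          only {i} Xx with before-or-in Xx
          ... | inj₁ i≡ = i≡
          ... | inj₂ h  = contradiction (subst (λ s → slot σ arranged i < toℕ s) e h) λ ()

        last : σ ⟨$⟩ʳ part ≡ 2F → Pend _≟ₚ_ (suc k) join (part , root part) (not ∘ Xₛ)
        last e = Pend-first part (λ x → trans (cong not (agree e x)) (sym (proj₂ reversed x))) only (proj₂ (G-root part (root part)) (proj₁ reversed))
          where
          reversed = cut-rev (toRoot part) time
          only : ∀ {i x} → not (Xₛ (i , x)) ≡ true → i ≡ part
          only {i} Xx with in-or-after (not-true Xx)
          ... | inj₁ i≡ = i≡
          ... | inj₂ h  = contradiction (ℕₚ.<-≤-trans (subst (λ s → toℕ s < slot σ arranged i) e h) (toℕ≤pred[n] (σ ⟨$⟩ʳ i))) (ℕₚ.<-irrefl refl)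

    -- The part of `v` goes last. A cut in the first or last part costs nothing for the join and one
    -- dimension for the new `tip`. A cut in the middle part costs one for the edges between parts,
    -- but `v` is still to come and `tip` is zero.
    join-Rootable : Rootable _≟ₚ_ (suc k) join
    join-Rootable (c , v) = stack σ (arranged σ toRoot) , λ t → finish t (active σ (arranged σ toRoot) t)
      where
      σ = transpose c 2F
      finish : ∀ t → Active σ (arranged σ toRoot) (cut (stack σ (arranged σ toRoot)) t) →
               Pend _≟ₚ_ (suc (suc k)) join (c , v) (cut (stack σ (arranged σ toRoot)) t)
      finish t A = at (σ ⟨$⟩ʳ Active.part A) refl
        where
        open Active A
        at : ∀ s → σ ⟨$⟩ʳ part ≡ s → Pend _≟ₚ_ (suc (suc k)) join (c , v) (cut (stack σ (arranged σ toRoot)) t)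
        at 0F e = Fac⇒Pend _≟ₚ_ (c , v) (Pend⇒Fac (first σ toRoot t A e))
        at 1F e with Fac-mid part (agree σ toRoot t A e) mixed (Pend⇒Fac (proj₂ (G-root part (root part)) time))
        ... | fac p q f = pend p q 𝟎 f λ {x} Xx → trans (dot-𝟎ʳ (p x)) (sym (dec-false (x ≟ₚ (c , v)) λ where
                refl → true≢false (trans (sym Xx) (later {c} {v} (ℕₚ.≤-reflexive (trans (cong (suc ∘ toℕ) e) (sym (cong toℕ (toSlot 2F c)))))))))
        at 2F e = Fac⇒Pend _≟ₚ_ (c , v) (Fac-cong (λ _ _ → refl) (λ x → not-involutive (cut (stack σ (arranged σ toRoot)) t x)) (Fac-transpose (join-sym G-sym) (Pend⇒Fac (last σ toRoot t A e))))

    -- The part `b` of the removed vertex goes into the middle, in its own layout for the corrected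
    -- code. For cuts in an outer part, the only possible neighbour of `v` there is the root, and
    -- `Pend⇒Bord` costs one dimension.
    join-Deletable : (∀ i → Deletable k (G i)) → Deletable (suc k) join
    join-Deletable G-del (b , v) s d s∨d = stack σ ℓ , λ t → finish t (active σ ℓ t)
      where
      σ = transpose b 1F
      middle = G-del b v s (d xor (s ∧ isRoot (b , v))) (table s d (isRoot (b , v)) s∨d)
        where
        table : ∀ s d e → s ∨ d ≡ true → s ∨ (d xor (s ∧ e)) ≡ true
        table true  d    e h = refl
        table false true e h = refl
      m : Fin 3 → Layout V
      m _ = proj₁ middle
      ℓ = arranged σ m
      finish : ∀ t → Active σ ℓ (cut (stack σ ℓ) t) → Bord (suc (suc k)) s d join (b , v) (cut (stack σ ℓ) t)
      finish t A = at (σ ⟨$⟩ʳ Active.part A) refl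
        where
        open Active A
        nbrs : part ≢ b → ∀ {i} x → i ≡ part → join (i , x) (b , v) ≡ does ((i , x) ≟ₚ (part , root part)) ∧ isRoot (b , v)
        nbrs part≢b x refl = trans (join-≢ x v part≢b)
          (cong (_∧ isRoot (b , v)) (does-⇔ (x ≟ᵥ root part) ((part , x) ≟ₚ (part , root part)) (cong (part ,_)) (cong proj₂)))
        part≢b : ∀ {s} → σ ⟨$⟩ʳ part ≡ s → s ≢ 1F → part ≢ b
        part≢b e s≢1 refl = s≢1 (trans (sym e) (toSlot 1F b))
        at : ∀ s′ → σ ⟨$⟩ʳ part ≡ s′ → Bord (suc (suc k)) s d join (b , v) (cut (stack σ ℓ) t)
        at 0F e = Pend⇒Bord (isRoot (b , v)) nb (first σ m t A e)
          where
          nb : ∀ x → cut (stack σ ℓ) t x ≡ true → join x (b , v) ≡ does (x ≟ₚ (part , root part)) ∧ isRoot (b , v)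
          nb (i , x) Xx with before-or-in Xx
          ... | inj₁ i≡ = nbrs (part≢b e (λ ())) x i≡
          ... | inj₂ h  = contradiction (subst (λ s → slot σ ℓ i < toℕ s) e h) λ ()
        at 1F e with slot-inj σ ℓ {part} {b} (cong toℕ (trans e (sym (toSlot 1F b))))
        ... | refl = Bord-mid b (agree σ m t A e) mixed (proj₂ middle time)
        at 2F e = Bord-untranspose (join-sym G-sym) (Pend⇒Bord (isRoot (b , v)) nb (last σ m t A e))
          where
          nb : ∀ x → not (cut (stack σ ℓ) t x) ≡ true → join x (b , v) ≡ does (x ≟ₚ (part , root part)) ∧ isRoot (b , v)
          nb (i , x) Xx with in-or-after (not-true Xx)
          ... | inj₁ i≡ = nbrs (part≢b e (λ ())) x i≡
          ... | inj₂ h  = contradiction (ℕₚ.<-≤-trans (subst (λ s → toℕ s < slot σ ℓ i) e h) (toℕ≤pred[n] (σ ⟨$⟩ʳ i))) (ℕₚ.<-irrefl refl)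

  module _ (G-cross : ∀ i → Cross (G i)) where

    -- Any selection of the parts is connected, because the parts are connected and their roots
    -- pairwise adjacent. It is applied to the two parts other than the middle one.
    join-cross-within : (P : Fin 3 → Set) (X : Fin 3 × V → Bool) → ∀ i x j y → P i → P j → X (i , x) ≡ true → X (j , y) ≡ false →
      ∃ λ u → ∃ λ w → X u ≡ true × X w ≡ false × join u w ≡ true × P (proj₁ u) × P (proj₁ w)
    join-cross-within P X i x j y Pi Pj Xx Xy = go (i ≟ j)
      where
      inside : ∀ i x y → P i → X (i , x) ≡ true → X (i , y) ≡ false →
        ∃ λ u → ∃ λ w → X u ≡ true × X w ≡ false × join u w ≡ true × P (proj₁ u) × P (proj₁ w)
      inside i x y Pi Xx Xy with G-cross i (λ z → X (i , z)) x y Xx Xy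
      ... | u , w , Xu , Xw , Guw = (i , u) , (i , w) , Xu , Xw , trans (join-≡ i u w) Guw , Pi , Pi
      go : Dec (i ≡ j) → ∃ λ u → ∃ λ w → X u ≡ true × X w ≡ false × join u w ≡ true × P (proj₁ u) × P (proj₁ w)
      go (yes refl) = inside i x y Pi Xx Xy
      go (no i≢j) with X (i , root i) in Xi | X (j , root j) in Xj
      ... | false | _     = inside i x (root i) Pi Xx Xi
      ... | true  | true  = inside j (root j) y Pj Xj Xy
      ... | true  | false = (i , root i) , (j , root j) , Xi , Xj ,
        trans (join-≢ (root i) (root j) i≢j) (cong₂ _∧_ (dec-true (root i ≟ᵥ root i) refl) (dec-true (root j ≟ᵥ root j) refl)) , Pi , Pj

    join-Cross : Cross join
    join-Cross X (i , x) (j , y) Xx Xy with join-cross-within (λ _ → ⊤) X i x j y tt tt Xx Xy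
    ... | u , w , Xu , Xw , e , _ = u , w , Xu , Xw , e

    -- At the middle of the three thresholds the triangle of its part extends by an edge of
    -- the other two parts: the cut matrix is block triangular, because only the root of the
    -- part has neighbours outside it.
    join-Wide : ∀ {m} → (∀ i → Wide (suc m) (G i)) → Wide (suc (suc m)) join
    join-Wide {m} G-wide f f-inj = time b , extend (X (b , root b)) refl
      where
      wide : ∀ i → Σ ℕ λ t → Σ (List (V × V)) λ l → Tri (G i) (before (λ x → f (i , x)) t) l × length l ≡ suc m
      wide i = G-wide i (λ x → f (i , x)) (λ e → cong proj₂ (f-inj e))
      time : Fin 3 → ℕ
      time i = proj₁ (wide i)
      sorted = sort₃ time
      a = proj₁ sorted
      b = proj₁ (proj₂ sorted)
      c = proj₁ (proj₂ (proj₂ sorted))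
      a≢b = proj₁ (proj₂ (proj₂ (proj₂ sorted)))
      c≢b = proj₁ (proj₂ (proj₂ (proj₂ (proj₂ sorted))))
      a≤b = proj₁ (proj₂ (proj₂ (proj₂ (proj₂ (proj₂ sorted)))))
      b≤c = proj₂ (proj₂ (proj₂ (proj₂ (proj₂ (proj₂ sorted)))))
      X = before f (time b)
      -- The triangle of each part is nonempty, so the part has vertices on both sides of its own
      -- threshold. As `time a` ≤ `time b` ≤ `time c`, part `a` has a vertex in `X` and part `c` one
      -- outside.
      pairOf : ∀ i → ∃ λ u → ∃ λ w → f (i , u) < time i × ¬ (f (i , w) < time i)
      pairOf i with wide i
      ... | t , _ ∷ _ , step {u} {w} Xu Xw _ _ _ , _ = u , w , does-true (_ <? _) Xu , does-false (_ <? _) Xw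
      crossing = join-cross-within (_≢ b) X a (proj₁ (pairOf a)) c (proj₁ (proj₂ (pairOf c))) a≢b c≢b
        (dec-true (_ <? _) (ℕₚ.<-≤-trans (proj₁ (proj₂ (proj₂ (pairOf a)))) a≤b))
        (dec-false (_ <? _) (λ h → proj₂ (proj₂ (proj₂ (pairOf c))) (ℕₚ.<-≤-trans h b≤c)))
      inB : V × V → (Fin 3 × V) × (Fin 3 × V)
      inB z = (b , proj₁ z) , (b , proj₂ z)
      l = map inB (proj₁ (proj₂ (wide b)))
      tri : Tri join X l
      tri = Tri-map (b ,_) (join-≡ b) (λ _ → refl) (proj₁ (proj₂ (proj₂ (wide b))))
      len : length l ≡ suc m
      len = trans (length-map inB (proj₁ (proj₂ (wide b)))) (proj₂ (proj₂ (proj₂ (wide b))))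
      u = proj₁ crossing
      w = proj₁ (proj₂ crossing)
      Xu = proj₁ (proj₂ (proj₂ crossing))
      Xw = proj₁ (proj₂ (proj₂ (proj₂ crossing)))
      Guw = proj₁ (proj₂ (proj₂ (proj₂ (proj₂ crossing))))
      u≢b = proj₁ (proj₂ (proj₂ (proj₂ (proj₂ (proj₂ crossing)))))
      w≢b = proj₂ (proj₂ (proj₂ (proj₂ (proj₂ (proj₂ crossing)))))
      -- If the root of `b` is in `X`, no column of `tri` belongs to it, so row `u` vanishes on
      -- these columns and the new pair goes first. Otherwise no row of `tri` belongs to it, so
      -- column `w` vanishes on these rows and the pair goes last.
      extend : ∀ β → X (b , root b) ≡ β → Σ (List _) λ l → Tri join X l × length l ≡ suc (suc m)
      extend true Xb = (u , w) ∷ l , step Xu Xw Guw (cols tri) tri , cong suc len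
        where
        cols : ∀ {l} → Tri join X (map inB l) → All (λ z → join u (proj₂ z) ≡ false) (map inB l)
        cols {[]} [] = []
        cols {(u′ , w′) ∷ l} (step _ Xw′ _ _ t) = trans (join-≢ _ w′ u≢b)
          (trans (cong (isRoot u ∧_) (dec-false (w′ ≟ᵥ root b) λ { refl → true≢false (trans (sym Xb) Xw′) })) (∧-zeroʳ (isRoot u))) ∷ cols t
      extend false Xb = l ++ (u , w) ∷ [] , Tri-snoc Xu Xw Guw (rows tri) tri , trans (length-++ l) (trans (ℕₚ.+-comm (length l) 1) (cong suc len))
        where
        rows : ∀ {l} → Tri join X (map inB l) → All (λ z → join (proj₁ z) w ≡ false) (map inB l)
        rows {[]} [] = []
        rows {(u′ , w′) ∷ l} (step Xu′ _ _ _ t) = trans (join-≢ u′ _ (w≢b ∘ sym)) (cong (_∧ isRoot w)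
          (dec-false (u′ ≟ᵥ root b) λ { refl → true≢false (trans (sym Xu′) Xb) })) ∷ rows t

-- Iterated joins of copies of a base graph

Vertex : Set → ℕ → Set
Vertex A zero    = A
Vertex A (suc k) = Fin 3 × Vertex A k

-- The vertex type of the leaves is a parameter because trees are used twice: over `K₂` for the
-- obstructions, and over a single vertex for the triangle cacti that are counted.
data Tree (A : Set) : ℕ → Set where
  leaf : Tree A zero
  node : ∀ {k} → (Fin 3 → Tree A k) → (Fin 3 → Vertex A k) → Tree A (suc k)

module Trees {A : Set} (_≟ₐ_ : DecidableEquality A) (base : Gr A) where

  vertex-≟ : ∀ k → DecidableEquality (Vertex A k)
  vertex-≟ zero    = _≟ₐ_
  vertex-≟ (suc k) = ≡-dec _≟_ (vertex-≟ k)

  adj : ∀ {k} → Tree A k → Gr (Vertex A k)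
  adj leaf               = base
  adj {suc k} (node T r) = Join.join (vertex-≟ k) (λ i → adj (T i)) r

  adj-sym : Sym base → ∀ {k} (T : Tree A k) → Sym (adj T)
  adj-sym base-sym leaf       = base-sym
  adj-sym base-sym {suc k} (node T r) = Join.join-sym (vertex-≟ k) (λ i → adj (T i)) r (λ i → adj-sym base-sym (T i))

  adj-irr : Irr base → ∀ {k} (T : Tree A k) → Irr (adj T)
  adj-irr base-irr leaf       = base-irr
  adj-irr base-irr {suc k} (node T r) = Join.join-irr (vertex-≟ k) (λ i → adj (T i)) r (λ i → adj-irr base-irr (T i))

  adj-Cross : Cross base → ∀ {k} (T : Tree A k) → Cross (adj T)
  adj-Cross base-cross leaf       = base-cross
  adj-Cross base-cross {suc k} (node T r) = JoinWidth.join-Cross (vertex-≟ k) (λ i → adj (T i)) r (λ i → adj-Cross base-cross (T i))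

-- The base graph K₂ and the width of the trees built from it

K₂ : Gr Bool
K₂ = _xor_

open Trees _≟ᵇ_ K₂

K₂-true : ∀ {x y} → x ≢ y → K₂ x y ≡ true
K₂-true {false} {false} h = contradiction refl h
K₂-true {false} {true}  h = refl
K₂-true {true}  {false} h = refl
K₂-true {true}  {true}  h = contradiction refl h

K₂-sym : Sym K₂
K₂-sym = xor-comm

K₂-irr : Irr K₂
K₂-irr = xor-same

K₂-Cross : Cross K₂
K₂-Cross X x y Xx Xy = x , y , Xx , Xy , K₂-true (separated {X = X} Xx Xy)

K₂-layout : Layout Bool
K₂-layout = record { pos = λ b → if b then 1 else 0 ; pos-inj = inj ; bound = 2 ; pos< = bounded }
  where
  inj : ∀ {x y} → (if x then 1 else 0) ≡ (if y then 1 else 0) → x ≡ y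
  inj {false} {false} _ = refl
  inj {true}  {true}  _ = refl
  bounded : ∀ b → (if b then 1 else 0) < 2
  bounded false = s≤s z≤n
  bounded true  = s≤s (s≤s z≤n)

-- With the pendant vertex this is a path on three vertices: one side of each cut has at most one
-- vertex, so the rank is at most 1.
K₂-Rootable : Rootable _≟ᵇ_ 0 K₂
K₂-Rootable v = K₂-layout , λ t → go (cut K₂-layout t)
  where
  single : ∀ {X : Bool → Bool} x → (∀ {y} → X y ≡ true → y ≡ x) → Pend _≟ᵇ_ 1 K₂ v X
  single {X} x only = pend (λ _ → true ∷ []) (λ _ → true ∷ []) (does (x ≟ᵇ v) ∷ [])
    (λ {x} {y} Xx Xy → K₂-true (separated {X = X} Xx Xy)) (λ { Xy → trans (xor-identityʳ _) (cong (λ z → does (z ≟ᵇ v)) (sym (only Xy))) })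
  go : ∀ X → Pend _≟ᵇ_ 1 K₂ v X
  go X with X false in X₀ | X true in X₁
  ... | false | _     = single true  λ { {true} _ → refl ; {false} e → contradiction (trans (sym e) X₀) true≢false }
  ... | true  | false = single false λ { {false} _ → refl ; {true} e → contradiction (trans (sym e) X₁) true≢false }
  ... | true  | true  = pend (λ x → does (x ≟ᵇ v) ∷ []) (λ _ → true ∷ []) (true ∷ [])
    (λ { {_} {false} _ e → contradiction (trans (sym X₀) e) true≢false ; {_} {true} _ e → contradiction (trans (sym X₁) e) true≢false })
    (λ _ → trans (xor-identityʳ _) (∧-comm _ true))

-- Besides `v` there is only `not v`, on one side of the cut, so the bordered matrix is a single
-- column or a single row.
K₂-Deletable : Deletable 0 K₂
K₂-Deletable v s d _ = K₂-layout , λ t → go (cut K₂-layout t)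
  where
  other : ∀ {x} → x ≢ v → x ≡ not v
  other h = xor-true (K₂-true h)
    where
    xor-true : ∀ {x y} → x xor y ≡ true → x ≡ not y
    xor-true {false} {true}  _ = refl
    xor-true {true}  {false} _ = refl
  entry : ∀ b → b ≡ (b ∧ true) xor false
  entry false = refl
  entry true  = refl
  go : ∀ X → Bord 1 s d K₂ v X
  go X with X (not v) in Xv
  ... | true = bord (λ _ → s ∷ []) (λ _ → s ∷ []) (d ∷ []) (true ∷ [])
    (λ x≢ y≢ Xx Xy → contradiction (trans (sym Xx) (trans (cong X (trans (other x≢) (sym (other y≢)))) Xy)) true≢false)
    (λ x≢ Xx → trans (cong (s ∧_) (K₂-true x≢)) (sym (xor-identityʳ _)))
    (λ {y} y≢ Xy → contradiction (trans (sym Xv) (trans (cong X (sym (other y≢))) Xy)) true≢false)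
    (entry d)
  ... | false = bord (λ _ → s ∷ []) (λ _ → s ∷ []) (true ∷ []) (d ∷ [])
    (λ x≢ y≢ Xx Xy → contradiction (trans (sym Xx) (trans (cong X (trans (other x≢) (sym (other y≢)))) Xy)) true≢false)
    (λ x≢ Xx → contradiction (trans (sym Xx) (trans (cong X (other x≢)) Xv)) true≢false)
    (λ y≢ Xy → trans (cong (s ∧_) (K₂-true (y≢ ∘ sym))) (trans (∧-comm s true) (sym (xor-identityʳ s))))
    (sym (xor-identityʳ d))

K₂-Wide : Wide 1 K₂
K₂-Wide f f-inj with ℕₚ.<-cmp (f false) (f true)
... | tri< h _ _ = f true  , (false , true) ∷ [] , step (dec-true (_ <? _) h) (dec-false (_ <? _) (ℕₚ.n≮n (f true))) refl [] [] , refl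
... | tri≈ _ e _ = contradiction (f-inj e) λ ()
... | tri> _ _ h = f false , (true , false) ∷ [] , step (dec-true (_ <? _) h) (dec-false (_ <? _) (ℕₚ.n≮n (f false))) refl [] [] , refl

tree-Rootable : ∀ {k} (T : Tree Bool k) → Rootable (vertex-≟ k) k (adj T)
tree-Rootable leaf       = K₂-Rootable
tree-Rootable {suc k} (node T r) = JoinWidth.join-Rootable (vertex-≟ k) (λ i → adj (T i)) r (λ i → adj-sym K₂-sym (T i)) (λ i → tree-Rootable (T i))

tree-Deletable : ∀ {k} (T : Tree Bool k) → Deletable k (adj T)
tree-Deletable leaf       = K₂-Deletable
tree-Deletable {suc k} (node T r) = JoinWidth.join-Deletable (vertex-≟ k) (λ i → adj (T i)) r (λ i → adj-sym K₂-sym (T i)) (λ i → tree-Rootable (T i)) (λ i → tree-Deletable (T i))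

tree-Wide : ∀ {k} (T : Tree Bool k) → Wide (suc k) (adj T)
tree-Wide leaf       = K₂-Wide
tree-Wide {suc k} (node T r) = JoinWidth.join-Wide (vertex-≟ k) (λ i → adj (T i)) r (λ i → adj-Cross K₂-Cross (T i)) (λ i → tree-Wide (T i))

-- Transfer to graphs on Fin n

order-of : ℕ → ℕ
order-of zero    = 2
order-of (suc k) = 3 * order-of k

numbering : ∀ k → Fin (order-of k) ↔ Vertex Bool k
numbering zero    = 2↔Bool
numbering (suc k) = (↔-id (Fin 3) ×-↔ numbering k) ↔-∘ *↔×

treeGraph : ∀ {k} → Tree Bool k → Graph (order-of k)
treeGraph {k} T x y = adj T (Inverse.to (numbering k) x) (Inverse.to (numbering k) y)

module _ {k} (T : Tree Bool k) where
  open Inverse (numbering k)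

  private
    to-inj : ∀ {x y} → to x ≡ to y → x ≡ y
    to-inj {x} {y} e = trans (sym (strictlyInverseʳ x)) (trans (cong from e) (strictlyInverseʳ y))
    from-inj : ∀ {x y} → from x ≡ from y → x ≡ y
    from-inj {x} {y} e = trans (sym (strictlyInverseˡ x)) (trans (cong to e) (strictlyInverseˡ y))

  treeGraph-simple : Simple (treeGraph T)
  treeGraph-simple = (λ x y → adj-sym K₂-sym T (to x) (to y)) , λ x → adj-irr K₂-irr T (to x)

  treeGraph-LrwGt : LrwGt k (treeGraph T)
  treeGraph-LrwGt = Wide⇒LrwGt (treeGraph T) wide
    where
    wide : Wide (suc k) (treeGraph T)
    wide f f-inj with tree-Wide T (f ∘ from) (from-inj ∘ f-inj)
    ... | t , l , tri , len = t , _ , Tri-map from (λ x y → cong₂ (adj T) (strictlyInverseˡ x) (strictlyInverseˡ y)) (λ _ → refl) tri ,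
      trans (length-map _ l) len

  treeGraph-Deletable : Deletable k (treeGraph T)
  treeGraph-Deletable v s d s∨d with tree-Deletable T (to v) s d s∨d
  ... | ℓ , b = Layout-pull to to-inj ℓ , λ t → Bord-pull to to-inj (b t)

  treeGraph-CutEquiv : CutEquiv (treeGraph T) (adj T)
  treeGraph-CutEquiv = CutEquiv-bijection (numbering k) (λ _ _ → refl)

record GraphIso {V : Set} (G H : Gr V) : Set where
  field
    to from  : V → V
    to-from  : ∀ y → to (from y) ≡ y
    from-to  : ∀ x → from (to x) ≡ x
    adjacent : ∀ x y → H (to x) (to y) ≡ G x y

GraphIso-sym : ∀ {V} {G H : Gr V} → GraphIso G H → GraphIso H G
GraphIso-sym {G = G} {H} φ = record
  { to = from ; from = to ; to-from = from-to ; from-to = to-from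
  ; adjacent = λ x y → trans (sym (adjacent (from x) (from y))) (cong₂ H (to-from x) (to-from y)) }
  where open GraphIso φ

-- Sums over lists

⨁ : {C : Set} → List C → (C → Bool) → Bool
⨁ []       g = false
⨁ (z ∷ zs) g = g z xor ⨁ zs g

⨁-zero : ∀ {C : Set} {zs : List C} {g} → All (λ z → g z ≡ false) zs → ⨁ zs g ≡ false
⨁-zero []       = refl
⨁-zero (e ∷ es) = cong₂ _xor_ e (⨁-zero es)

⨁-cong : ∀ {C : Set} (zs : List C) {g g′ : C → Bool} → (∀ z → g z ≡ g′ z) → ⨁ zs g ≡ ⨁ zs g′
⨁-cong []       e = refl
⨁-cong (z ∷ zs) e = cong₂ _xor_ (e z) (⨁-cong zs e)

⨁-δ : ∀ {C : Set} {zs : List C} {g w} → Unique zs → w ∈ₗ zs → (∀ {z} → z ≢ w → g z ≡ false) → ⨁ zs g ≡ g w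
⨁-δ {g = g} {w} (z≢ ∷ _) (here refl) off = trans (cong (g w xor_) (⨁-zero (All.map (λ w≢z → off (w≢z ∘ sym)) z≢))) (xor-identityʳ _)
⨁-δ {zs = _ ∷ zs} {g} {w} (z≢ ∷ uq) (there m) off = trans (cong (_xor ⨁ zs g) (off (All.lookup z≢ m))) (⨁-δ uq m off)

⨁ᵥ : ∀ {C : Set} {r} → List C → (C → F₂^ r) → F₂^ r
⨁ᵥ []       g = 𝟎
⨁ᵥ (z ∷ zs) g = g z ⊕ ⨁ᵥ zs g

dot-⨁ᵥ : ∀ {C : Set} {r} (zs : List C) (g : C → F₂^ r) q → dot (⨁ᵥ zs g) q ≡ ⨁ zs (λ z → dot (g z) q)
dot-⨁ᵥ []       g q = dot-𝟎ˡ q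
dot-⨁ᵥ (z ∷ zs) g q = trans (dot-⊕ˡ (g z) (⨁ᵥ zs g) q) (cong (dot (g z) q xor_) (dot-⨁ᵥ zs g q))

values : ∀ {C : Set} (zs : List C) → (C → Bool) → F₂^ (length zs)
values []       g = []
values (z ∷ zs) g = g z ∷ values zs g

dot-values : ∀ {C : Set} (zs : List C) f g → dot (values zs f) (values zs g) ≡ ⨁ zs (λ z → f z ∧ g z)
dot-values []       f g = refl
dot-values (z ∷ zs) f g = cong ((f z ∧ g z) xor_) (dot-values zs f g)

-- Coronas

not≢ : ∀ s → not s ≢ s
not≢ false ()
not≢ true  ()

bar : ∀ {C : Set} → C × Bool → C × Bool
bar (c , s) = c , not s

-- Nonzero rows of a matrix of rank one over GF(2) are equal.
Fac₁-entry : ∀ {V} {G : Gr V} {Y} → Fac 1 G Y → ∀ {x y x′ y′} → Y x ≡ true → Y y ≡ true → Y x′ ≡ false → Y y′ ≡ false →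
  G x x′ ≡ true → G y y′ ≡ true → G y x′ ≡ true
Fac₁-entry (fac p q f) {x} {y} {x′} {y′} Yx Yy Yx′ Yy′ e e′ =
  trans (f Yy Yx′) (lemma (p x) (q x′) (p y) (q y′) (trans (sym (f Yx Yx′)) e) (trans (sym (f Yy Yy′)) e′))
  where
  lemma : ∀ (a b c d : F₂^ 1) → dot a b ≡ true → dot c d ≡ true → dot c b ≡ true
  lemma (true ∷ []) (true ∷ []) (true ∷ []) (true ∷ []) _ _ = refl
  lemma (true ∷ []) (true ∷ []) (false ∷ []) (_ ∷ []) _ ()
  lemma (true ∷ []) (true ∷ []) (true ∷ []) (false ∷ []) _ ()
  lemma (true ∷ []) (false ∷ []) _ _ () _
  lemma (false ∷ []) (_ ∷ []) _ _ () _

module Corona {C : Set} (_≟ᵥ_ : DecidableEquality C) where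

  -- (c , true) is the vertex c and (c , false) is the pendant vertex attached to it.
  corona : Gr C → Gr (C × Bool)
  corona H (c , s) (d , t) = if does (c ≟ᵥ d) then s xor t else (s ∧ t) ∧ H c d

  corona-≡ : ∀ H c s t → corona H (c , s) (c , t) ≡ s xor t
  corona-≡ H c s t = cong (if_then (s xor t) else ((s ∧ t) ∧ H c c)) (dec-true (c ≟ᵥ c) refl)

  corona-≢ : ∀ H {c d} s t → c ≢ d → corona H (c , s) (d , t) ≡ (s ∧ t) ∧ H c d
  corona-≢ H {c} {d} s t c≢d = cong (if_then (s xor t) else ((s ∧ t) ∧ H c d)) (dec-false (c ≟ᵥ d) c≢d)

  corona-bar : ∀ H x → corona H x (bar x) ≡ true
  corona-bar H (c , s) = trans (corona-≡ H c s (not s)) (table s)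
    where
    table : ∀ s → s xor not s ≡ true
    table false = refl
    table true  = refl

  pairOf : C → C × Bool → Bool
  pairOf c z = does (proj₁ z ≟ᵥ c)

  Fac-pair : ∀ H c → Fac 1 (corona H) (pairOf c)
  Fac-pair H c = fac (λ z → proj₂ z ∷ []) (λ z → (proj₂ z ∧ H c (proj₁ z)) ∷ []) (λ {x} {y} → factor {x} {y})
    where
    factor : ∀ {x y} → pairOf c x ≡ true → pairOf c y ≡ false → corona H x y ≡ (proj₂ x ∧ (proj₂ y ∧ H c (proj₁ y))) xor false
    factor {c′ , s} {d , t} Xx Xy with does-true (c′ ≟ᵥ c) Xx
    ... | refl = trans (corona-≢ H s t (λ e → does-false (d ≟ᵥ c) Xy (sym e))) (trans (∧-assoc s t _) (sym (xor-identityʳ _)))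

  -- If the two vertices came from different pairs, their partners would lie outside `Y`. Equal rows
  -- would then make each vertex adjacent to the partner of the other, but only non-pendant vertices
  -- have neighbours in other pairs.
  Fac₁-pair : ∀ H {Y} → Fac 1 (corona H) Y → ∀ x y → Y x ≡ true → Y y ≡ true → (∀ z → Y z ≡ true → z ≡ x ⊎ z ≡ y) → proj₁ x ≡ proj₁ y
  Fac₁-pair H {Y} f (c , s) (d , t) Yx Yy only with c ≟ᵥ d
  ... | yes e   = e
  ... | no  c≢d = contradiction (table s t _ _ (edge c≢d Yx Yy bars bars′) (edge (c≢d ∘ sym) Yy Yx bars′ bars)) λ ()
    where
    outside : ∀ z → z ≢ (c , s) → z ≢ (d , t) → Y z ≡ false
    outside z z≢x z≢y with Y z in Yz
    ... | false = refl
    ... | true with only z Yz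
    ... | inj₁ e = contradiction e z≢x
    ... | inj₂ e = contradiction e z≢y
    bars : Y (c , not s) ≡ false
    bars = outside _ (λ e → not≢ s (cong proj₂ e)) (c≢d ∘ cong proj₁)
    bars′ : Y (d , not t) ≡ false
    bars′ = outside _ (λ e → c≢d (sym (cong proj₁ e))) (λ e → not≢ t (cong proj₂ e))
    edge : ∀ {c s d t} → c ≢ d → Y (c , s) ≡ true → Y (d , t) ≡ true → Y (c , not s) ≡ false → Y (d , not t) ≡ false → (t ∧ not s) ∧ H d c ≡ true
    edge {c} {s} {d} {t} c≢d Yx Yy Yx′ Yy′ = trans (sym (corona-≢ H t (not s) (c≢d ∘ sym)))
      (Fac₁-entry f Yx Yy Yx′ Yy′ (corona-bar H (c , s)) (corona-bar H (d , t)))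
    table : ∀ s t u v → (t ∧ not s) ∧ u ≡ true → (s ∧ not t) ∧ v ≡ true → true ≡ false
    table false true  u v _ ()
    table false false u v () _
    table true  true  u v () _
    table true  false u v () _

  -- A bijection preserving cut ranks may interchange the two vertices of a pair. The test sets are
  -- therefore described in a way that survives this: one vertex, no matter which, of every pair
  -- except those of `c` and `d`.
  record Halves (c d : C) (X : C × Bool → Bool) : Set where
    field
      omit₁ : ∀ s → X (c , s) ≡ false
      omit₂ : ∀ s → X (d , s) ≡ false
      half  : ∀ z → z ≢ c → z ≢ d → ∀ s → X (z , not s) ≡ not (X (z , s))

  record Adds (c : C) (X Y : C × Bool → Bool) : Set where
    field
      new : ∀ s → Y (c , s) ≡ true
      old : ∀ z → z ≢ c → ∀ s → Y (z , s) ≡ X (z , s)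

  module _ (all : List C) (all-unique : Unique all) (all-complete : ∀ c → c ∈ₗ all) where

    -- If c and d are not adjacent, row (c , true) is the sum of the rows of the pendant
    -- vertices in X that hang on neighbours of c.
    nonadjacent : ∀ {H c d r X Y} → c ≢ d → H c d ≡ false → Halves c d X → Adds c X Y → Fac r (corona H) X → Fac r (corona H) Y
    nonadjacent {H} {c} {d} {r} {X} {Y} c≢d Hcd halves adds (fac p q f) = fac row q factor
      where
      open Halves halves
      open Adds adds
      new-row : Bool → F₂^ r
      new-row s = s · ⨁ᵥ all (λ z → (H c z ∧ X (z , false)) · p (z , false))
      row : C × Bool → F₂^ r
      row (z , s) = if does (z ≟ᵥ c) then new-row s else p (z , s)
      summand : ∀ {w t} → X (w , t) ≡ false → ∀ z → dot ((H c z ∧ X (z , false)) · p (z , false)) (q (w , t)) ≡ (H c z ∧ X (z , false)) ∧ (does (z ≟ᵥ w) ∧ t)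
      summand {w} {t} Xw z = trans (dot-·ˡ (H c z ∧ X (z , false)) (p (z , false)) (q (w , t))) (∧-congʳ (λ e →
        trans (sym (f (∧-trueʳ e) Xw)) (entry (z ≟ᵥ w))))
        where
        ∧-congʳ : ∀ {a b b′} → (a ≡ true → b ≡ b′) → a ∧ b ≡ a ∧ b′
        ∧-congʳ {true}  e = e refl
        ∧-congʳ {false} e = refl
        ∧-trueʳ : ∀ {a b} → a ∧ b ≡ true → b ≡ true
        ∧-trueʳ {true} e = e
        entry : Dec (z ≡ w) → corona H (z , false) (w , t) ≡ does (z ≟ᵥ w) ∧ t
        entry (yes refl) = trans (corona-≡ H z false t) (sym (cong (_∧ t) (dec-true (z ≟ᵥ z) refl)))
        entry (no z≢w)   = trans (corona-≢ H false t z≢w) (sym (cong (_∧ t) (dec-false (z ≟ᵥ w) z≢w)))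
      dot-new : ∀ s w t → w ≢ c → X (w , t) ≡ false → dot (new-row s) (q (w , t)) ≡ (s ∧ t) ∧ H c w
      dot-new s w t w≢c Xw = trans (dot-·ˡ s (⨁ᵥ all (λ z → (H c z ∧ X (z , false)) · p (z , false))) (q (w , t))) (trans
        (cong (s ∧_) (trans (dot-⨁ᵥ all (λ z → (H c z ∧ X (z , false)) · p (z , false)) (q (w , t))) (trans (⨁-cong all (summand Xw)) (trans
          (⨁-δ all-unique (all-complete w) (λ {z} z≢w → trans (cong (λ b → (H c z ∧ X (z , false)) ∧ (b ∧ t)) (dec-false (z ≟ᵥ w) z≢w)) (∧-zeroʳ (H c z ∧ X (z , false)))))
          (trans (cong (λ b → (H c w ∧ X (w , false)) ∧ (b ∧ t)) (dec-true (w ≟ᵥ w) refl)) (value t Xw (w ≟ᵥ d))))))) (sym (∧-assoc s t _)))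
        where
        value : ∀ t → X (w , t) ≡ false → Dec (w ≡ d) → (H c w ∧ X (w , false)) ∧ t ≡ t ∧ H c w
        value t     Xw (yes refl) rewrite Hcd = sym (∧-zeroʳ t)
        value false Xw (no _)   = ∧-zeroʳ _
        value true  Xw (no w≢d) = trans (∧-comm _ true) (trans (cong (H c w ∧_) (trans (half w w≢c w≢d true) (cong not Xw))) (∧-comm _ true))
      factor : ∀ {x y} → Y x ≡ true → Y y ≡ false → corona H x y ≡ dot (row x) (q y)
      factor {z , s} {w , t} Yx Yy with w ≟ᵥ c
      ... | yes refl = contradiction (trans (sym (new t)) Yy) true≢false
      ... | no  w≢c with z ≟ᵥ c
      ... | yes refl = trans (corona-≢ H s t (w≢c ∘ sym)) (sym (dot-new s w t w≢c (trans (sym (old w w≢c t)) Yy)))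
      ... | no  z≢c  = f (trans (sym (old z z≢c s)) Yx) (trans (sym (old w w≢c t)) Yy)

    module _ (H : Gr C) (c d : C) (c≢d : c ≢ d) where

      other? : ∀ z → Dec (z ≢ c × z ≢ d)
      other? z = ¬? (z ≟ᵥ c) ×-dec ¬? (z ≟ᵥ d)

      others : List C
      others = filter other? all

      tops tops⁺ : C × Bool → Bool
      tops  (z , s) = s ∧ does (other? z)
      tops⁺ (z , s) = if does (z ≟ᵥ c) then true else tops (z , s)

      not-other : ∀ z → ¬ (z ≢ c × z ≢ d) → ∀ s → tops (z , s) ≡ false
      not-other z h s = trans (cong (s ∧_) (dec-false (other? z) h)) (∧-zeroʳ s)

      tops-halves : Halves c d tops
      tops-halves = record
        { omit₁ = not-other c (λ h → proj₁ h refl)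
        ; omit₂ = not-other d (λ h → proj₂ h refl)
        ; half  = λ z z≢c z≢d s → trans (cong (not s ∧_) (dec-true (other? z) (z≢c , z≢d))) (trans (∧-comm (not s) true)
                    (cong not (sym (trans (cong (s ∧_) (dec-true (other? z) (z≢c , z≢d))) (∧-comm s true)))))
        }

      tops-adds : Adds c tops tops⁺
      tops-adds = record
        { new = λ s → cong (if_then true else tops (c , s)) (dec-true (c ≟ᵥ c) refl)
        ; old = λ z z≢c s → cong (if_then true else tops (z , s)) (dec-false (z ≟ᵥ c) z≢c)
        }

      others-unique : Unique others
      others-unique = Uniqueₚ.filter⁺ other? all-unique

      Fac-tops : Fac (length others) (corona H) tops
      Fac-tops = fac (λ x → values others (λ w → does (w ≟ᵥ proj₁ x))) (λ y → values others (λ w → corona H (w , true) y)) factor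
        where
        factor : ∀ {x y} → tops x ≡ true → tops y ≡ false → corona H x y ≡ dot (values others (λ w → does (w ≟ᵥ proj₁ x))) (values others (λ w → corona H (w , true) y))
        factor {z , true} {y} Xx _ = sym (trans (dot-values others _ _) (trans
          (⨁-δ others-unique (∈-filter⁺ other? (all-complete z) (does-true (other? z) Xx)) (λ {w} w≢z → cong (_∧ corona H (w , true) y) (dec-false (w ≟ᵥ z) w≢z)))
          (cong (_∧ corona H (z , true) y) (dec-true (z ≟ᵥ z) refl))))

      -- Non-pendant vertices against their own pendants form an identity matrix. Row `(c , true)`
      -- vanishes on these columns but meets `(d , true)`, so it adds one to the rank.
      adjacent-Tri : H c d ≡ true → Tri (corona H) tops⁺ (((c , true) , (d , true)) ∷ map (λ z → (z , true) , (z , false)) others)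
      adjacent-Tri Hcd = step (new true) (trans (old d (c≢d ∘ sym) true) (omit₂ true)) (trans (corona-≢ H true true c≢d) Hcd)
        (Allₚ.map⁺ (All.map (λ h → trans (corona-≢ H true false (proj₁ h ∘ sym)) refl) (Allₚ.all-filter other? all)))
        (triangle others others-unique (Allₚ.all-filter other? all))
        where
        open Halves tops-halves
        open Adds tops-adds
        triangle : ∀ zs → Unique zs → All (λ z → z ≢ c × z ≢ d) zs → Tri (corona H) tops⁺ (map (λ z → (z , true) , (z , false)) zs)
        triangle []       _          _        = []
        triangle (z ∷ zs) (z≢ ∷ uq) (h ∷ hs) = step (trans (old z (proj₁ h) true) (dec-true (other? z) h)) (old z (proj₁ h) false)
          (corona-≡ H z true false) (Allₚ.map⁺ (All.map (λ z≢w → trans (corona-≢ H true false z≢w) refl) z≢)) (triangle zs uq hs)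

      adjacent⇒¬Fac : H c d ≡ true → ¬ Fac (length others) (corona H) tops⁺
      adjacent⇒¬Fac Hcd f = ℕₚ.1+n≰n (subst (_≤ length others) (cong suc (length-map _ others)) (Tri≤Fac (adjacent-Tri Hcd) f))

    module _ {H H′ : Gr C} (E : CutEquiv (corona H) (corona H′)) where
      open CutEquiv E

      same-pair : ∀ c → proj₁ (to (c , true)) ≡ proj₁ (to (c , false))
      same-pair c = Fac₁-pair H′ (push (Fac-pair H c)) (to (c , true)) (to (c , false)) (inside true) (inside false) only
        where
        inside : ∀ s → pairOf c (from (to (c , s))) ≡ true
        inside s = trans (cong (pairOf c) (from-to (c , s))) (dec-true (c ≟ᵥ c) refl)
        only : ∀ z → pairOf c (from z) ≡ true → z ≡ to (c , true) ⊎ z ≡ to (c , false)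
        only z e with from z in eq
        ... | c′ , s with does-true (c′ ≟ᵥ c) e
        only z e | c′ , true  | refl = inj₁ (trans (sym (to-from z)) (cong to eq))
        only z e | c′ , false | refl = inj₂ (trans (sym (to-from z)) (cong to eq))

      under : C → C
      under c = proj₁ (to (c , true))

      to-under : ∀ c s → proj₁ (to (c , s)) ≡ under c
      to-under c true  = refl
      to-under c false = sym (same-pair c)

    corona-iso : ∀ {H H′ : Gr C} → Irr H → Irr H′ → CutEquiv (corona H) (corona H′) → GraphIso H H′
    corona-iso {H} {H′} H-irr H′-irr E = record
      { to       = under E
      ; from     = under E⁻
      ; to-from  = inverse E⁻
      ; from-to  = inverse E
      ; adjacent = λ x y → adjacent x y (x ≟ᵥ y)
      }
      where
      E⁻ = CutEquiv-sym E
      inverse : ∀ {H H′} (E : CutEquiv (corona H) (corona H′)) c → under (CutEquiv-sym E) (under E c) ≡ c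
      inverse E c = trans (sym (to-under (CutEquiv-sym E) (under E c) (proj₂ (to (c , true))))) (cong proj₁ (from-to (c , true)))
        where open CutEquiv E
      from-bar : ∀ {H H′} (E : CutEquiv (corona H) (corona H′)) x → CutEquiv.to E (bar x) ≡ bar (CutEquiv.to E x)
      from-bar E (c , s) = cong₂ _,_ (trans (to-under E c (not s)) (sym (to-under E c s))) (differ _ _ sides)
        where
        open CutEquiv E
        differ : ∀ a b → b ≢ a → b ≡ not a
        differ false false h = contradiction refl h
        differ false true  h = refl
        differ true  false h = refl
        differ true  true  h = contradiction refl h
        sides : proj₂ (to (c , not s)) ≢ proj₂ (to (c , s))
        sides e = not≢ s (cong proj₂ (trans (sym (from-to (c , not s))) (trans
          (cong from (cong₂ _,_ (trans (to-under E c (not s)) (sym (to-under E c s))) e)) (from-to (c , s)))))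
      -- Adjacency is read off the rank: adding the pair of `c` to `tops` lifts it above
      -- `length others`. If the images were not adjacent, `nonadjacent` would exclude this for the
      -- transported sets.
      preserves : ∀ {H H′} (E : CutEquiv (corona H) (corona H′)) c d → c ≢ d → H c d ≡ true → H′ (under E c) (under E d) ≡ true
      preserves {H} {H′} E c d c≢d Hcd with H′ (under E c) (under E d) in H′cd
      ... | true  = refl
      ... | false = contradiction
        (Fac-cong (λ _ _ → refl) (λ x → cong (tops⁺ H c d c≢d) (from-to x))
          (pull (nonadjacent ψ≢ H′cd halves adds (push (Fac-tops H c d c≢d)))))
        (adjacent⇒¬Fac H c d c≢d Hcd)
        where
        open CutEquiv E
        module T = Halves (tops-halves H c d c≢d)
        module A = Adds (tops-adds H c d c≢d)
        ψ⁻ = under (CutEquiv-sym E)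
        ψ≢ : under E c ≢ under E d
        ψ≢ e = c≢d (trans (sym (inverse E c)) (trans (cong ψ⁻ e) (inverse E d)))
        at : ∀ c s → from (under E c , s) ≡ (c , proj₂ (from (under E c , s)))
        at c s = cong (_, proj₂ (from (under E c , s))) (trans (to-under (CutEquiv-sym E) (under E c) s) (inverse E c))
        away : ∀ {z c s} → z ≢ under E c → proj₁ (from (z , s)) ≢ c
        away {z} {c} {s} z≢ refl = z≢ (trans (sym (inverse (CutEquiv-sym E) z)) (cong (under E) (sym (to-under (CutEquiv-sym E) z s))))
        halves : Halves (under E c) (under E d) (tops H c d c≢d ∘ from)
        halves = record
          { omit₁ = λ s → trans (cong (tops H c d c≢d) (at c s)) (T.omit₁ (proj₂ (from (under E c , s))))
          ; omit₂ = λ s → trans (cong (tops H c d c≢d) (at d s)) (T.omit₂ (proj₂ (from (under E d , s))))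
          ; half  = λ z z≢c z≢d s → trans (cong (tops H c d c≢d) (from-bar (CutEquiv-sym E) (z , s))) (T.half _ (away z≢c) (away z≢d) (proj₂ (from (z , s))))
          }
        adds : Adds (under E c) (tops H c d c≢d ∘ from) (tops⁺ H c d c≢d ∘ from)
        adds = record
          { new = λ s → trans (cong (tops⁺ H c d c≢d) (at c s)) (A.new (proj₂ (from (under E c , s))))
          ; old = λ z z≢c s → A.old _ (away z≢c) (proj₂ (from (z , s)))
          }
      adjacent : ∀ x y → Dec (x ≡ y) → H′ (under E x) (under E y) ≡ H x y
      adjacent x y (yes refl) = trans (H′-irr (under E x)) (sym (H-irr x))
      adjacent x y (no x≢y) with H x y in Hxy | H′ (under E x) (under E y) in H′xy
      ... | true  | _     = trans (sym H′xy) (preserves E x y x≢y Hxy)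
      ... | false | false = refl
      ... | false | true  = trans (sym (preserves E⁻ (under E x) (under E y) (λ e → x≢y (trans (sym (inverse E x)) (trans (cong (under E⁻) e) (inverse E y)))) H′xy))
        (trans (cong₂ H (inverse E x) (inverse E y)) Hxy)

-- Cacti and their coronas

Cactus : ℕ → Set
Cactus = Tree ⊤

Site : ℕ → Set
Site = Vertex ⊤

K₁ : Gr ⊤
K₁ _ _ = false

open Trees Unit._≟_ K₁ using () renaming (vertex-≟ to site-≟; adj to cadj; adj-irr to cadj-irr′; adj-Cross to cadj-Cross′)
open Corona

cadj-irr : ∀ {k} (T : Cactus k) → Irr (cadj T)
cadj-irr = cadj-irr′ λ _ → refl

cadj-Cross : ∀ {k} (T : Cactus k) → Cross (cadj T)
cadj-Cross = cadj-Cross′ λ X x y Xx Xy → contradiction (trans (sym Xx) Xy) true≢false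

sites : ∀ k → List (Site k)
sites zero    = tt ∷ []
sites (suc k) = cartesianProduct (allFin 3) (sites k)

sites-unique : ∀ k → Unique (sites k)
sites-unique zero    = [] ∷ []
sites-unique (suc k) = Uniqueₚ.cartesianProduct⁺ (Uniqueₚ.allFin⁺ 3) (sites-unique k)

sites-complete : ∀ k c → c ∈ₗ sites k
sites-complete zero    tt      = here refl
sites-complete (suc k) (i , c) = ∈-cartesianProduct⁺ (∈-allFin i) (sites-complete k c)

pack : ∀ k → Site k × Bool → Vertex Bool k
pack zero    (tt , s)      = s
pack (suc k) ((i , c) , s) = i , pack k (c , s)

unpack : ∀ k → Vertex Bool k → Site k × Bool
unpack zero    s       = tt , s
unpack (suc k) (i , v) = (i , proj₁ (unpack k v)) , proj₂ (unpack k v)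

pack-unpack : ∀ k v → pack k (unpack k v) ≡ v
pack-unpack zero    s       = refl
pack-unpack (suc k) (i , v) = cong (i ,_) (pack-unpack k v)

unpack-pack : ∀ k x → unpack k (pack k x) ≡ x
unpack-pack zero    (tt , s)      = refl
unpack-pack (suc k) ((i , c) , s) = cong (λ z → (i , proj₁ z) , proj₂ z) (unpack-pack k (c , s))

pack-inj : ∀ k {x y} → pack k x ≡ pack k y → x ≡ y
pack-inj k {x} {y} e = trans (sym (unpack-pack k x)) (trans (cong (unpack k) e) (unpack-pack k y))

-- Attaching pendants commutes with joining as long as the roots are non-pendant vertices, and K₂ is
-- the corona of a single vertex. So coronas of cacti are again trees over `K₂`.
coronaTree : ∀ {k} → Cactus k → Tree Bool k
coronaTree leaf           = leaf
coronaTree {suc k} (node T r) = node (λ i → coronaTree (T i)) (λ i → pack k (r i , true))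

pack-root : ∀ k c s d → does (vertex-≟ k (pack k (c , s)) (pack k (d , true))) ≡ s ∧ does (site-≟ k c d)
pack-root k c true  d = does-⇔ (vertex-≟ k _ _) (site-≟ k c d) (λ e → cong proj₁ (pack-inj k e)) (λ e → cong (λ z → pack k (z , true)) e)
pack-root k c false d = dec-false (vertex-≟ k _ _) λ e → true≢false (sym (cong proj₂ (pack-inj k e)))

coronaTree-adj : ∀ {k} (T : Cactus k) x y → corona (site-≟ k) (cadj T) x y ≡ adj (coronaTree T) (pack k x) (pack k y)
coronaTree-adj leaf (tt , s) (tt , t) = refl
coronaTree-adj {suc k} (node T r) ((i , c) , s) ((j , d) , t) with i ≟ j
... | yes refl = coronaTree-adj (T i) (c , s) (d , t)
... | no  _    = trans (table s t _ _) (sym (cong₂ _∧_ (pack-root k c s (r i)) (pack-root k d t (r j))))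
  where
  table : ∀ s t a b → (s ∧ t) ∧ (a ∧ b) ≡ (s ∧ a) ∧ (t ∧ b)
  table false t     a b = refl
  table true  true  a b = refl
  table true  false a b = sym (∧-zeroʳ a)

coronaTree-CutEquiv : ∀ {k} (T : Cactus k) → CutEquiv (corona (site-≟ k) (cadj T)) (adj (coronaTree T))
coronaTree-CutEquiv {k} T = CutEquiv-bijection (mk↔ₛ′ (pack k) (unpack k) (pack-unpack k) (unpack-pack k)) (coronaTree-adj T)

CutEquiv⇒cactusIso : ∀ {k} (T T′ : Cactus k) → CutEquiv (adj (coronaTree T)) (adj (coronaTree T′)) → GraphIso (cadj T) (cadj T′)
CutEquiv⇒cactusIso {k} T T′ E = corona-iso (site-≟ k) (sites k) (sites-unique k) (sites-complete k) (cadj-irr T) (cadj-irr T′)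
  (CutEquiv-trans (coronaTree-CutEquiv T) (CutEquiv-trans E (CutEquiv-sym (coronaTree-CutEquiv T′))))

-- Degrees in cacti

deg : ∀ {k} → Cactus k → Site k → ℕ
deg leaf _ = 0
deg {suc k} (node T r) (i , x) = deg (T i) x + (if does (site-≟ k x (r i)) then 2 else 0)

-- The degree is pinned down by two injections, `nbr` from below and `index` from above, which need
-- not be inverse to each other. An isomorphism compares degrees by passing from `nbr` on one side
-- to `index` on the other.
record Neighbours {V : Set} (G : Gr V) (x : V) (m : ℕ) : Set where
  field
    nbr       : Fin m → V
    nbr-inj   : ∀ {a b} → nbr a ≡ nbr b → a ≡ b
    nbr-adj   : ∀ a → G x (nbr a) ≡ true
    index     : V → ℕ
    index<    : ∀ {y} → G x y ≡ true → index y < m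
    index-inj : ∀ {y z} → G x y ≡ true → G x z ≡ true → index y ≡ index z → y ≡ z

module _ {V : Set} (_≟ᵥ_ : DecidableEquality V) (G : Fin 3 → Gr V) (root : Fin 3 → V) where
  open Join _≟ᵥ_ G root

  join-foreign : ∀ {i x j y} → i ≢ j → join (i , x) (j , y) ≡ true → x ≡ root i × y ≡ root j
  join-foreign {i} {x} {j} {y} i≢j e = does-true (x ≟ᵥ root i) (proj₁ both) , does-true (y ≟ᵥ root j) (proj₂ both)
    where
    ∧-true : ∀ {a b} → a ∧ b ≡ true → a ≡ true × b ≡ true
    ∧-true {true} {true} _ = refl , refl
    both = ∧-true (trans (sym (join-≢ x y i≢j)) e)

  nonroot-neighbours : ∀ {i x m} → x ≢ root i → Neighbours (G i) x m → Neighbours join (i , x) m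
  nonroot-neighbours {i} {x} x≢r ns = record
    { nbr       = λ a → i , nbr a
    ; nbr-inj   = λ e → nbr-inj (cong proj₂ e)
    ; nbr-adj   = λ a → trans (join-≡ i x (nbr a)) (nbr-adj a)
    ; index     = λ y → index (proj₂ y)
    ; index<    = λ {y} e → index< (proj₂ (within y e))
    ; index-inj = λ {y} {z} e e′ h → cong₂ _,_ (trans (proj₁ (within y e)) (sym (proj₁ (within z e′))))
                    (index-inj (proj₂ (within y e)) (proj₂ (within z e′)) h)
    }
    where
    open Neighbours ns
    within : ∀ y → join (i , x) y ≡ true → proj₁ y ≡ i × G i x (proj₂ y) ≡ true
    within (j , y) e = case i ≟ j of λ where
      (yes refl) → refl , trans (sym (join-≡ i x y)) e
      (no i≢j)   → contradiction (proj₁ (join-foreign i≢j e)) x≢r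

  root-neighbours : ∀ {i m} → Neighbours (G i) (root i) m → Neighbours join (i , root i) (m + 2)
  root-neighbours {i} {m} ns = record
    { nbr       = nbr′ ∘ splitAt m
    ; nbr-inj   = λ {a} {b} e → trans (sym (join-splitAt m 2 a)) (trans (cong (Fin.join m 2) (inj (splitAt m a) (splitAt m b) e)) (join-splitAt m 2 b))
    ; nbr-adj   = nbr-adj′ ∘ splitAt m
    ; index     = λ y → index′ y (i ≟ proj₁ y)
    ; index<    = λ {y} e → bounded y e (i ≟ proj₁ y)
    ; index-inj = λ {y} {z} e e′ → index-inj′ y z e e′ (i ≟ proj₁ y) (i ≟ proj₁ z)
    }
    where
    open Neighbours ns
    nbr′ : Fin m ⊎ Fin 2 → Fin 3 × V
    nbr′ (inj₁ a) = i , nbr a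
    nbr′ (inj₂ b) = punchIn i b , root (punchIn i b)
    inj : ∀ a b → nbr′ a ≡ nbr′ b → a ≡ b
    inj (inj₁ a) (inj₁ b) e = cong inj₁ (nbr-inj (cong proj₂ e))
    inj (inj₁ a) (inj₂ b) e = contradiction (sym (cong proj₁ e)) (punchInᵢ≢i i b)
    inj (inj₂ a) (inj₁ b) e = contradiction (cong proj₁ e) (punchInᵢ≢i i a)
    inj (inj₂ a) (inj₂ b) e = cong inj₂ (punchIn-injective i a b (cong proj₁ e))
    nbr-adj′ : ∀ a → join (i , root i) (nbr′ a) ≡ true
    nbr-adj′ (inj₁ a) = trans (join-≡ i _ _) (nbr-adj a)
    nbr-adj′ (inj₂ b) = trans (join-≢ _ _ (punchInᵢ≢i i b ∘ sym))
      (cong₂ _∧_ (dec-true (root i ≟ᵥ root i) refl) (dec-true (root (punchIn i b) ≟ᵥ root (punchIn i b)) refl))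
    index′ : ∀ y → Dec (i ≡ proj₁ y) → ℕ
    index′ y (yes _)  = index (proj₂ y)
    index′ y (no i≢j) = m + toℕ (punchOut i≢j)
    inside : ∀ {y} → join (i , root i) y ≡ true → i ≡ proj₁ y → G i (root i) (proj₂ y) ≡ true
    inside e refl = trans (sym (join-≡ i _ _)) e
    bounded : ∀ y → join (i , root i) y ≡ true → (i≟ : Dec (i ≡ proj₁ y)) → index′ y i≟ < m + 2
    bounded y e (yes i≡) = ≤-trans (index< (inside e i≡)) (ℕₚ.m≤m+n m 2)
    bounded y e (no i≢)  = ℕₚ.+-monoʳ-< m (toℕ<n (punchOut i≢))
    index-inj′ : ∀ y z → join (i , root i) y ≡ true → join (i , root i) z ≡ true → (y? : Dec (i ≡ proj₁ y)) (z? : Dec (i ≡ proj₁ z)) →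
      index′ y y? ≡ index′ z z? → y ≡ z
    index-inj′ y z e e′ (yes p) (yes q) h = cong₂ _,_ (trans (sym p) q) (index-inj (inside e p) (inside e′ q) h)
    index-inj′ y z e e′ (yes p) (no q)  h = contradiction (subst (_< m) h (index< (inside e p))) (ℕₚ.m+n≮m m _)
    index-inj′ y z e e′ (no p)  (yes q) h = contradiction (subst (_< m) (sym h) (index< (inside e′ q))) (ℕₚ.m+n≮m m _)
    index-inj′ (j , y) (l , z) e e′ (no p) (no q) h with punchOut-injective p q (toℕ-injective (ℕₚ.+-cancelˡ-≡ m _ _ h))
    ... | refl = cong (j ,_) (trans (proj₂ (join-foreign p e)) (sym (proj₂ (join-foreign q e′))))

neighbours : ∀ {k} (T : Cactus k) x → Neighbours (cadj T) x (deg T x)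
neighbours leaf _ = record { nbr = λ () ; nbr-inj = λ { {()} } ; nbr-adj = λ () ; index = λ _ → 0 ; index< = λ () ; index-inj = λ () }
neighbours {suc k} (node T r) (i , x) = go (site-≟ k x (r i)) refl
  where
  go : (x? : Dec (x ≡ r i)) → does (site-≟ k x (r i)) ≡ does x? → Neighbours (cadj (node T r)) (i , x) (deg (node T r) (i , x))
  go (no x≢r)   e rewrite e = subst (Neighbours _ _) (sym (ℕₚ.+-identityʳ _)) (nonroot-neighbours (site-≟ k) (λ i → cadj (T i)) r x≢r (neighbours (T i) x))
  go (yes refl) e rewrite e = root-neighbours (site-≟ k) (λ i → cadj (T i)) r (neighbours (T i) x)

module _ {k} (T T′ : Cactus k) where

  deg-≤ : (φ : GraphIso (cadj T) (cadj T′)) → ∀ x → deg T x ≤ deg T′ (GraphIso.to φ x)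
  deg-≤ φ x = injective⇒≤ {f = λ a → fromℕ< (image a)} λ {a} {b} e → N.nbr-inj (trans (sym (from-to _)) (trans
      (cong from (N′.index-inj (edge a) (edge b) (trans (sym (toℕ-fromℕ< (image a))) (trans (cong toℕ e) (toℕ-fromℕ< (image b)))))) (from-to _)))
    where
    open GraphIso φ
    module N = Neighbours (neighbours T x)
    module N′ = Neighbours (neighbours T′ (to x))
    edge : ∀ a → cadj T′ (to x) (to (N.nbr a)) ≡ true
    edge a = trans (adjacent x (N.nbr a)) (N.nbr-adj a)
    image : ∀ a → N′.index (to (N.nbr a)) < deg T′ (to x)
    image a = N′.index< (edge a)

deg-iso : ∀ {k} (T T′ : Cactus k) (φ : GraphIso (cadj T) (cadj T′)) → ∀ x → deg T′ (GraphIso.to φ x) ≡ deg T x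
deg-iso T T′ φ x = ℕₚ.≤-antisym (subst (deg T′ (to x) ≤_) (cong (deg T) (from-to x)) (deg-≤ T′ T (GraphIso-sym φ) (to x))) (deg-≤ T T′ φ x)
  where open GraphIso φ

deg-bound : ∀ {k} (T : Cactus k) x → deg T x ≤ k * 2
deg-bound leaf       _       = z≤n
deg-bound {suc k} (node T r) (i , x) = subst (deg T′ (i , x) ≤_) (ℕₚ.+-comm (k * 2) 2) (ℕₚ.+-mono-≤ (deg-bound (T i) x) (two (does (site-≟ k x (r i)))))
  where
  T′ = node T r
  two : ∀ b → (if b then 2 else 0) ≤ 2
  two true  = ≤-refl
  two false = z≤n

-- In a full cactus the spine lies in a triangle of every level, so that the central triangle
-- of a fork of full cacti consists of its vertices of maximum degree.
spine : ∀ k → Site k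
spine zero    = tt
spine (suc k) = 0F , spine k

fork : ∀ {k} → (Fin 3 → Cactus k) → Cactus (suc k)
fork {k} T = node T (λ _ → spine k)

Full : ∀ {k} → Cactus k → Set
Full {k} T = deg T (spine k) ≡ k * 2

fork-deg : ∀ {k} (T : Fin 3 → Cactus k) → (∀ i → Full (T i)) → ∀ i → deg (fork T) (i , spine k) ≡ suc k * 2
fork-deg {k} T full i = trans (cong₂ (λ a b → a + (if b then 2 else 0)) (full i) (dec-true (site-≟ k (spine k) (spine k)) refl)) (ℕₚ.+-comm (k * 2) 2)

fork-Full : ∀ {k} (T : Fin 3 → Cactus k) → (∀ i → Full (T i)) → Full (fork T)
fork-Full T full = fork-deg T full 0F

-- A vertex that is not a root gains nothing at the top level, so it stays at degree at most
-- `k * 2`.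
node-deg-≢ : ∀ {k} (T : Fin 3 → Cactus k) r {i x} → x ≢ r i → deg (node T r) (i , x) ≢ suc k * 2
node-deg-≢ {k} T r {i} {x} x≢ e = contradiction (subst (_≤ k * 2)
  (trans (sym (trans (cong (λ b → deg (T i) x + (if b then 2 else 0)) (dec-false (site-≟ k x (r i)) x≢)) (ℕₚ.+-identityʳ _))) e)
  (deg-bound (T i) x)) (ℕₚ.<⇒≱ (ℕₚ.m<n+m (k * 2) (s≤s z≤n)))

RootedIso : ∀ {k} → Cactus k → Cactus k → Set
RootedIso {k} T T′ = Σ (GraphIso (cadj T) (cadj T′)) λ φ → GraphIso.to φ (spine k) ≡ spine k

module ForkIso {k} (T T′ : Fin 3 → Cactus k) (T-full : ∀ i → Full (T i)) (T′-full : ∀ i → Full (T′ i)) (φ : GraphIso (cadj (fork T)) (cadj (fork T′))) where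
  open GraphIso φ

  private
    module J = Join (site-≟ k) (λ i → cadj (T i)) (λ _ → spine k)

  part : Fin 3 → Fin 3
  part i = proj₁ (to (i , spine k))

  to-top : ∀ i → to (i , spine k) ≡ (part i , spine k)
  to-top i with site-≟ k (proj₂ (to (i , spine k))) (spine k)
  ... | yes e  = cong (part i ,_) e
  ... | no  ≢s = contradiction (trans (deg-iso (fork T) (fork T′) φ (i , spine k)) (fork-deg T T-full i)) (node-deg-≢ T′ _ ≢s)

  from-top : ∀ i x → proj₂ (to (i , x)) ≡ spine k → x ≡ spine k
  from-top i x e with site-≟ k x (spine k)
  ... | yes x≡ = x≡
  ... | no  x≢ = contradiction (trans (sym (deg-iso (fork T) (fork T′) φ (i , x))) (trans (cong (λ z → deg (fork T′) (proj₁ (to (i , x)) , z)) e) (fork-deg T′ T′-full _))) (node-deg-≢ T _ x≢)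

  -- Only edges of the central triangle join different parts, and φ preserves these.
  to-part : ∀ i x → proj₁ (to (i , x)) ≡ part i
  to-part i x with proj₁ (to (i , x)) ≟ part i
  ... | yes e = e
  ... | no  ≢part with cadj-Cross (T i) (λ z → does (proj₁ (to (i , z)) ≟ part i)) (spine k) x (dec-true (part i ≟ part i) refl) (dec-false (proj₁ (to (i , x)) ≟ part i) ≢part)
  ... | u , w , Xu , Xw , Guw = contradiction (trans (sym Guw) (trans (cong₂ (cadj (T i)) u≡ w≡) (cadj-irr (T i) (spine k)))) true≢false
    where
    foreign = join-foreign (site-≟ k) (λ i → cadj (T′ i)) (λ _ → spine k)
      (λ e → does-false (proj₁ (to (i , w)) ≟ part i) Xw (trans (sym e) (does-true (proj₁ (to (i , u)) ≟ part i) Xu)))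
      (trans (adjacent (i , u) (i , w)) (trans (J.join-≡ i u w) Guw))
    u≡ = from-top i u (proj₁ foreign)
    w≡ = from-top i w (proj₂ foreign)

module ForkDecode {k} (T T′ : Fin 3 → Cactus k) (T-full : ∀ i → Full (T i)) (T′-full : ∀ i → Full (T′ i)) (φ : GraphIso (cadj (fork T)) (cadj (fork T′))) where
  open GraphIso φ
  open ForkIso T T′ T-full T′-full φ public using (part; to-top)
  open ForkIso T T′ T-full T′-full φ using (to-part)

  private
    module J    = Join (site-≟ k) (λ i → cadj (T i)) (λ _ → spine k)
    module J′   = Join (site-≟ k) (λ i → cadj (T′ i)) (λ _ → spine k)
    module Back = ForkIso T′ T T′-full T-full (GraphIso-sym φ)

  part-inverse : ∀ i → Back.part (part i) ≡ i
  part-inverse i = cong proj₁ (trans (cong from (sym (to-top i))) (from-to (i , spine k)))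

  part-inj : ∀ {i j} → part i ≡ part j → i ≡ j
  part-inj {i} {j} e = trans (sym (part-inverse i)) (trans (cong Back.part e) (part-inverse j))

  child-iso : ∀ i → RootedIso (T i) (T′ (part i))
  child-iso i = record
    { to       = λ x → proj₂ (to (i , x))
    ; from     = λ y → proj₂ (from (part i , y))
    ; to-from  = λ y → cong proj₂ (trans (cong to (sym (from-pair y))) (to-from (part i , y)))
    ; from-to  = λ x → cong proj₂ (trans (cong from (sym (to-pair x))) (from-to (i , x)))
    ; adjacent = λ x y → trans (sym (J′.join-≡ (part i) _ _)) (trans (cong₂ (cadj (fork T′)) (sym (to-pair x)) (sym (to-pair y)))
                   (trans (adjacent (i , x) (i , y)) (J.join-≡ i x y)))
    } , cong proj₂ (to-top i)
    where
    to-pair : ∀ x → to (i , x) ≡ (part i , proj₂ (to (i , x)))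
    to-pair x = cong (_, proj₂ (to (i , x))) (to-part i x)
    from-pair : ∀ y → from (part i , y) ≡ (i , proj₂ (from (part i , y)))
    from-pair y = cong (_, proj₂ (from (part i , y))) (trans (Back.to-part (part i) y) (part-inverse i))

-- Many cacti

three : ∀ {A : Set} → A → A → A → Fin 3 → A
three a b c 0F = a
three a b c 1F = b
three a b c 2F = c

all-three : ∀ {A : Set} {P : A → Set} {a b c} → P a → P b → P c → ∀ i → P (three a b c i)
all-three p q r 0F = p
all-three p q r 1F = q
all-three p q r 2F = r

-- Up to isomorphism the only cactus of level 2, since a triangle is vertex-transitive. The choice
-- of roots first matters at level 3.
cactus₂ : Cactus 2
cactus₂ = fork λ _ → fork λ _ → leaf

-- cactus₃ true has three vertices of degree 6, cactus₃ false only two.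
cactus₃ : Bool → Cactus 3
cactus₃ true  = fork λ _ → cactus₂
cactus₃ false = node (λ _ → cactus₂) (three (spine 2) (spine 2) (0F , 1F , tt))

cactus₃-Full : ∀ b → Full (cactus₃ b)
cactus₃-Full true  = refl
cactus₃-Full false = refl

cactus₃-tops : ∀ v → deg (cactus₃ false) v ≡ 6 → ∃ λ (b : Fin 2) → v ≡ (inject₁ b , spine 2)
cactus₃-tops (i , x) e with site-≟ 2 x (three (spine 2) (spine 2) (0F , 1F , tt) i)
cactus₃-tops (0F , x) e | yes refl = 0F , refl
cactus₃-tops (1F , x) e | yes refl = 1F , refl
cactus₃-tops (2F , x) () | yes refl
cactus₃-tops (i , x) e  | no x≢ = contradiction (subst (_≤ 4) (trans (sym (ℕₚ.+-identityʳ _)) e) (deg-bound cactus₂ x)) λ { (s≤s (s≤s (s≤s (s≤s ())))) }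

cactus₃-true≇false : ¬ GraphIso (cadj (cactus₃ true)) (cadj (cactus₃ false))
cactus₃-true≇false φ = contradiction (injective⇒≤ {f = proj₁ ∘ top} inj) (λ { (s≤s (s≤s ())) })
  where
  open GraphIso φ
  top : ∀ i → ∃ λ (b : Fin 2) → to (i , spine 2) ≡ (inject₁ b , spine 2)
  top i = cactus₃-tops (to (i , spine 2)) (trans (deg-iso (cactus₃ true) (cactus₃ false) φ (i , spine 2)) (fork-deg (λ _ → cactus₂) (λ _ → refl) i))
  inj : ∀ {i j} → proj₁ (top i) ≡ proj₁ (top j) → i ≡ j
  inj {i} {j} e = cong proj₁ (trans (sym (from-to (i , spine 2))) (trans
    (cong from (trans (proj₂ (top i)) (trans (cong (λ b → inject₁ b , spine 2) e) (sym (proj₂ (top j)))))) (from-to (j , spine 2))))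

cactus₃-inj : ∀ b b′ → GraphIso (cadj (cactus₃ b)) (cadj (cactus₃ b′)) → b ≡ b′
cactus₃-inj false false φ = refl
cactus₃-inj false true  φ = contradiction (GraphIso-sym φ) cactus₃-true≇false
cactus₃-inj true  false φ = contradiction φ cactus₃-true≇false
cactus₃-inj true  true  φ = refl

count : ℕ → ℕ
count zero    = 2
count (suc m) = count m * (count m * count m)

module _ {n : ℕ} where

  digit : Fin (n * (n * n)) → Fin 3 → Fin n
  digit q = three (proj₁ (remQuot {n} (n * n) q)) (proj₁ (remQuot {n} n (proj₂ (remQuot {n} (n * n) q)))) (proj₂ (remQuot {n} n (proj₂ (remQuot {n} (n * n) q))))

  digit-inj : ∀ q q′ → (∀ i → digit q i ≡ digit q′ i) → q ≡ q′
  digit-inj q q′ e = trans (sym (combine-remQuot {n} (n * n) q)) (trans (cong₂ combine (e 0F)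
    (trans (sym (combine-remQuot {n} n _)) (trans (cong₂ combine (e 1F) (e 2F)) (combine-remQuot {n} n _)))) (combine-remQuot {n} (n * n) q′))

bit : Fin 2 → Bool
bit = Inverse.to 2↔Bool

bit-inj : ∀ {q q′} → bit q ≡ bit q′ → q ≡ q′
bit-inj {q} {q′} e = trans (sym (Inverse.strictlyInverseʳ 2↔Bool q)) (trans (cong (Inverse.from 2↔Bool) e) (Inverse.strictlyInverseʳ 2↔Bool q′))

-- Rooted cacti of level 4 + m.  The Boolean tag distinguishes the second child of a fork
-- from the third; it is inherited from the first child, which contains the root.
family : ∀ m → Bool → Fin (count m) → Cactus (4 + m)
children : ∀ m → Bool → Fin (count m) → Fin 3 → Cactus (3 + m)
family m b q = fork (children m b q)
-- The bit is stored in both remaining children, so it can be read off even if an isomorphism swaps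
-- them.
children zero    b q = three (cactus₃ b) (cactus₃ (bit q)) (cactus₃ (bit q))
children (suc m) b q = three (family m b (digit q 0F)) (family m false (digit q 1F)) (family m true (digit q 2F))

children-Full : ∀ m b q i → Full (children m b q i)
children-Full zero    b q = all-three {P = Full} (cactus₃-Full b) (cactus₃-Full (bit q)) (cactus₃-Full (bit q))
children-Full (suc m) b q = all-three {P = Full}
  (fork-Full (children m _ _) (children-Full m b (digit q 0F)))
  (fork-Full (children m _ _) (children-Full m false (digit q 1F)))
  (fork-Full (children m _ _) (children-Full m true (digit q 2F)))

family-Full : ∀ m b q → Full (family m b q)
family-Full m b q = fork-Full (children m b q) (children-Full m b q)

-- The fixed root lies in the first child, so this child is preserved and returns the tag. The other
-- two could only be swapped, which their different tags forbid above the lowest level; each child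
-- then yields its digit.
family-inj : ∀ m b q b′ q′ → RootedIso (family m b q) (family m b′ q′) → b ≡ b′ × q ≡ q′
family-inj m b q b′ q′ (φ , φ-spine) = decode m b q b′ q′ at
  where
  open ForkDecode (children m b q) (children m b′ q′) (children-Full m b q) (children-Full m b′ q′) φ
  at : ∃ λ (π : Fin 3 → Fin 3) → π 0F ≡ 0F × (∀ i → π (suc i) ≢ 0F) × (∀ i j → π i ≡ j → RootedIso (children m b q i) (children m b′ q′ j))
  at = part , part0 , (λ i e → case part-inj (trans e (sym part0)) of λ ()) , λ i j e → subst (λ j → RootedIso (children m b q i) (children m b′ q′ j)) e (child-iso i)
    where
    part0 : part 0F ≡ 0F
    part0 = cong proj₁ φ-spine
  decode : ∀ m b q b′ q′ →
    (∃ λ (π : Fin 3 → Fin 3) → π 0F ≡ 0F × (∀ i → π (suc i) ≢ 0F) × (∀ i j → π i ≡ j → RootedIso (children m b q i) (children m b′ q′ j))) → b ≡ b′ × q ≡ q′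
  decode zero b q b′ q′ (π , π0 , π≢0 , iso) = cactus₃-inj b b′ (proj₁ (iso 0F 0F π0)) , second (π 1F) refl
    where
    second : ∀ j → π 1F ≡ j → q ≡ q′
    second 0F e = contradiction e (π≢0 0F)
    second 1F e = bit-inj (cactus₃-inj (bit q) (bit q′) (proj₁ (iso 1F 1F e)))
    second 2F e = bit-inj (cactus₃-inj (bit q) (bit q′) (proj₁ (iso 1F 2F e)))
  decode (suc m) b q b′ q′ (π , π0 , π≢0 , iso) = proj₁ first , digit-inj q q′ λ where
      0F → proj₂ first
      1F → second (π 1F) refl
      2F → third (π 2F) refl
    where
    first = family-inj m b (digit q 0F) b′ (digit q′ 0F) (iso 0F 0F π0)
    second : ∀ j → π 1F ≡ j → digit q 1F ≡ digit q′ 1F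
    second 0F e = contradiction e (π≢0 0F)
    second 1F e = proj₂ (family-inj m false (digit q 1F) false (digit q′ 1F) (iso 1F 1F e))
    second 2F e = contradiction (proj₁ (family-inj m false (digit q 1F) true (digit q′ 2F) (iso 1F 2F e))) λ ()
    third : ∀ j → π 2F ≡ j → digit q 2F ≡ digit q′ 2F
    third 0F e = contradiction e (π≢0 1F)
    third 1F e = contradiction (proj₁ (family-inj m true (digit q 2F) false (digit q′ 1F) (iso 2F 1F e))) λ ()
    third 2F e = proj₂ (family-inj m true (digit q 2F) true (digit q′ 2F) (iso 2F 2F e))

crown-children : ∀ m → Fin (count m) → Fin 3 → Cactus (4 + m)
crown-children m q = three (family m false q) (family m false q) (family m true q)

-- Turns rooted classes into unrooted ones. Only the third child has the tag `true`, so every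
-- isomorphism of crowns maps third child to third child, and it respects the roots of the children.
crown : ∀ m → Fin (count m) → Cactus (5 + m)
crown m q = fork (crown-children m q)

crown-inj : ∀ m q q′ → GraphIso (cadj (crown m q)) (cadj (crown m q′)) → q ≡ q′
crown-inj m q q′ φ = third (part 2F) refl
  where
  full : ∀ q i → Full (crown-children m q i)
  full q = all-three {P = Full} (family-Full m false q) (family-Full m false q) (family-Full m true q)
  open ForkDecode (crown-children m q) (crown-children m q′) (full q) (full q′) φ
  third : ∀ j → part 2F ≡ j → q ≡ q′
  third j e with subst (λ j → RootedIso (family m true q) (crown-children m q′ j)) e (child-iso 2F)
  third 0F e | ψ = contradiction (proj₁ (family-inj m true q false q′ ψ)) λ ()
  third 1F e | ψ = contradiction (proj₁ (family-inj m true q false q′ ψ)) λ ()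
  third 2F e | ψ = proj₂ (family-inj m true q true q′ ψ)

count-2^ : ∀ m → count m ≡ 2 ^ (3 ^ m)
count-2^ zero    = refl
count-2^ (suc m) = trans (cong (λ c → c * (c * c)) (count-2^ m)) (sym (trans (ℕₚ.^-distribˡ-+-* 2 (3 ^ m) (3 ^ m + (3 ^ m + 0)))
  (cong (2 ^ (3 ^ m) *_) (trans (ℕₚ.^-distribˡ-+-* 2 (3 ^ m) (3 ^ m + 0)) (cong (λ z → 2 ^ (3 ^ m) * 2 ^ z) (ℕₚ.+-identityʳ (3 ^ m)))))))

-- Vertices with a twin or a pendant neighbour

Partnered : ∀ {V} → Gr V → V → Set
Partnered {V} G x = Σ V λ y → y ≢ x × Σ (V → Bool) λ X → Fac 1 G X × X x ≡ true × X y ≡ true × (∀ z → X z ≡ true → z ≡ x ⊎ z ≡ y)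

Partnered-push : ∀ {V W} {G : Gr V} {H : Gr W} (E : CutEquiv G H) {x} → Partnered G x → Partnered H (CutEquiv.to E x)
Partnered-push E {x} (y , y≢x , X , f , Xx , Xy , only) =
  to y , (λ e → y≢x (trans (sym (from-to y)) (trans (cong from e) (from-to x)))) , X ∘ from , push f ,
  trans (cong X (from-to x)) Xx , trans (cong X (from-to y)) Xy , λ z e →
    Sum.map (λ h → trans (sym (to-from z)) (cong to h)) (λ h → trans (sym (to-from z)) (cong to h)) (only (from z) e)
  where open CutEquiv E

corona-Partnered : ∀ {C : Set} (_≟ᵥ_ : DecidableEquality C) H x → Partnered (corona _≟ᵥ_ H) x
corona-Partnered _≟ᵥ_ H (c , s) = (c , not s) , (λ e → not≢ s (cong proj₂ e)) , pairOf _≟ᵥ_ c , Fac-pair _≟ᵥ_ H c ,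
  dec-true (c ≟ᵥ c) refl , dec-true (c ≟ᵥ c) refl , only
  where
  cases : ∀ s t → t ≡ s ⊎ t ≡ not s
  cases false false = inj₁ refl
  cases false true  = inj₂ refl
  cases true  false = inj₂ refl
  cases true  true  = inj₁ refl
  only : ∀ z → does (proj₁ z ≟ᵥ c) ≡ true → z ≡ (c , s) ⊎ z ≡ (c , not s)
  only (d , t) e with does-true (d ≟ᵥ c) e
  ... | refl = Sum.map (cong (c ,_)) (cong (c ,_)) (cases s t)

coronaTree-Partnered : ∀ {k} (T : Cactus k) x → Partnered (adj (coronaTree T)) x
coronaTree-Partnered {k} T x = subst (Partnered (adj (coronaTree T))) (CutEquiv.to-from E x)
  (Partnered-push E (corona-Partnered (site-≟ k) (cadj T) (CutEquiv.from E x)))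
  where E = coronaTree-CutEquiv T

spineCactus : ∀ k → Cactus k
spineCactus zero    = leaf
spineCactus (suc k) = fork λ _ → spineCactus k

spineTree : ∀ k → Tree Bool k
spineTree k = coronaTree (spineCactus k)

twistedRoots : ∀ k → Fin 3 → Vertex Bool k
twistedRoots k = three (pack k (spine k , false)) (pack k (spine k , true)) (pack k (spine k , true))

-- A second graph for the levels below the crowns: one root is moved to a pendant vertex, so that
-- the graph is no longer a corona.
twisted : ∀ k → Tree Bool (suc k)
twisted k = node (λ _ → spineTree k) (twistedRoots k)

module _ (k : ℕ) where
  private
    l = suc k
    open Join (vertex-≟ l) (λ _ → adj (spineTree l)) (twistedRoots l)
    b : Vertex Bool (suc l)
    b = 0F , pack l (spine l , false)
    isRoot-root : ∀ i → isRoot (i , twistedRoots l i) ≡ true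
    isRoot-root i = dec-true (vertex-≟ l (twistedRoots l i) (twistedRoots l i)) refl
    corona-adj : ∀ i x y → join (i , pack l x) (i , pack l y) ≡ corona (site-≟ l) (cadj (spineCactus l)) x y
    corona-adj i x y = trans (join-≡ i (pack l x) (pack l y)) (sym (coronaTree-adj (spineCactus l) x y))

  -- The pendant vertex b used as a root separates the two vertices of its pair.
  twisted-unpartnered : ¬ Partnered (adj (twisted l)) b
  twisted-unpartnered (y , y≢b , X , f , Xb , Xy , only) = refute y y≢b Xy outside
    where
    outside : ∀ z → z ≢ b → z ≢ y → X z ≡ false
    outside z z≢b z≢y with X z in Xz
    ... | false = refl
    ... | true with only z Xz
    ... | inj₁ e = contradiction e z≢b
    ... | inj₂ e = contradiction e z≢y
    refute : ∀ y → y ≢ b → X y ≡ true → (∀ z → z ≢ b → z ≢ y → X z ≡ false) → ⊥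
    -- In the same part: `b` is adjacent to the root `x′` of another part, and `y` is not. Since `y`
    -- has some neighbour outside `X`, rank one is impossible.
    refute (0F , v) y≢b Xy outside = subst (λ v → (0F , v) ≢ b → X (0F , v) ≡ true → (∀ z → z ≢ b → z ≢ (0F , v) → X z ≡ false) → ⊥)
      (pack-unpack l v) (λ y≢b Xy outside → same-part _ _ y≢b Xy outside (site-≟ l _ (spine l))) y≢b Xy outside
      where
      x′ : Vertex Bool (suc l)
      x′ = 1F , twistedRoots l 1F
      same-part : ∀ d t → (0F , pack l (d , t)) ≢ b → X (0F , pack l (d , t)) ≡ true → (∀ z → z ≢ b → z ≢ (0F , pack l (d , t)) → X z ≡ false) → Dec (d ≡ spine l) → ⊥
      same-part d t y≢b Xy outside d≟ = true≢false (trans (sym (Fac₁-entry f {b} {y₀} {x′} Xb Xy (outside x′ (λ ()) (λ ())) (proj₁ (proj₂ nbr))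
          (cong₂ _∧_ (isRoot-root 0F) (isRoot-root 1F)) (proj₂ (proj₂ nbr))))
          (trans (join-≢ {0F} {1F} (pack l (d , t)) (twistedRoots l 1F) (λ ())) (cong (_∧ isRoot x′) (dec-false (vertex-≟ l (pack l (d , t)) (twistedRoots l 0F)) (λ e → y≢b (cong (0F ,_) e))))))
        where
        y₀ : Vertex Bool (suc l)
        y₀ = 0F , pack l (d , t)
        packed : ∀ {x y} → (0F , pack l x) ≡ (0F , pack l y) → x ≡ y
        packed e = pack-inj l (cong proj₂ e)
        find : ∀ d t → (d , t) ≢ (spine l , false) → Dec (d ≡ spine l) → Σ (Site l × Bool) λ z → z ≢ (spine l , false) × z ≢ (d , t) × corona (site-≟ l) (cadj (spineCactus l)) (d , t) z ≡ true
        find d t     h (no d≢)    = (d , not t) , (λ e → d≢ (cong proj₁ e)) , (λ e → not≢ t (cong proj₂ e)) , corona-bar (site-≟ l) (cadj (spineCactus l)) (d , t)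
        find d false h (yes refl) = contradiction refl h
        -- Here the partner of `y` is `b`, which lies in `X`, so a neighbour in another child serves
        -- instead. It exists because `l` is at least 1.
        find d true  h (yes refl) = ((1F , spine k) , true) , (λ ()) , (λ ()) ,
          trans (corona-≢ (site-≟ l) (cadj (spineCactus l)) {spine l} {1F , spine k} true true (λ ()))
            (cong₂ _∧_ (dec-true (site-≟ k (spine k) (spine k)) refl) (dec-true (site-≟ k (spine k) (spine k)) refl))
        nbr : Σ (Vertex Bool (suc l)) λ z → X z ≡ false × join y₀ z ≡ true
        nbr with find d t (λ e → y≢b (cong (λ z → 0F , pack l z) e)) d≟
        ... | z , z≢b , z≢y , e = (0F , pack l z) , outside _ (z≢b ∘ packed) (z≢y ∘ packed) , trans (corona-adj 0F (d , t) z) e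
    -- In another part: `b` is adjacent to its former pair vertex `x′`, which is no root and so has
    -- no neighbour in the part of `y`.
    refute (suc j , v) y≢b Xy outside = true≢false (trans (sym (Fac₁-entry f {b} {y₀} {x′} {y′} Xb Xy
        (outside x′ (λ e → true≢false (cong proj₂ (pack-inj l {spine l , true} {spine l , false} (cong proj₂ e)))) (λ ())) (outside y′ (λ ()) y′≢y)
        (trans (corona-adj 0F (spine l , false) (spine l , true)) (corona-≡ (site-≟ l) (cadj (spineCactus l)) (spine l) false true)) y-y′))
        (trans (join-≢ {suc j} {0F} v (pack l (spine l , true)) (λ ())) (trans (cong (isRoot y₀ ∧_) (dec-false (vertex-≟ l (pack l (spine l , true)) (twistedRoots l 0F)) λ e → true≢false (cong proj₂ (pack-inj l {spine l , true} {spine l , false} e)))) (∧-zeroʳ (isRoot y₀)))))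
      where
      y₀ x′ y′ : Vertex Bool (suc l)
      y₀ = suc j , v
      x′ = 0F , pack l (spine l , true)
      y′ = suc j , pack l (bar (unpack l v))
      y′≢y : y′ ≢ y₀
      y′≢y e = not≢ _ (cong proj₂ (trans (sym (unpack-pack l (bar (unpack l v)))) (cong (λ z → unpack l (proj₂ z)) e)))
      y-y′ : join y₀ y′ ≡ true
      y-y′ = trans (cong (λ z → join (suc j , z) y′) (sym (pack-unpack l v))) (trans (corona-adj (suc j) (unpack l v) (bar (unpack l v))) (corona-bar (site-≟ l) (cadj (spineCactus l)) (unpack l v)))

  spineTree≁twisted : ¬ CutEquiv (adj (spineTree (suc l))) (adj (twisted l))
  spineTree≁twisted E = twisted-unpartnered (subst (Partnered (adj (twisted l))) (CutEquiv.to-from E b)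
    (Partnered-push E (coronaTree-Partnered (spineCactus (suc l)) (CutEquiv.from E b))))

-- Families of obstructions and the bound on a characterizing list

record Obstructions (k : ℕ) : Set where
  field
    size     : ℕ
    large    : 2 ^ (1 * 3 ^ k) ≤ size ^ 243
    tree     : Fin size → Tree Bool k
    distinct : ∀ i j → i ≢ j → ¬ CutEquiv (adj (tree i)) (adj (tree j))

two-obstructions : ∀ k → suc (suc k) ≤ 5 → Obstructions (suc (suc k))
two-obstructions k k≤5 = record
  { size     = 2
  -- Two graphs give `2 ^ 243`, which is enough as long as the level is at most 5, because 243 =
  -- 3^5.
  ; large    = ℕₚ.^-monoʳ-≤ 2 (subst (_≤ 243) (sym (ℕₚ.*-identityˡ (3 ^ suc (suc k)))) (ℕₚ.^-monoʳ-≤ 3 k≤5))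
  ; tree     = tree
  ; distinct = distinct
  }
  where
  tree : Fin 2 → Tree Bool (suc (suc k))
  tree 0F = spineTree (suc (suc k))
  tree 1F = twisted (suc k)
  distinct : ∀ i j → i ≢ j → ¬ CutEquiv (adj (tree i)) (adj (tree j))
  distinct 0F 0F i≢j E = i≢j refl
  distinct 0F 1F i≢j E = spineTree≁twisted k E
  distinct 1F 0F i≢j E = spineTree≁twisted k (CutEquiv-sym E)
  distinct 1F 1F i≢j E = i≢j refl

crown-obstructions : ∀ m → Obstructions (5 + m)
crown-obstructions m = record
  { size     = count m
  -- Equality holds: `count m` is `2 ^ (3 ^ m)`, and 3^m times 243 is 3^(5+m).
  ; large    = ℕₚ.≤-reflexive (sym (trans (cong (_^ 243) (count-2^ m)) (trans (ℕₚ.^-*-assoc 2 (3 ^ m) 243)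
                 (cong (2 ^_) (trans (ℕₚ.*-comm (3 ^ m) 243) (trans (sym (ℕₚ.^-distribˡ-+-* 3 5 m)) (sym (ℕₚ.*-identityˡ (3 ^ (5 + m))))))))))
  ; tree     = λ q → coronaTree (crown m q)
  ; distinct = λ q q′ q≢q′ E → q≢q′ (crown-inj m q q′ (CutEquiv⇒cactusIso (crown m q) (crown m q′) E))
  }

obstructions : ∀ k → 2 ≤ k → Obstructions k
obstructions 2 _ = two-obstructions 0 (s≤s (s≤s z≤n))
obstructions 3 _ = two-obstructions 1 (s≤s (s≤s (s≤s z≤n)))
obstructions 4 _ = two-obstructions 2 (s≤s (s≤s (s≤s (s≤s z≤n))))
obstructions (suc (suc (suc (suc (suc m))))) _ = crown-obstructions m
obstructions 1 (s≤s ())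

¬¬-Fin : ∀ n {P : Fin n → Set} → (∀ i → ¬ ¬ P i) → ¬ ¬ (∀ i → P i)
¬¬-Fin zero    h k = k λ ()
¬¬-Fin (suc n) h k = h zero λ p₀ → ¬¬-Fin n (h ∘ suc) λ p → k λ { zero → p₀ ; (suc i) → p i }

open Obstructions

module _ {k : ℕ} (Ω : Obstructions k) where

  obstruction : Fin (size Ω) → AGraph
  obstruction i = order-of k , treeGraph (tree Ω i)

  obstruction-minimal : ∀ i → VMMinimal (λ G → LrwGt k G) (proj₂ (obstruction i))
  obstruction-minimal i = treeGraph-LrwGt (tree Ω i) , λ H vm m<n gt →
    gt (LinearWidth≤⇒LrwLe H (Deletable-vm (treeGraph-simple (tree Ω i)) (treeGraph-Deletable (tree Ω i)) vm m<n))

  treeGraph-distinct : ∀ i j → i ≢ j → ¬ CutEquiv (treeGraph (tree Ω i)) (treeGraph (tree Ω j))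
  treeGraph-distinct i j i≢j E = distinct Ω i j i≢j
    (CutEquiv-trans (CutEquiv-sym (treeGraph-CutEquiv (tree Ω i))) (CutEquiv-trans E (treeGraph-CutEquiv (tree Ω j))))

  module _ (O : List AGraph) (O-simple : All (λ H → Simple (proj₂ H)) O)
           (O-char : ∀ (n : ℕ) (G : Graph n) → Simple G → (LrwLe k G ⇔ (¬ HasVMIn G O))) where

    member-LrwGt : ∀ {H} → H ∈ₗ O → LrwGt k (proj₂ H)
    member-LrwGt {n , H} H∈O le = Equivalence.to (O-char n H (All.lookup O-simple H∈O)) le
      ((n , H) , H∈O , n , H , vm-refl , ↔-id (Fin n) , λ _ _ → refl)

    -- The characterization forbids that no member of `O` occurs as a vertex-minor. A member that
    -- occurs has width larger than k, so by minimality it is not proper and has the same cut ranks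
    -- as the tree graph. The argument is by refutation, hence the double negation.
    represented : ∀ i → ¬ ¬ (Σ (Fin (length O)) λ o → CutEquiv (treeGraph (tree Ω i)) (proj₂ (List.lookup O o)))
    represented i none = treeGraph-LrwGt (tree Ω i) (Equivalence.from (O-char _ (treeGraph (tree Ω i)) simple) λ where
        ((n , H) , H∈O , m , H′ , vm , f , f-adj) → case vm-proper-or-CutEquiv simple vm of λ where
          (inj₁ m<n) → member-LrwGt H∈O (LinearWidth≤⇒LrwLe H (transport f f-adj (Deletable-vm simple (treeGraph-Deletable (tree Ω i)) vm m<n)))
          (inj₂ E)   → none (Any.index H∈O , subst (λ H → CutEquiv (treeGraph (tree Ω i)) (proj₂ H)) (lookup-index H∈O) (CutEquiv-trans E (CutEquiv-bijection f f-adj))))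
      where
      simple = treeGraph-simple (tree Ω i)
      transport : ∀ {m n} {H′ : Graph m} {H : Graph n} (f : Fin m ↔ Fin n) → (∀ x y → H′ x y ≡ H (Inverse.to f x) (Inverse.to f y)) →
        LinearWidth≤ k H′ → LinearWidth≤ k H
      transport {H = H} f f-adj (ℓ , width) =
        Layout-pull from (λ {x} {y} e → trans (sym (strictlyInverseˡ x)) (trans (cong to e) (strictlyInverseˡ y))) ℓ ,
        λ t → Fac-cong (λ x y → trans (f-adj (from x) (from y)) (cong₂ H (strictlyInverseˡ x) (strictlyInverseˡ y))) (λ _ → refl) (Fac-pull from (width t))
        where open Inverse f

    -- The comparison of numbers is decidable, so the finitely many double negations can be removed
    -- together. Two tree graphs represented by the same member would be cut-equivalent.
    size≤length : size Ω ≤ length O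
    size≤length with size Ω ≤? length O
    ... | yes h = h
    ... | no ¬h = contradiction (λ rep → collide rep) (¬¬-Fin (size Ω) represented)
      where
      collide : (∀ i → Σ (Fin (length O)) λ o → CutEquiv (treeGraph (tree Ω i)) (proj₂ (List.lookup O o))) → ⊥
      collide rep with pigeonhole (ℕₚ.≰⇒> ¬h) (proj₁ ∘ rep)
      ... | i , j , i<j , e = treeGraph-distinct i j (λ { refl → ℕₚ.<-irrefl refl i<j })
        (CutEquiv-trans (proj₂ (rep i)) (CutEquiv-sym (subst (λ o → CutEquiv (treeGraph (tree Ω j)) (proj₂ (List.lookup O o))) (sym e) (proj₂ (rep j)))))

theorem1p3 : Σ ℕ λ a → Σ ℕ λ b → 0 < a × 0 < b ×
    ((∀ (k : ℕ) → 2 ≤ k →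
    Σ ℕ λ L → 2 ^ (a * 3 ^ k) ≤ L ^ b ×
    Σ (Fin L → AGraph) λ F →
    (∀ i → Simple (proj₂ (F i)) × VMMinimal (λ G → LrwGt k G) (proj₂ (F i))) ×
    (∀ i j → i ≢ j → ¬ LocEqUpToIso (proj₂ (F i)) (proj₂ (F j))))
    ×
    (∀ (k : ℕ) → 2 ≤ k → (O : List AGraph) →
    All (λ H → Simple (proj₂ H)) O →
    (∀ (n : ℕ) (G : Graph n) → Simple G → (LrwLe k G ⇔ (¬ HasVMIn G O))) →
    2 ^ (a * 3 ^ k) ≤ length O ^ b))
theorem1p3 = 1 , 243 , s≤s z≤n , s≤s z≤n , many , bounded
  where
  many = λ k 2≤k → size (obstructions k 2≤k) , large (obstructions k 2≤k) , obstruction (obstructions k 2≤k) ,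
    (λ i → treeGraph-simple (tree (obstructions k 2≤k) i) , obstruction-minimal (obstructions k 2≤k) i) ,
    (λ i j i≢j e → treeGraph-distinct (obstructions k 2≤k) i j i≢j (LocEqUpToIso⇒CutEquiv (treeGraph-simple (tree (obstructions k 2≤k) i)) e))
  bounded = λ k 2≤k O O-simple O-char →
    ≤-trans (large (obstructions k 2≤k)) (ℕₚ.^-monoˡ-≤ 243 (size≤length (obstructions k 2≤k) O O-simple O-char))
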